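{- Let $r \geq 5$. If $G$ is a $2$-geodetic digraph with order $n = 2r+1$, size $r^2+2$ and no sources or sinks, then $G$ is isomorphic to one of $A_r$, $B_{r,0}$, $B_{r,r-1}$, $C_r$, $D_r$, or to one of $B_{r,t}$, $B'_{r,t}$ for some $1 \leq t \leq r-2$. The digraphs in this list are pairwise non-isomorphic, so there are exactly $2r+1$ such digraphs up to isomorphism.
   Context: A digraph has a vertex set and an arc set consisting of ordered pairs of distinct vertices. A walk of length $\ell$ is a sequence $x_0x_1\dots x_\ell$ of vertices with $x_i \rightarrow x_{i+1}$ for all $i$. A digraph is $k$-geodetic if for every ordered pair $(u,v)$ of (not necessarily distinct) vertices there is at most one $u,v$-walk of length at most $k$. A source has in-degree $0$, a sink out-degree $0$. Order = number of vertices, size = number of arcs. All the digraphs below have vertex set $\{x,y,z\} \cup \{x_1,\dots,x_{r-1}\} \cup \{y_1,\dots,y_{r-1}\}$, contain the directed triangle $x \rightarrow y \rightarrow z \rightarrow x$, and between $X=\{x_1,\dots,x_{r-1}\}$ and $Y=\{y_1,\dots,y_{r-1}\}$ contain exactly one arc for each pair $(x_i,y_j)$: namely $y_j \rightarrow x_i$ for all $i \neq j$, while the direction of the arc between $x_i$ and $y_i$ is specified below. There are no other arcs than those listed. $A_r$: $x_i \rightarrow y_i$ for $1 \le i \le r-2$, $y_{r-1} \rightarrow x_{r-1}$; $x_{r-1} \rightarrow x$; $x \rightarrow x_i$ for $1 \le i \le r-2$; $y \rightarrow y_{r-1}$; $y_i \rightarrow y$ for $1 \le i \le r-2$. $B_{r,t}$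 ($0 \le t \le r-1$): $x_i \rightarrow y_i$ for all $1 \le i \le r-1$; $x \rightarrow x_i$ for all $1 \le i \le r-1$; $y_i \rightarrow y$ for $1 \le i \le t$; $y_i \rightarrow z$ for $t+1 \le i \le r-1$. $B'_{r,t}$ is the converse of $B_{r,t}$ (all arcs reversed). $C_r$: $x_i \rightarrow y_i$ for $1 \le i \le r-2$, $y_{r-1} \rightarrow x_{r-1}$; $z \rightarrow y_{r-1}$; $x_{r-1} \rightarrow z$; $y \rightarrow x_i$ for $1 \le i \le r-2$; $y_i \rightarrow x$ for $1 \le i \le r-2$. $D_r$: $x_i \rightarrow y_i$ for all $1 \le i \le r-1$; $z \rightarrow x_1$; $y_1 \rightarrow z$; $y \rightarrow x_i$ for $2 \le i \le r-1$; $y_i \rightarrow x$ for $2 \le i \le r-1$. -}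

module Defs where

open import Data.Nat using (ℕ; zero; suc; _+_; _*_; _∸_; _^_; _≤_; _<ᵇ_; _≡ᵇ_)
open import Data.Bool using (Bool; true; false; if_then_else_; _∧_; _∨_; not; T)
open import Data.Fin using (Fin; toℕ)
open import Data.List using (List; []; _∷_; length; map; allFin)
open import Data.Nat.ListAction using (sum)
open import Data.Product using (Σ; ∃; _×_; _,_)
open import Function.Bundles using (_↔_; Inverse)
open import Relation.Binary.PropositionalEquality using (_≡_)

Digraph : ℕ → Set
Digraph n = Fin n → Fin n → Bool

Loopless : ∀ {n} → Digraph n → Set
Loopless G = ∀ v → G v v ≡ false

size : ∀ {n} → Digraph n → ℕ
size {n} G = sum (map (λ u → sum (map (λ v → if G u v then 1 else 0) (allFin n))) (allFin n))

-- WalkFrom G u xs v : the vertex sequence u ∷ xs is a u,v-walk of length (length xs).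
data WalkFrom {n} (G : Digraph n) : Fin n → List (Fin n) → Fin n → Set where
  stop : ∀ {u} → WalkFrom G u [] u
  step : ∀ {u w xs v} → T (G u w) → WalkFrom G w xs v → WalkFrom G u (w ∷ xs) v

Geodetic : ∀ {n} → ℕ → Digraph n → Set
Geodetic {n} k G = ∀ (u v : Fin n) (xs ys : List (Fin n)) →
  length xs ≤ k → length ys ≤ k →
  WalkFrom G u xs v → WalkFrom G u ys v → xs ≡ ys

NoSources : ∀ {n} → Digraph n → Set
NoSources {n} G = ∀ (v : Fin n) → ∃ λ u → G u v ≡ true

NoSinks : ∀ {n} → Digraph n → Set
NoSinks {n} G = ∀ (v : Fin n) → ∃ λ w → G v w ≡ true

Iso : ∀ {n} → Digraph n → Digraph n → Set
Iso {n} G H = Σ (Fin n ↔ Fin n) λ f →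
  ∀ u v → G u v ≡ H (Inverse.to f u) (Inverse.to f v)

Qualifies : (r : ℕ) → Digraph (2 * r + 1) → Set
Qualifies r G = Loopless G × Geodetic 2 G × size G ≡ r ^ 2 + 2 × NoSources G × NoSinks G

-- The catalogue.  Vertex labels: x, y, z, x_i, y_i (1 ≤ i ≤ r-1).

data Lab : Set where
  lx ly lz : Lab
  lX lY : ℕ → Lab

-- Labelling of Fin (2r+1): 0 ↦ x, 1 ↦ y, 2 ↦ z, 3..r+1 ↦ x_1..x_{r-1}, r+2..2r ↦ y_1..y_{r-1}.
decodeℕ : ℕ → ℕ → Lab
decodeℕ r 0 = lx
decodeℕ r 1 = ly
decodeℕ r 2 = lz
decodeℕ r (suc (suc (suc j))) =
  if j <ᵇ (r ∸ 1) then lX (suc j) else lY (suc (j ∸ (r ∸ 1)))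

decode : (r : ℕ) → Fin (2 * r + 1) → Lab
decode r k = decodeℕ r (toℕ k)

_≠ᵇ_ : ℕ → ℕ → Bool
i ≠ᵇ j = not (i ≡ᵇ j)

common : (ℕ → Bool) → Lab → Lab → Bool
common diag lx ly = true
common diag ly lz = true
common diag lz lx = true
common diag (lX i) (lY j) = (i ≡ᵇ j) ∧ diag i
common diag (lY j) (lX i) = (i ≠ᵇ j) ∨ not (diag i)
common diag _ _ = false

small : ℕ → ℕ → Bool
small r i = i <ᵇ (r ∸ 1)

arcA : ℕ → Lab → Lab → Bool
arcA r (lX i) lx = i ≡ᵇ (r ∸ 1)
arcA r lx (lX i) = small r i
arcA r ly (lY i) = i ≡ᵇ (r ∸ 1)
arcA r (lY i) ly = small r i
arcA r u v = common (small r) u v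

arcB : ℕ → ℕ → Lab → Lab → Bool
arcB r t lx (lX i) = true
arcB r t (lY i) ly = i <ᵇ suc t
arcB r t (lY i) lz = t <ᵇ i
arcB r t u v = common (λ _ → true) u v

arcB' : ℕ → ℕ → Lab → Lab → Bool
arcB' r t u v = arcB r t v u

arcC : ℕ → Lab → Lab → Bool
arcC r lz (lY i) = i ≡ᵇ (r ∸ 1)
arcC r (lX i) lz = i ≡ᵇ (r ∸ 1)
arcC r ly (lX i) = small r i
arcC r (lY i) lx = small r i
arcC r u v = common (small r) u v

arcD : ℕ → Lab → Lab → Bool
arcD r lz (lX i) = i ≡ᵇ 1
arcD r (lY i) lz = i ≡ᵇ 1
arcD r ly (lX i) = 1 <ᵇ i
arcD r (lY i) lx = 1 <ᵇ i
arcD r u v = common (λ _ → true) u v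

-- Names of the 2r+1 digraphs in the list.
-- nB i / nB' i stand for B_{r,t} / B'_{r,t} with t = toℕ i + 1, so 1 ≤ t ≤ r-2.
data Name (r : ℕ) : Set where
  nA nB0 nBlast nC nD : Name r
  nB nB' : Fin (r ∸ 2) → Name r

labArcs : (r : ℕ) → Name r → Lab → Lab → Bool
labArcs r nA = arcA r
labArcs r nB0 = arcB r 0
labArcs r nBlast = arcB r (r ∸ 1)
labArcs r nC = arcC r
labArcs r nD = arcD r
labArcs r (nB i) = arcB r (suc (toℕ i))
labArcs r (nB' i) = arcB' r (suc (toℕ i))

family : (r : ℕ) → Name r → Digraph (2 * r + 1)
family r nm u v = labArcs r nm (decode r u) (decode r v)

{-# OPTIONS --safe #-}
module Submission where

open import Defs
open import Data.Nat.Properties hiding (_≟_; suc-injective)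
open import Algebra.Properties.Semiring.Sum +-*-semiring
  using (sum; sum-syntax; sum-cong-≗; ∑-distrib-+; ∑-comm; ∑-permute; *-distribˡ-sum; *-distribʳ-sum)
open import Data.Bool using (Bool; true; false; if_then_else_; _∧_; _∨_; not) renaming (T to IsTrue)
open import Data.Bool.ListAction using (any; all)
import Data.Bool.Properties as Bool
open import Data.Empty using (⊥; ⊥-elim)
open import Data.Fin using (Fin; zero; suc; toℕ; fromℕ<; inject≤; _↑ˡ_; _↑ʳ_; splitAt; cast)
open import Data.Fin.Patterns using (0F; 1F; 2F; 3F; 4F)
open import Data.Fin.Permutation using (Permutation′; _⟨$⟩ʳ_; _∘ₚ_; transpose)
import Data.Fin.Permutation as Perm
open import Data.Fin.Properties using (_≟_; suc-injective; any?; all?; pigeonhole) renaming (<⇒≢ to <⇒≢-Fin)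
import Data.Fin.Properties as Fin
open import Data.List using (List; []; _∷_; map; tabulate; allFin; filterᵇ; cartesianProduct; cartesianProductWith)
open import Data.List.Membership.Propositional using (_∈_)
open import Data.List.Membership.Propositional.Properties
  using (∈-cartesianProductWith⁺; ∈-cartesianProduct⁺; ∈-allFin)
open import Data.List.Properties using (map-tabulate; ∷-injectiveˡ)
open import Data.List.Relation.Unary.All using (All; []; _∷_; universal) renaming (map to mapAll)
open import Data.List.Relation.Unary.Any using (here; there)
open import Data.Nat using (ℕ; zero; suc; pred; _+_; _*_; _^_; _≤_; _<_; _≤?_; _<ᵇ_; _≡ᵇ_; z≤n; s≤s)
import Data.Nat.ListAction as List
import Data.Nat.Properties as ℕ using (suc-injective)
open import Data.Nat.Tactic.RingSolver using (solve-∀)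
open import Data.Product using (∃; ∃₂; _×_; _,_; proj₁; proj₂)
import Data.Product.Properties as Product
open import Data.Sum using (_⊎_; inj₁; inj₂; [_,_]′)
import Data.Sum as Sum
open import Function using (_∘_; id)
open import Function.Bundles using (_↔_; Inverse; Equivalence; mk⤖; mk↔ₛ′)
open import Function.Construct.Composition using (_↔-∘_)
open import Function.Construct.Symmetry using (↔-sym)
open import Function.Properties.Bijection using (⤖⇒↔)
open import Relation.Binary using (DecidableEquality)
open import Relation.Binary.PropositionalEquality
open import Relation.Nullary using (¬?; Dec; does; yes; no; contradiction; _×-dec_)
open import Relation.Nullary.Decidable using (map′; toWitness)

-- Every edge of the underlying graph lies in at most one triangle, so a vertex off a triangle is joined to
-- at most one of its corners.  If there were no triangle, an edge of degree sum at least 2r would force the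
-- graph to be bipartite, and counting the 2-walks with both ends in the smaller part is incompatible with the
-- absence of sources and sinks.  Deleting a directed triangle leaves at least s² edges on 2s = 2(r − 1)
-- vertices; by a Mantel argument (a second triangle would cost too many edges once s ≥ 4) what remains is
-- K_{s,s}, and every vertex of it is joined to exactly one corner.
--
-- Between the two sides the arcs of one direction form a partial matching, so the digraph is encoded by one
-- state for each of s pairs (x_i , y_i).  2-geodecity constrains pairs of states only, and a finite search
-- shows that any four pairwise compatible states use one of six pairs of states up to rotation of the triangle.
-- These are the digraphs of the list, C occurring twice because it has two triangles.  The list is separated by
-- the degrees of the corners: in B the in-degree of the only predecessor of the vertex of out-degree r gives t.

-- Mantel's bound for `2 r + 1` vertices is `r² + r`, well above the size `r² + 2`, so the whole
-- graph offers no rigidity. Removing a triangle creates it: this costs three sides and at most one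
-- edge for each of the `2 s` other vertices, and `r² + 2 − 3 − 2 s = s²` is exactly Mantel's bound
-- for `2 s` vertices. All estimates are then equalities. An edge lies in at most one triangle
-- because a transitive triangle is a shortcut, while two directed triangles on an arc u → v give
-- two walks of length 2 from v to u. Besides excluding a second triangle, `s ≥ 4` serves twice
-- more: four columns against three classes show that one direction between the sides is sparse, and
-- the search looks at four indices at once. Four suffice globally since a kind has only two states:
-- two indices with different states determine both, and every further index can be tested along
-- with them.

private variable
  n : ℕ

-- Finite sums and counting

𝟙 : Bool → ℕ
𝟙 b = if b then 1 else 0

count : (Fin n → Bool) → ℕ
count p = ∑[ i < _ ] 𝟙 (p i)

_==_ : Fin n → Fin n → Bool
i == j = does (i ≟ j)

==-refl : (i : Fin n) → (i == i) ≡ true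
==-refl i with i ≟ i
... | yes _ = refl
... | no ne = contradiction refl ne

==⇒≡ : {i j : Fin n} → (i == j) ≡ true → i ≡ j
==⇒≡ {i = i} {j} h with i ≟ j
... | yes e = e

≢⇒== : {i j : Fin n} → i ≢ j → (i == j) ≡ false
≢⇒== {i = i} {j} h with i ≟ j
... | yes e = contradiction e h
... | no _ = refl

true≢false : {A : Set} {b : Bool} → b ≡ true → b ≡ false → A
true≢false refl ()

∧-true : ∀ {a b} → a ∧ b ≡ true → a ≡ true × b ≡ true
∧-true {true} {true} _ = refl , refl

¬true⇒false : ∀ {b} → b ≢ true → b ≡ false
¬true⇒false {true} h = contradiction refl h
¬true⇒false {false} h = refl

not-true : ∀ {b} → not b ≡ true → b ≡ false
not-true {false} _ = refl

not-false : ∀ {b} → not b ≡ false → b ≡ true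
not-false {true} _ = refl

𝟙≤1 : ∀ b → 𝟙 b ≤ 1
𝟙≤1 true = ≤-refl
𝟙≤1 false = z≤n

sum-mono : {f g : Fin n → ℕ} → (∀ i → f i ≤ g i) → sum f ≤ sum g
sum-mono {zero} h = z≤n
sum-mono {suc n} h = +-mono-≤ (h zero) (sum-mono (h ∘ suc))

-- The equality case of the counting bounds: this is how a tight estimate is turned into information
-- about each vertex or edge.
sum-tight : {f g : Fin n → ℕ} → (∀ i → f i ≤ g i) → sum g ≤ sum f → ∀ i → f i ≡ g i
sum-tight {suc n} {f} {g} h le = λ where
    zero → ≤-antisym (h zero) (+-cancelʳ-≤ _ _ _ (≤-trans (+-monoʳ-≤ (g zero) (sum-mono (h ∘ suc))) le))
    (suc i) → sum-tight (h ∘ suc)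
      (+-cancelˡ-≤ (f zero) _ _ (≤-trans (+-monoˡ-≤ _ (h zero)) le)) i

sum-zero : {f : Fin n → ℕ} → (∀ i → f i ≡ 0) → sum f ≡ 0
sum-zero {zero} h = refl
sum-zero {suc n} h = cong₂ _+_ (h zero) (sum-zero (h ∘ suc))

sum-const : ∀ n c → sum {n} (λ _ → c) ≡ n * c
sum-const zero c = refl
sum-const (suc n) c = cong (c +_) (sum-const n c)

sum-δ : (x : Fin n) (g : Fin n → ℕ) → ∑[ i < n ] (𝟙 (i == x) * g i) ≡ g x
sum-δ {suc n} zero g = trans (cong₂ _+_ (+-identityʳ (g zero)) (sum-zero {n} (λ _ → refl))) (+-identityʳ (g zero))
sum-δ {suc n} (suc x) g = sum-δ x (g ∘ suc)

count-δ : (x : Fin n) → count (_== x) ≡ 1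
count-δ x = trans (sum-cong-≗ (λ i → sym (*-identityʳ (𝟙 (i == x))))) (sum-δ x (λ _ → 1))

member≤sum : (f : Fin n → ℕ) (i : Fin n) → f i ≤ sum f
member≤sum f zero = m≤m+n _ _
member≤sum f (suc i) = ≤-trans (member≤sum (f ∘ suc) i) (m≤n+m _ _)

count≡0 : {p : Fin n → Bool} → (∀ i → p i ≡ false) → count p ≡ 0
count≡0 h = sum-zero (λ i → cong 𝟙 (h i))

count≤1 : {p : Fin n → Bool} → (∀ i j → p i ≡ true → p j ≡ true → i ≡ j) → count p ≤ 1
count≤1 {zero} h = z≤n
count≤1 {suc n} {p} h with p zero in eq
... | true = ≤-reflexive (cong suc (count≡0 λ i → ¬true⇒false λ e → contradiction (h zero (suc i) eq e) λ ()))
... | false = count≤1 {n} {p ∘ suc} λ i j a b → suc-injective (h (suc i) (suc j) a b)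

count-witness : {p : Fin n → Bool} → 1 ≤ count p → ∃ λ i → p i ≡ true
count-witness {suc n} {p} h with p zero in eq
... | true = zero , eq
... | false = let i , e = count-witness {n} {p ∘ suc} h in suc i , e

size-sum : (G : Digraph n) → size G ≡ ∑[ u < n ] ∑[ v < n ] 𝟙 (G u v)
size-sum {n} G = trans (go _) (sum-cong-≗ {n} (λ u → go _))
  where
  tabulate-sum : ∀ {m} (f : Fin m → ℕ) → List.sum (tabulate f) ≡ sum f
  tabulate-sum {zero} f = refl
  tabulate-sum {suc m} f = cong (f zero +_) (tabulate-sum (f ∘ suc))
  go : (f : Fin n → ℕ) → List.sum (map f (allFin n)) ≡ sum f
  go f = trans (cong List.sum (map-tabulate id f)) (tabulate-sum f)

record Enumeration (p : Fin n → Bool) (k : ℕ) : Set where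
  field
    elem : Fin k → Fin n
    sound : ∀ i → p (elem i) ≡ true
    injective : ∀ {i j} → elem i ≡ elem j → i ≡ j
    complete : ∀ v → p v ≡ true → ∃ λ i → elem i ≡ v

enumerate : (p : Fin n → Bool) → Enumeration p (count p)
enumerate {zero} p = record { elem = λ () ; sound = λ () ; injective = λ { {()} } ; complete = λ () }
enumerate {suc n} p = extend (p zero) refl (enumerate (p ∘ suc))
  where
  extend : ∀ {k} b → p zero ≡ b → Enumeration (p ∘ suc) k → Enumeration p (𝟙 b + k)
  extend true eq R = record
    { elem = λ { zero → zero ; (suc i) → suc (elem i) }
    ; sound = λ { zero → eq ; (suc i) → sound i }
    ; injective = λ { {zero} {zero} _ → refl
                    ; {suc i} {suc j} e → cong suc (injective (suc-injective e)) }
    ; complete = λ { zero _ → zero , refl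
                   ; (suc v) h → let i , e = complete v h in suc i , cong suc e } }
    where open Enumeration R
  extend false eq R = record
    { elem = suc ∘ elem
    ; sound = sound
    ; injective = injective ∘ suc-injective
    ; complete = λ { zero h → true≢false h eq
                   ; (suc v) h → let i , e = complete v h in i , cong suc e } }
    where open Enumeration R

bijection : {A B : Set} (f : A → B) → (∀ {x y} → f x ≡ f y → x ≡ y) → (∀ y → ∃ λ x → f x ≡ y) → A ↔ B
bijection f inj surj = ⤖⇒↔ (mk⤖ {to = f} (inj , λ y → proj₁ (surj y) , λ { refl → proj₂ (surj y) }))

count-not : (p : Fin n → Bool) → count p + count (not ∘ p) ≡ n
count-not {n} p = trans (sym (∑-distrib-+ (𝟙 ∘ p) (𝟙 ∘ not ∘ p)))
  (trans (sum-cong-≗ (λ i → lem (p i))) (trans (sum-const n 1) (*-identityʳ n)))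
  where
  lem : ∀ b → 𝟙 b + 𝟙 (not b) ≡ 1
  lem true = refl
  lem false = refl

-- The elements satisfying q are sent to those satisfying p, both being enumerated by the same Fin.
matching-permutation : (p q : Fin n → Bool) → count p ≡ count q →
  ∃ λ (σ : Fin n ↔ Fin n) → ∀ i → p (Inverse.to σ i) ≡ q i
matching-permutation {n} p q eq = bijection σ σ-injective σ-surjective , σ-respects
  where
  eq' : count (not ∘ p) ≡ count (not ∘ q)
  eq' = +-cancelˡ-≡ (count p) _ _
    (trans (count-not p) (sym (trans (cong (_+ count (not ∘ q)) eq) (count-not q))))
  module P = Enumeration (subst (Enumeration p) eq (enumerate p))
  module P' = Enumeration (subst (Enumeration (not ∘ p)) eq' (enumerate (not ∘ p)))
  module Q = Enumeration (enumerate q)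
  module Q' = Enumeration (enumerate (not ∘ q))
  data View : Fin n → Set where
    isT : ∀ i → View (Q.elem i)
    isF : ∀ i → View (Q'.elem i)
  view : ∀ v → View v
  view v with q v in e
  ... | true with Q.complete v e
  ...   | i , refl = isT i
  view v | false with Q'.complete v (cong not e)
  ...   | i , refl = isF i
  σ' : ∀ {v} → View v → Fin n
  σ' (isT i) = P.elem i
  σ' (isF i) = P'.elem i
  σ : Fin n → Fin n
  σ v = σ' (view v)
  σ'-inj : ∀ {u v} (a : View u) (b : View v) → σ' a ≡ σ' b → u ≡ v
  σ'-inj (isT i) (isT j) e = cong Q.elem (P.injective e)
  σ'-inj (isT i) (isF j) e = true≢false (trans (cong p (sym e)) (P.sound i)) (not-true (P'.sound j))
  σ'-inj (isF i) (isT j) e = true≢false (trans (cong p e) (P.sound j)) (not-true (P'.sound i))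
  σ'-inj (isF i) (isF j) e = cong Q'.elem (P'.injective e)
  σ-injective : ∀ {u v} → σ u ≡ σ v → u ≡ v
  σ-injective = σ'-inj (view _) (view _)
  σ'-T : ∀ {v} (a : View v) i → v ≡ Q.elem i → σ' a ≡ P.elem i
  σ'-T (isT j) i e = cong P.elem (Q.injective e)
  σ'-T (isF j) i e = true≢false (trans (cong q e) (Q.sound i)) (not-true (Q'.sound j))
  σ'-F : ∀ {v} (a : View v) i → v ≡ Q'.elem i → σ' a ≡ P'.elem i
  σ'-F (isF j) i e = cong P'.elem (Q'.injective e)
  σ'-F (isT j) i e = true≢false (trans (cong q (sym e)) (Q.sound j)) (not-true (Q'.sound i))
  σ-surjective : ∀ y → ∃ λ x → σ x ≡ y
  σ-surjective y with p y in e
  ... | true = let i , h = P.complete y e in Q.elem i , trans (σ'-T (view _) i refl) h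
  ... | false = let i , h = P'.complete y (cong not e) in Q'.elem i , trans (σ'-F (view _) i refl) h
  σ-respects : ∀ v → p (σ v) ≡ q v
  σ-respects v with view v
  ... | isT i = trans (P.sound i) (sym (Q.sound i))
  ... | isF i = trans (not-true (P'.sound i)) (sym (not-true (Q'.sound i)))

-- If `g` hit every element, a choice of preimages would be an injection of `Fin n` into `Fin m`,
-- against the pigeonhole principle.
fresh : ∀ {m} → m < n → (g : Fin m → Fin n) → ∃ λ l → ∀ a → l ≢ g a
fresh {m} {n} m<n g with any? (λ l → all? (λ a → ¬? (l ≟ g a)))
... | yes found = found
... | no none = contradiction (trans (proj₂ (hit i)) (trans (cong g same) (sym (proj₂ (hit j))))) (<⇒≢-Fin i<j)
  where
  hit : ∀ l → ∃ λ a → l ≡ g a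
  hit l with any? (λ a → l ≟ g a)
  ... | yes e = e
  ... | no ne = contradiction (l , λ a e → ne (a , e)) none
  collision = pigeonhole m<n (proj₁ ∘ hit)
  i = proj₁ collision
  j = proj₁ (proj₂ collision)
  i<j = proj₁ (proj₂ (proj₂ collision))
  same = proj₂ (proj₂ (proj₂ collision))

-- Symmetric relations: degrees and edge bounds

Relation : ℕ → Set
Relation n = Fin n → Fin n → Bool

-- A book is a family of triangles sharing an edge; `BookFree` allows each edge a single page.
Symmetric Irreflexive TriangleFree BookFree : Relation n → Set
Symmetric E = ∀ u v → E u v ≡ E v u
Irreflexive E = ∀ u → E u u ≡ false
TriangleFree E = ∀ u v w → E u v ≡ true → E v w ≡ true → E u w ≡ true → ⊥
BookFree E = ∀ u v w w' → E u v ≡ true → E u w ≡ true → E v w ≡ true →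
  E u w' ≡ true → E v w' ≡ true → w ≡ w'

-- Only the first end is constrained; for the symmetric relations considered here the second
-- follows.
SupportedOn : Relation n → (Fin n → Bool) → Set
SupportedOn E S = ∀ u v → E u v ≡ true → S u ≡ true

deg : Relation n → Fin n → ℕ
deg E u = count (E u)

-- Twice the number of edges of a symmetric relation; counting both ends avoids any division.
vol : Relation n → ℕ
vol {n} E = ∑[ u < n ] deg E u

𝟙-∧ : ∀ a b → 𝟙 (a ∧ b) ≡ 𝟙 a * 𝟙 b
𝟙-∧ true b = sym (+-identityʳ (𝟙 b))
𝟙-∧ false b = refl

𝟙-mono : ∀ {a b} → (a ≡ true → b ≡ true) → 𝟙 a ≤ 𝟙 b
𝟙-mono {false} h = z≤n
𝟙-mono {true} h rewrite h refl = ≤-refl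

𝟙-injective : ∀ {a b} → 𝟙 a ≡ 𝟙 b → a ≡ b
𝟙-injective {true} {true} _ = refl
𝟙-injective {false} {false} _ = refl

2xy≤x²+y² : ∀ x y → 2 * (x * y) ≤ x * x + y * y
2xy≤x²+y² x y with ≤-total x y
... | inj₁ x≤y with m≤n⇒∃[o]m+o≡n x≤y
...   | k , refl = ≤-trans (m≤m+n _ (k * k)) (≤-reflexive (eq x k))
  where
  eq : ∀ x k → 2 * (x * (x + k)) + k * k ≡ x * x + (x + k) * (x + k)
  eq = solve-∀
2xy≤x²+y² x y | inj₂ y≤x with m≤n⇒∃[o]m+o≡n y≤x
...   | k , refl = ≤-trans (m≤m+n _ (k * k)) (≤-reflexive (eq y k))
  where
  eq : ∀ y k → 2 * ((y + k) * y) + k * k ≡ (y + k) * (y + k) + y * y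
  eq = solve-∀

∑∑-product : ∀ {m} (f : Fin n → ℕ) (g : Fin m → ℕ) → ∑[ u < n ] ∑[ v < m ] (f u * g v) ≡ sum f * sum g
∑∑-product {n} {m} f g = trans (sum-cong-≗ {n} (λ u → sym (*-distribˡ-sum (f u) g))) (sym (*-distribʳ-sum (sum g) f))

∑∑-distrib-+ : ∀ {m} (f g : Fin n → Fin m → ℕ) →
  ∑[ u < n ] ∑[ v < m ] (f u v + g u v) ≡ ∑[ u < n ] ∑[ v < m ] f u v + ∑[ u < n ] ∑[ v < m ] g u v
∑∑-distrib-+ {n} {m} f g = trans (sum-cong-≗ {n} (λ u → ∑-distrib-+ (f u) (g u))) (∑-distrib-+ (λ u → sum (f u)) (λ u → sum (g u)))

-- Summing (2d − c)² ≥ 0 over the support against Σ_{uv} (d u + d v) = 2 Σ d².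
light-edges : (E : Relation n) (S : Fin n → Bool) → Symmetric E → SupportedOn E S → ∀ c →
  (∀ u v → E u v ≡ true → deg E u + deg E v ≤ suc c) → 2 * vol E ≤ count S * suc c
light-edges {n} E S symm supp c light = *-cancelʳ-≤ _ _ (suc c)
  (+-cancelˡ-≤ (2 * (suc c * vol E)) _ _ (begin
    2 * (C * vol E) + 2 * vol E * C          ≡⟨ eq₁ C (vol E) ⟩
    vol E * (4 * C)                          ≡⟨ *-distribʳ-sum (4 * C) d ⟩
    ∑[ u < n ] (d u * (4 * C))               ≤⟨ sum-mono pointwise ⟩
    ∑[ u < n ] (4 * (d u * d u) + 𝟙 (S u) * (C * C))
      ≡⟨ ∑-distrib-+ (λ u → 4 * (d u * d u)) _ ⟩
    ∑[ u < n ] (4 * (d u * d u)) + ∑[ u < n ] (𝟙 (S u) * (C * C))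
      ≡⟨ cong₂ _+_ (sym (*-distribˡ-sum 4 (λ u → d u * d u))) (sym (*-distribʳ-sum (C * C) (𝟙 ∘ S))) ⟩
    4 * Q + count S * (C * C)                ≡⟨ cong (_+ count S * (C * C)) (eq₂ Q) ⟩
    2 * (2 * Q) + count S * (C * C)          ≤⟨ +-monoˡ-≤ _ (*-monoʳ-≤ 2 squares) ⟩
    2 * (C * vol E) + count S * (C * C)      ≡⟨ cong (2 * (C * vol E) +_) (sym (*-assoc (count S) C C)) ⟩
    2 * (C * vol E) + count S * C * C        ∎))
  where
  open ≤-Reasoning
  C = suc c
  d = deg E
  Q = ∑[ u < n ] (d u * d u)
  eq₁ : ∀ C V → 2 * (C * V) + 2 * V * C ≡ V * (4 * C)
  eq₁ = solve-∀
  eq₂ : ∀ Q → 4 * Q ≡ 2 * (2 * Q)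
  eq₂ = solve-∀
  pointwise : ∀ u → d u * (4 * C) ≤ 4 * (d u * d u) + 𝟙 (S u) * (C * C)
  pointwise u with S u in eq
  ... | false = subst (λ x → x * (4 * C) ≤ 4 * (x * x) + 0) (sym (count≡0 λ v → ¬true⇒false λ e → true≢false (supp u v e) eq)) z≤n
  ... | true = begin
    d u * (4 * C)                          ≡⟨ eq₃ (d u) C ⟩
    2 * ((2 * d u) * C)                    ≤⟨ 2xy≤x²+y² (2 * d u) C ⟩
    (2 * d u) * (2 * d u) + C * C          ≡⟨ eq₄ (d u) C ⟩
    4 * (d u * d u) + (C * C + 0)          ∎
    where
    eq₃ : ∀ x C → x * (4 * C) ≡ 2 * ((2 * x) * C)
    eq₃ = solve-∀
    eq₄ : ∀ x C → (2 * x) * (2 * x) + C * C ≡ 4 * (x * x) + (C * C + 0)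
    eq₄ = solve-∀
  edge-weight : ∀ u v → 𝟙 (E u v) * (d u + d v) ≤ C * 𝟙 (E u v)
  edge-weight u v with E u v in eq
  ... | false = z≤n
  ... | true = ≤-trans (≤-reflexive (+-identityʳ _)) (≤-trans (light u v eq) (≤-reflexive (sym (*-identityʳ C))))
  rows : ∑[ u < n ] ∑[ v < n ] (𝟙 (E u v) * d u) ≡ Q
  rows = sum-cong-≗ {n} (λ u → sym (*-distribʳ-sum (d u) (𝟙 ∘ E u)))
  columns : ∑[ u < n ] ∑[ v < n ] (𝟙 (E u v) * d v) ≡ Q
  columns = trans (∑-comm (λ u v → 𝟙 (E u v) * d v))
    (sum-cong-≗ {n} λ v → trans (sum-cong-≗ {n} λ u → cong (λ b → 𝟙 b * d v) (symm u v))
      (sym (*-distribʳ-sum (d v) (𝟙 ∘ E v))))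
  squares : 2 * Q ≤ C * vol E
  squares = begin
    2 * Q  ≡⟨ cong (Q +_) (+-identityʳ Q) ⟩
    Q + Q  ≡⟨ sym (cong₂ _+_ rows columns) ⟩
    ∑[ u < n ] ∑[ v < n ] (𝟙 (E u v) * d u) + ∑[ u < n ] ∑[ v < n ] (𝟙 (E u v) * d v)
      ≡⟨ sym (∑∑-distrib-+ (λ u v → 𝟙 (E u v) * d u) (λ u v → 𝟙 (E u v) * d v)) ⟩
    ∑[ u < n ] ∑[ v < n ] (𝟙 (E u v) * d u + 𝟙 (E u v) * d v)
      ≡⟨ sum-cong-≗ {n} (λ u → sum-cong-≗ {n} λ v → sym (*-distribˡ-+ (𝟙 (E u v)) (d u) (d v))) ⟩
    ∑[ u < n ] ∑[ v < n ] (𝟙 (E u v) * (d u + d v))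
      ≤⟨ sum-mono (λ u → sum-mono λ v → edge-weight u v) ⟩
    ∑[ u < n ] ∑[ v < n ] (C * 𝟙 (E u v))
      ≡⟨ sum-cong-≗ {n} (λ u → sym (*-distribˡ-sum C (𝟙 ∘ E u))) ⟩
    ∑[ u < n ] (C * d u)
      ≡⟨ sym (*-distribˡ-sum C d) ⟩
    C * vol E ∎

heavy-edge : (E : Relation n) (S : Fin n → Bool) → Symmetric E → SupportedOn E S → ∀ c →
  count S * suc c < 2 * vol E → ∃₂ λ u v → E u v ≡ true × suc c < deg E u + deg E v
heavy-edge E S symm supp c lt
  with any? (λ u → any? (λ v → (E u v Bool.≟ true) ×-dec (suc (suc c) ≤? deg E u + deg E v)))
... | yes (u , v , e , h) = u , v , e , h
... | no none = contradiction
  (light-edges E S symm supp c λ u v e → ≮⇒≥ λ h → none (u , v , e , h)) (<⇒≱ lt)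

-- Inclusion-exclusion: the union of the two neighbourhoods lies in `S`, and the last term is their
-- intersection. In a book-free relation that term is at most 1 when `u` and `v` are adjacent.
deg-sum≤ : (E : Relation n) (S : Fin n → Bool) → Symmetric E → SupportedOn E S → ∀ u v →
  deg E u + deg E v ≤ count S + count (λ w → E u w ∧ E v w)
deg-sum≤ {n} E S symm supp u v = begin
  deg E u + deg E v                              ≡⟨ sym (∑-distrib-+ (𝟙 ∘ E u) (𝟙 ∘ E v)) ⟩
  ∑[ w < n ] (𝟙 (E u w) + 𝟙 (E v w))             ≤⟨ sum-mono pointwise ⟩
  ∑[ w < n ] (𝟙 (S w) + 𝟙 (E u w ∧ E v w))       ≡⟨ ∑-distrib-+ (𝟙 ∘ S) _ ⟩
  count S + count (λ w → E u w ∧ E v w)          ∎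
  where
  open ≤-Reasoning
  in-S : ∀ {u w} → E u w ≡ true → S w ≡ true
  in-S {u} {w} e = supp w u (trans (symm w u) e)
  pointwise : ∀ w → 𝟙 (E u w) + 𝟙 (E v w) ≤ 𝟙 (S w) + 𝟙 (E u w ∧ E v w)
  pointwise w with E u w in eu | E v w in ev
  ... | true | true rewrite in-S eu = ≤-refl
  ... | true | false rewrite in-S eu = ≤-refl
  ... | false | true rewrite in-S ev = ≤-refl
  ... | false | false = z≤n

complete-bipartite : (A B : Fin n → Bool) → Relation n
complete-bipartite A B u v = (A u ∧ B v) ∨ (B u ∧ A v)

vol-complete-bipartite≤ : (A B : Fin n → Bool) → vol (complete-bipartite A B) ≤ 2 * (count A * count B)
vol-complete-bipartite≤ {n} A B = begin
  vol (complete-bipartite A B)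
    ≤⟨ sum-mono (λ u → sum-mono (λ v → pointwise (A u) (B v) (B u) (A v))) ⟩
  ∑[ u < n ] ∑[ v < n ] (𝟙 (A u) * 𝟙 (B v) + 𝟙 (B u) * 𝟙 (A v))
    ≡⟨ ∑∑-distrib-+ (λ u v → 𝟙 (A u) * 𝟙 (B v)) (λ u v → 𝟙 (B u) * 𝟙 (A v)) ⟩
  ∑[ u < n ] ∑[ v < n ] (𝟙 (A u) * 𝟙 (B v)) + ∑[ u < n ] ∑[ v < n ] (𝟙 (B u) * 𝟙 (A v))
    ≡⟨ cong₂ _+_ (∑∑-product (𝟙 ∘ A) (𝟙 ∘ B)) (∑∑-product (𝟙 ∘ B) (𝟙 ∘ A)) ⟩
  count A * count B + count B * count A
    ≡⟨ eq (count A) (count B) ⟩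
  2 * (count A * count B) ∎
  where
  open ≤-Reasoning
  eq : ∀ a b → a * b + b * a ≡ 2 * (a * b)
  eq = solve-∀
  pointwise : ∀ a b c d → 𝟙 ((a ∧ b) ∨ (c ∧ d)) ≤ 𝟙 a * 𝟙 b + 𝟙 c * 𝟙 d
  pointwise true true c d = s≤s z≤n
  pointwise true false true d = ≤-reflexive (sym (+-identityʳ (𝟙 d)))
  pointwise true false false d = z≤n
  pointwise false b true d = ≤-reflexive (sym (+-identityʳ (𝟙 d)))
  pointwise false b false d = z≤n

-- Writing `s = a + k` gives `b = a + 2 k` and `s² = a b + k²`, so `k` vanishes.
balanced-ordered : ∀ s a b → a ≤ b → a + b ≡ 2 * s → s * s ≤ a * b → a ≡ s × b ≡ s
balanced-ordered s a b a≤b eq le = a≡s , trans b≡ (trans (cong (λ x → a + x + x) k≡0) (trans (+-identityʳ _) (trans (+-identityʳ a) a≡s)))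
  where
  a≤s : a ≤ s
  a≤s = *-cancelˡ-≤ 2 (≤-trans (≤-reflexive (cong (a +_) (+-identityʳ a))) (≤-trans (+-monoʳ-≤ a a≤b) (≤-reflexive eq)))
  k = proj₁ (m≤n⇒∃[o]m+o≡n a≤s)
  a+k≡s : a + k ≡ s
  a+k≡s = proj₂ (m≤n⇒∃[o]m+o≡n a≤s)
  e₁ : ∀ a k → 2 * (a + k) ≡ a + (a + k + k)
  e₁ = solve-∀
  e₂ : ∀ a k → (a + k) * (a + k) ≡ a * (a + k + k) + k * k
  e₂ = solve-∀
  b≡ : b ≡ a + k + k
  b≡ = +-cancelˡ-≡ a _ _ (trans eq (trans (cong (2 *_) (sym a+k≡s)) (e₁ a k)))
  k²≤0 : k * k ≤ 0
  k²≤0 = +-cancelˡ-≤ (a * (a + k + k)) _ _ (≤-trans (≤-reflexive (trans (sym (e₂ a k)) (cong₂ _*_ a+k≡s a+k≡s)))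
    (≤-trans le (≤-reflexive (trans (cong (a *_) b≡) (sym (+-identityʳ _))))))
  k≡0 : k ≡ 0
  k≡0 with m*n≡0⇒m≡0∨n≡0 k (n≤0⇒n≡0 k²≤0)
  ... | inj₁ e = e
  ... | inj₂ e = e
  a≡s : a ≡ s
  a≡s = trans (sym (+-identityʳ a)) (trans (cong (a +_) (sym k≡0)) a+k≡s)

balanced : ∀ s a b → a + b ≡ 2 * s → s * s ≤ a * b → a ≡ s × b ≡ s
balanced s a b eq le with ≤-total a b
... | inj₁ a≤b = balanced-ordered s a b a≤b eq le
... | inj₂ b≤a =
  let p , q = balanced-ordered s b a b≤a (trans (+-comm b a) eq) (≤-trans le (≤-reflexive (*-comm a b))) in q , p

-- Neighbourhoods of the ends of a heavy edge are disjoint and independent, so they exhaust the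
-- support and the graph sits inside the complete bipartite graph between them.
triangle-free-extremal : (E : Relation n) (S : Fin n → Bool) → Symmetric E → SupportedOn E S → TriangleFree E →
  ∀ s → count S ≡ 2 * suc s → 2 * (suc s * suc s) ≤ vol E →
  ∃₂ λ A B → (∀ w → S w ≡ A w ∨ B w) × (∀ w → A w ≡ true → B w ≡ true → ⊥) ×
    count A ≡ suc s × count B ≡ suc s × (∀ u v → E u v ≡ complete-bipartite A B u v) × vol E ≡ 2 * (suc s * suc s)
triangle-free-extremal {n} E S symm supp tf s card large
  -- The threshold `suc (s + s)` is one below `count S`, so the degree sum of the edge found reaches
  -- `count S`.
  with heavy-edge E S symm supp (s + s) strict
  where
  e₁ : ∀ s → suc (2 * suc s * suc (s + s) + suc (2 * s)) ≡ 2 * (2 * (suc s * suc s))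
  e₁ = solve-∀
  strict : count S * suc (s + s) < 2 * vol E
  strict = ≤-trans (s≤s (≤-trans (≤-reflexive (cong (_* suc (s + s)) card)) (m≤m+n _ (suc (2 * s)))))
    (≤-trans (≤-reflexive (e₁ s)) (*-monoʳ-≤ 2 large))
... | p , q , pq , heavy = E p , E q , cover , disjoint , proj₁ halves , proj₂ halves , full , vol≡
  where
  disjoint : ∀ w → E p w ≡ true → E q w ≡ true → ⊥
  disjoint w pw qw = tf p q w pq qw pw
  in-S : ∀ {u w} → E u w ≡ true → S w ≡ true
  in-S {u} {w} e = supp w u (trans (symm w u) e)
  pointwise : ∀ w → 𝟙 (E p w) + 𝟙 (E q w) ≤ 𝟙 (S w)
  pointwise w with E p w in ep | E q w in eq
  ... | true | true = contradiction eq (λ eq → disjoint w ep eq)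
  ... | true | false rewrite in-S ep = ≤-refl
  ... | false | true rewrite in-S eq = ≤-refl
  ... | false | false = z≤n
  e₂ : ∀ s → 2 * suc s ≡ suc (suc (s + s))
  e₂ = solve-∀
  large-sum : count S ≤ ∑[ w < n ] (𝟙 (E p w) + 𝟙 (E q w))
  large-sum = ≤-trans (≤-reflexive (trans card (e₂ s)))
    (≤-trans heavy (≤-reflexive (sym (∑-distrib-+ (𝟙 ∘ E p) (𝟙 ∘ E q)))))
  exact : ∀ w → 𝟙 (E p w) + 𝟙 (E q w) ≡ 𝟙 (S w)
  exact = sum-tight pointwise large-sum
  cover : ∀ w → S w ≡ E p w ∨ E q w
  cover w with E p w | E q w | S w | exact w
  ... | true | false | true | _ = refl
  ... | false | true | true | _ = refl
  ... | false | false | false | _ = refl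
  ... | true | true | true | ()
  sum≡ : deg E p + deg E q ≡ 2 * suc s
  sum≡ = trans (sym (∑-distrib-+ (𝟙 ∘ E p) (𝟙 ∘ E q))) (trans (sum-cong-≗ exact) card)
  crossing : ∀ u v → E u v ≡ true → complete-bipartite (E p) (E q) u v ≡ true
  crossing u v e with E p u in pu | E q u in qu | E p v in pv | E q v in qv
  ... | true | _ | true | _ = contradiction e (λ e → tf p u v pu e pv)
  ... | _ | true | _ | true = contradiction e (λ e → tf q u v qu e qv)
  ... | false | false | _ | _ = true≢false (supp u v e) (trans (cover u) (cong₂ _∨_ pu qu))
  ... | _ | _ | false | false = true≢false (supp v u (trans (symm v u) e)) (trans (cover v) (cong₂ _∨_ pv qv))
  ... | true | _ | false | true = refl
  ... | false | true | true | false = refl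
  K = complete-bipartite (E p) (E q)
  row≤ : ∀ u → deg E u ≤ deg K u
  row≤ u = sum-mono (λ v → 𝟙-mono (crossing u v))
  vol≤ : vol E ≤ 2 * (deg E p * deg E q)
  vol≤ = ≤-trans (sum-mono row≤) (vol-complete-bipartite≤ (E p) (E q))
  halves : deg E p ≡ suc s × deg E q ≡ suc s
  halves = balanced (suc s) _ _ sum≡ (*-cancelˡ-≤ 2 (≤-trans large vol≤))
  K≤ : vol K ≤ 2 * (suc s * suc s)
  K≤ = ≤-trans (vol-complete-bipartite≤ (E p) (E q))
    (≤-reflexive (cong₂ (λ a b → 2 * (a * b)) (proj₁ halves) (proj₂ halves)))
  vol≡ : vol E ≡ 2 * (suc s * suc s)
  vol≡ = ≤-antisym (≤-trans (sum-mono row≤) K≤) large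
  full : ∀ u v → E u v ≡ K u v
  full u v = 𝟙-injective (sum-tight (λ v → 𝟙-mono (crossing u v))
    (≤-reflexive (sym (sum-tight row≤ (≤-trans K≤ large) u))) v)

-- Deleting a triangle

outside : Fin n → Fin n → Fin n → Fin n → Bool
outside x y z u = not ((u == x) ∨ (u == y) ∨ (u == z))

outside⇒≢ : ∀ {x y z u : Fin n} → outside x y z u ≡ true → u ≢ x × u ≢ y × u ≢ z
outside⇒≢ {x = x} {y} {z} {u} h with u ≟ x | u ≟ y | u ≟ z
... | no a | no b | no c = a , b , c

-- The vertex type stays `Fin n` and the removed vertices become isolated, so that all results about
-- relations apply unchanged, also after a second deletion.
restrict : (Fin n → Bool) → Relation n → Relation n
restrict S E u v = S u ∧ (S v ∧ E u v)

restrict-true : ∀ (S : Fin n → Bool) (E : Relation n) u v → restrict S E u v ≡ true →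
  S u ≡ true × S v ≡ true × E u v ≡ true
restrict-true S E u v h with ∧-true h
... | a , bc with ∧-true bc
...   | b , c = a , b , c

restrict-symmetric : ∀ (S : Fin n → Bool) (E : Relation n) → Symmetric E → Symmetric (restrict S E)
restrict-symmetric S E symm u v with S u | S v
... | true | true = symm u v
... | true | false = refl
... | false | true = refl
... | false | false = refl

restrict-irreflexive : ∀ (S : Fin n → Bool) (E : Relation n) → Irreflexive E → Irreflexive (restrict S E)
restrict-irreflexive S E irr u with S u
... | true = irr u
... | false = refl

restrict-bookFree : ∀ (S : Fin n → Bool) (E : Relation n) → BookFree E → BookFree (restrict S E)
restrict-bookFree S E bf u v w w' a b c d e = bf u v w w' (get {u} {v} a) (get {u} {w} b) (get {v} {w} c) (get {u} {w'} d) (get {v} {w'} e)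
  where
  get : ∀ {u v} → restrict S E u v ≡ true → E u v ≡ true
  get {u} {v} h = proj₂ (proj₂ (restrict-true S E u v h))

module Delete (E : Relation n) (symm : Symmetric E) (irr : Irreflexive E)
  (x y z : Fin n) (xy : E x y ≡ true) (yz : E y z ≡ true) (xz : E x z ≡ true) where

  other : Fin n → Bool
  other = outside x y z

  E' : Relation n
  E' = restrict other E

  τ : Fin n → ℕ
  τ u = 𝟙 (E u x) + 𝟙 (E u y) + 𝟙 (E u z)

  private
    D : Fin n → ℕ
    D u = 𝟙 (u == x) + 𝟙 (u == y) + 𝟙 (u == z)

    edge⇒≢ : ∀ {u v} → E u v ≡ true → u ≢ v
    edge⇒≢ {u} e refl = true≢false e (irr u)

    partition : ∀ u → 𝟙 (other u) + D u ≡ 1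
    partition u with u ≟ x | u ≟ y | u ≟ z
    ... | yes refl | yes refl | _ = contradiction refl (edge⇒≢ xy)
    ... | yes refl | no _ | yes refl = contradiction refl (edge⇒≢ xz)
    ... | yes refl | no _ | no _ = refl
    ... | no _ | yes refl | yes refl = contradiction refl (edge⇒≢ yz)
    ... | no _ | yes refl | no _ = refl
    ... | no _ | no _ | yes refl = refl
    ... | no _ | no _ | no _ = refl

    sum-D : ∀ g → ∑[ u < n ] (D u * g u) ≡ g x + g y + g z
    sum-D g = begin
      ∑[ u < n ] (D u * g u)
        ≡⟨ sum-cong-≗ {n} (λ u → *-distribʳ-+ (g u) (𝟙 (u == x) + 𝟙 (u == y)) (𝟙 (u == z))) ⟩
      ∑[ u < n ] ((𝟙 (u == x) + 𝟙 (u == y)) * g u + 𝟙 (u == z) * g u)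
        ≡⟨ ∑-distrib-+ (λ u → (𝟙 (u == x) + 𝟙 (u == y)) * g u) _ ⟩
      ∑[ u < n ] ((𝟙 (u == x) + 𝟙 (u == y)) * g u) + ∑[ u < n ] (𝟙 (u == z) * g u)
        ≡⟨ cong₂ _+_ (trans (sum-cong-≗ {n} (λ u → *-distribʳ-+ (g u) (𝟙 (u == x)) (𝟙 (u == y))))
             (trans (∑-distrib-+ (λ u → 𝟙 (u == x) * g u) _) (cong₂ _+_ (sum-δ x g) (sum-δ y g)))) (sum-δ z g) ⟩
      g x + g y + g z ∎
      where open ≡-Reasoning

    split : (g : Fin n → ℕ) → sum g ≡ ∑[ u < n ] (𝟙 (other u) * g u) + (g x + g y + g z)
    split g = begin
      sum g
        ≡⟨ sum-cong-≗ {n} (λ u → sym (trans (cong (_* g u) (partition u)) (+-identityʳ (g u)))) ⟩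
      ∑[ u < n ] ((𝟙 (other u) + D u) * g u)
        ≡⟨ sum-cong-≗ {n} (λ u → *-distribʳ-+ (g u) (𝟙 (other u)) (D u)) ⟩
      ∑[ u < n ] (𝟙 (other u) * g u + D u * g u)
        ≡⟨ ∑-distrib-+ (λ u → 𝟙 (other u) * g u) _ ⟩
      ∑[ u < n ] (𝟙 (other u) * g u) + ∑[ u < n ] (D u * g u)
        ≡⟨ cong (∑[ u < n ] (𝟙 (other u) * g u) +_) (sum-D g) ⟩
      ∑[ u < n ] (𝟙 (other u) * g u) + (g x + g y + g z) ∎
      where open ≡-Reasoning

    τ-corners : τ x + τ y + τ z ≡ 6
    τ-corners rewrite irr x | irr y | irr z | xy | xz | yz
      | symm y x | symm z x | symm z y | xy | xz | yz = refl

  -- The lost edges are the three sides, which account for 6, and the edges from corners to outside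
  -- vertices, each counted at both of its ends.
  vol-delete : vol E ≡ vol E' + 2 * ∑[ u < n ] (𝟙 (other u) * τ u) + 6
  vol-delete = begin
    vol E
      ≡⟨ split (deg E) ⟩
    ∑[ u < n ] (𝟙 (other u) * deg E u) + (deg E x + deg E y + deg E z)
      ≡⟨ cong₂ _+_ rows corners ⟩
    (vol E' + O) + (O + 6)
      ≡⟨ arith (vol E') O ⟩
    vol E' + 2 * O + 6 ∎
    where
    open ≡-Reasoning
    O = ∑[ u < n ] (𝟙 (other u) * τ u)
    arith : ∀ v o → (v + o) + (o + 6) ≡ v + 2 * o + 6
    arith = solve-∀
    corners : deg E x + deg E y + deg E z ≡ O + 6
    corners = begin
      deg E x + deg E y + deg E z
        ≡⟨ cong (_+ deg E z) (sym (∑-distrib-+ (𝟙 ∘ E x) (𝟙 ∘ E y))) ⟩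
      ∑[ v < n ] (𝟙 (E x v) + 𝟙 (E y v)) + deg E z
        ≡⟨ sym (∑-distrib-+ (λ v → 𝟙 (E x v) + 𝟙 (E y v)) (𝟙 ∘ E z)) ⟩
      ∑[ v < n ] (𝟙 (E x v) + 𝟙 (E y v) + 𝟙 (E z v))
        ≡⟨ sum-cong-≗ {n} (λ v → cong₂ _+_ (cong₂ _+_ (cong 𝟙 (symm x v)) (cong 𝟙 (symm y v))) (cong 𝟙 (symm z v))) ⟩
      sum τ
        ≡⟨ split τ ⟩
      O + (τ x + τ y + τ z)
        ≡⟨ cong (O +_) τ-corners ⟩
      O + 6 ∎
    row : ∀ u → 𝟙 (other u) * deg E u ≡ deg E' u + 𝟙 (other u) * τ u
    row u = begin
      𝟙 (other u) * deg E u
        ≡⟨ cong (𝟙 (other u) *_) (split (𝟙 ∘ E u)) ⟩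
      𝟙 (other u) * (∑[ v < n ] (𝟙 (other v) * 𝟙 (E u v)) + τ u)
        ≡⟨ *-distribˡ-+ (𝟙 (other u)) _ (τ u) ⟩
      𝟙 (other u) * ∑[ v < n ] (𝟙 (other v) * 𝟙 (E u v)) + 𝟙 (other u) * τ u
        ≡⟨ cong (_+ 𝟙 (other u) * τ u) (trans (*-distribˡ-sum (𝟙 (other u)) (λ v → 𝟙 (other v) * 𝟙 (E u v)))
             (sum-cong-≗ {n} λ v → sym (trans (𝟙-∧ (other u) _) (cong (𝟙 (other u) *_) (𝟙-∧ (other v) _))))) ⟩
      deg E' u + 𝟙 (other u) * τ u ∎
    rows : ∑[ u < n ] (𝟙 (other u) * deg E u) ≡ vol E' + O
    rows = trans (sum-cong-≗ row) (∑-distrib-+ (deg E') _)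

  count-delete : ∀ S → S x ≡ true → S y ≡ true → S z ≡ true → count S ≡ count (λ u → other u ∧ S u) + 3
  count-delete S sx sy sz = trans (split (𝟙 ∘ S)) (cong₂ _+_
    (sum-cong-≗ {n} λ u → sym (𝟙-∧ (other u) (S u)))
    (cong₂ _+_ (cong₂ _+_ (cong 𝟙 sx) (cong 𝟙 sy)) (cong 𝟙 sz)))

  module _ (bf : BookFree E) where

    -- A vertex joined to two corners spans a second triangle on the side between them; `BookFree`
    -- identifies it with the third corner.
    τ≤1 : ∀ u → other u ≡ true → τ u ≤ 1
    τ≤1 u o with E u x in ux | E u y in uy | E u z in uz | outside⇒≢ {u = u} o
    ... | true | true | _ | _ , _ , u≢z = contradiction (bf x y u z xy (flip ux) (flip uy) xz yz) u≢z
      where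
      flip : ∀ {v} → E u v ≡ true → E v u ≡ true
      flip e = trans (symm _ u) e
    ... | true | false | true | _ , u≢y , _ = contradiction (bf x z u y xz (flip ux) (flip uz) xy (trans (symm z y) yz)) u≢y
      where
      flip : ∀ {v} → E u v ≡ true → E v u ≡ true
      flip e = trans (symm _ u) e
    ... | false | true | true | u≢x , _ , _ = contradiction (bf y z u x yz (flip uy) (flip uz) (trans (symm y x) xy) (trans (symm z x) xz)) u≢x
      where
      flip : ∀ {v} → E u v ≡ true → E v u ≡ true
      flip e = trans (symm _ u) e
    ... | true | false | false | _ = ≤-refl
    ... | false | true | false | _ = ≤-refl
    ... | false | false | true | _ = ≤-refl
    ... | false | false | false | _ = z≤n

-- With `s = suc s⁻ = r − 1` the last two equations are the order `2 r + 1` and twice the size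
-- `r² + 2`. The bound `s ≥ 4` is given through `k = s − 4`, so that the strict inequality below can
-- be checked as a polynomial identity in `k`.
module AroundTriangle (E : Relation n) (symm : Symmetric E) (irr : Irreflexive E) (bf : BookFree E)
  (x y z : Fin n) (xy : E x y ≡ true) (yz : E y z ≡ true) (xz : E x z ≡ true)
  (s⁻ k : ℕ) (s⁻≡ : s⁻ ≡ 3 + k) (n≡ : n ≡ 2 * suc s⁻ + 3) (vol≡ : vol E ≡ 2 * (suc s⁻ * suc s⁻ + 2 * suc s⁻ + 3)) where

  open Delete E symm irr x y z xy yz xz public

  private
    s = suc s⁻

    count-other : count other ≡ 2 * s
    count-other = +-cancelʳ-≡ 3 _ _ (begin
      count other + 3                  ≡⟨ cong (_+ 3) (sum-cong-≗ {n} λ u → cong 𝟙 (sym (Bool.∧-identityʳ (other u)))) ⟩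
      count (λ u → other u ∧ true) + 3 ≡⟨ sym (count-delete (λ _ → true) refl refl refl) ⟩
      count {n} (λ _ → true)           ≡⟨ trans (sum-const n 1) (*-identityʳ n) ⟩
      n                                ≡⟨ n≡ ⟩
      2 * s + 3 ∎)
      where open ≡-Reasoning

    O = ∑[ u < n ] (𝟙 (other u) * τ u)

    attached≤ : ∀ u → 𝟙 (other u) * τ u ≤ 𝟙 (other u)
    attached≤ u with other u in eq
    ... | true = ≤-trans (≤-reflexive (+-identityʳ _)) (τ≤1 bf u eq)
    ... | false = z≤n

    O≤ : O ≤ 2 * s
    O≤ = ≤-trans (sum-mono attached≤) (≤-reflexive count-other)

    balance : vol E' + 2 * O ≡ 2 * (s * s) + 2 * (2 * s)
    balance = +-cancelʳ-≡ 6 _ _ (trans (sym vol-delete) (trans vol≡ (arith s)))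
      where
      arith : ∀ s → 2 * (s * s + 2 * s + 3) ≡ 2 * (s * s) + 2 * (2 * s) + 6
      arith = solve-∀

    vol-E'≥ : 2 * (s * s) ≤ vol E'
    vol-E'≥ = +-cancelʳ-≤ (2 * (2 * s)) _ _ (≤-trans (≤-reflexive (sym balance)) (+-monoʳ-≤ (vol E') (*-monoʳ-≤ 2 O≤)))

    symm' : Symmetric E'
    symm' = restrict-symmetric other E symm
    irr' : Irreflexive E'
    irr' = restrict-irreflexive other E irr
    bf' : BookFree E'
    bf' = restrict-bookFree other E bf

    -- The 2s − 3 vertices left by a second triangle carry too few edges: this needs s ≥ 4.
    E'-triangleFree : TriangleFree E'
    E'-triangleFree p q r pq qr pr = contradiction too-many (<⇒≱ (≤-trans (s≤s (m≤m+n _ (2 * k + 1))) (≤-reflexive (final k))))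
      where
      module D = Delete E' symm' irr' p q r pq qr pr
      S' : Fin n → Bool
      S' u = D.other u ∧ other u
      in-other : ∀ u v → E' u v ≡ true → other u ≡ true
      in-other u v e = proj₁ (restrict-true other E u v e)
      m = count S'
      m≡ : m ≡ 2 * k + 5
      m≡ = +-cancelʳ-≡ 3 _ _ (trans (sym (D.count-delete other (in-other p q pq) (in-other q r qr) (in-other r p (trans (symm' r p) pr))))
        (trans count-other (trans (cong (λ s → 2 * suc s) s⁻≡) (arith k))))
        where
        arith : ∀ k → 2 * (4 + k) ≡ 2 * k + 5 + 3
        arith = solve-∀
      supp : SupportedOn D.E' S'
      supp u v e with restrict-true D.other E' u v e
      ... | a , b , c = cong₂ _∧_ a (in-other u v c)
      symm'' : Symmetric D.E'
      symm'' = restrict-symmetric D.other E' symm'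
      bf'' : BookFree D.E'
      bf'' = restrict-bookFree D.other E' bf'
      light : ∀ u v → D.E' u v ≡ true → deg D.E' u + deg D.E' v ≤ suc m
      light u v e = ≤-trans (deg-sum≤ D.E' S' symm'' supp u v) (≤-trans (+-monoʳ-≤ m (count≤1 λ w w' a b →
        bf'' u v w w' e (proj₁ (both w a)) (proj₂ (both w a)) (proj₁ (both w' b)) (proj₂ (both w' b)))) (≤-reflexive (+-comm m 1)))
        where
        both : ∀ w → D.E' u w ∧ D.E' v w ≡ true → D.E' u w ≡ true × D.E' v w ≡ true
        both w = ∧-true {D.E' u w}
      vol''≤ : 2 * vol D.E' ≤ m * suc m
      vol''≤ = light-edges D.E' S' symm'' supp m light
      O' = ∑[ u < n ] (𝟙 (D.other u) * D.τ u)
      isolated : ∀ u v → other u ≡ false → 𝟙 (E' u v) ≡ 0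
      isolated u v e = cong (λ b → 𝟙 (b ∧ (other v ∧ E u v))) e
      bound : ∀ a b t → (a ≡ true → t ≤ 1) → (b ≡ false → t ≡ 0) → 𝟙 a * t ≤ 𝟙 (a ∧ b)
      bound false b t _ _ = z≤n
      bound true true t h _ = ≤-trans (≤-reflexive (+-identityʳ t)) (h refl)
      bound true false t _ h = ≤-reflexive (trans (+-identityʳ t) (h refl))
      attached'≤ : ∀ u → 𝟙 (D.other u) * D.τ u ≤ 𝟙 (S' u)
      attached'≤ u = bound (D.other u) (other u) (D.τ u) (D.τ≤1 bf' u)
        (λ e → cong₂ _+_ (cong₂ _+_ (isolated u p e) (isolated u q e)) (isolated u r e))
      O'≤ : O' ≤ m
      O'≤ = sum-mono attached'≤
      too-many : 2 * (2 * ((4 + k) * (4 + k))) ≤ (2 * k + 5) * suc (2 * k + 5) + 4 * (2 * k + 5) + 12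
      too-many = begin
        2 * (2 * ((4 + k) * (4 + k)))  ≡⟨ cong (λ s → 2 * (2 * (suc s * suc s))) (sym s⁻≡) ⟩
        2 * (2 * (s * s))              ≤⟨ *-monoʳ-≤ 2 vol-E'≥ ⟩
        2 * vol E'                     ≡⟨ cong (2 *_) D.vol-delete ⟩
        2 * (vol D.E' + 2 * O' + 6)    ≡⟨ arith (vol D.E') O' ⟩
        2 * vol D.E' + 4 * O' + 12     ≤⟨ +-monoˡ-≤ 12 (+-mono-≤ vol''≤ (*-monoʳ-≤ 4 O'≤)) ⟩
        m * suc m + 4 * m + 12         ≡⟨ cong (λ m → m * suc m + 4 * m + 12) m≡ ⟩
        (2 * k + 5) * suc (2 * k + 5) + 4 * (2 * k + 5) + 12 ∎
        where
        open ≤-Reasoning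
        arith : ∀ v o → 2 * (v + 2 * o + 6) ≡ 2 * v + 4 * o + 12
        arith = solve-∀
      -- The two sides of the estimate differ by `2 k + 2`, that is `2 s − 6`, which would vanish at
      -- `s = 3`.
      final : ∀ k → suc ((2 * k + 5) * suc (2 * k + 5) + 4 * (2 * k + 5) + 12 + (2 * k + 1)) ≡ 2 * (2 * ((4 + k) * (4 + k)))
      final = solve-∀

    extremal = triangle-free-extremal E' other symm' (λ u v e → proj₁ (restrict-true other E u v e)) E'-triangleFree
      s⁻ count-other vol-E'≥

  A B : Fin n → Bool
  A = proj₁ extremal
  B = proj₁ (proj₂ extremal)

  cover : ∀ w → other w ≡ A w ∨ B w
  cover = proj₁ (proj₂ (proj₂ extremal))

  disjoint : ∀ w → A w ≡ true → B w ≡ true → ⊥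
  disjoint = proj₁ (proj₂ (proj₂ (proj₂ extremal)))

  count-A : count A ≡ s
  count-A = proj₁ (proj₂ (proj₂ (proj₂ (proj₂ extremal))))

  count-B : count B ≡ s
  count-B = proj₁ (proj₂ (proj₂ (proj₂ (proj₂ (proj₂ extremal)))))

  between : ∀ u v → E' u v ≡ complete-bipartite A B u v
  between = proj₁ (proj₂ (proj₂ (proj₂ (proj₂ (proj₂ (proj₂ extremal))))))

  -- The extremal case gives `vol E'` exactly `2 s²`, whence `balance` forces `O = 2 s`, the number
  -- of outside vertices. The bound `τ ≤ 1` is therefore attained at each of them.
  attached-once : ∀ u → other u ≡ true → τ u ≡ 1
  attached-once u o = trans (sym (+-identityʳ (τ u))) (subst (λ b → 𝟙 b * τ u ≡ 𝟙 b) o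
    (sum-tight attached≤ (≤-reflexive (trans count-other (sym O≡))) u))
    where
    O≡ : O ≡ 2 * s
    O≡ = *-cancelˡ-≡ _ _ 2 (+-cancelˡ-≡ (vol E') _ _ (trans balance
      (cong (_+ 2 * (2 * s)) (sym (proj₂ (proj₂ (proj₂ (proj₂ (proj₂ (proj₂ (proj₂ extremal)))))))))))

-- The triangle-free case

𝟙-contra : ∀ {a b} → (a ≡ true → b ≡ true → ⊥) → 𝟙 a + 𝟙 b ≤ 1
𝟙-contra {true} {true} h = contradiction refl (h refl)
𝟙-contra {true} {false} h = ≤-refl
𝟙-contra {false} {b} h = 𝟙≤1 b

-- If w has p ≥ 1 neighbours in A and q ≥ 1 in B, none of the former is joined to any of the latter, which
-- leaves at most |A| |B| + 1 edges.
module NearBipartite (E : Relation n) (symm : Symmetric E) (tf : TriangleFree E) (A B : Fin n → Bool) (w : Fin n)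
  (exact : ∀ v → 𝟙 (A v) + 𝟙 (B v) + 𝟙 (v == w) ≡ 1)
  (indepA : ∀ u v → A u ≡ true → A v ≡ true → E u v ≡ true → ⊥) where

  private
    irr : E w w ≡ false
    irr = ¬true⇒false λ e → tf w w w e e e

    at-w : A w ≡ false × B w ≡ false
    at-w with A w | B w | w == w | ==-refl w | exact w
    ... | false | false | true | _ | _ = refl , refl
    ... | true | false | true | _ | ()
    ... | false | true | true | _ | ()
    ... | true | true | true | _ | ()

  -- Neighbours of `α` lie in `B` or equal `w`. If `w` is one of them, then `q₀` is not, or `α`,
  -- `w`, `q₀` would form a triangle; adding the indicator of the edge `α w` to both sides, at `q₀`
  -- and at `w`, performs this exchange.
  deg≤ : ∀ α q₀ → A α ≡ true → B q₀ ≡ true → E w q₀ ≡ true → deg E α ≤ count B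
  deg≤ α q₀ aα bq₀ wq₀ = +-cancelʳ-≤ (𝟙 (E α w)) _ _ (begin
    deg E α + 𝟙 (E α w)
      ≡⟨ cong (deg E α +_) (sym (sum-δ q₀ (λ _ → 𝟙 (E α w)))) ⟩
    deg E α + ∑[ v < n ] (𝟙 (v == q₀) * 𝟙 (E α w))
      ≡⟨ sym (∑-distrib-+ (𝟙 ∘ E α) _) ⟩
    ∑[ v < n ] (𝟙 (E α v) + 𝟙 (v == q₀) * 𝟙 (E α w))
      ≤⟨ sum-mono pointwise ⟩
    ∑[ v < n ] (𝟙 (B v) + 𝟙 (v == w) * 𝟙 (E α w))
      ≡⟨ ∑-distrib-+ (𝟙 ∘ B) _ ⟩
    count B + ∑[ v < n ] (𝟙 (v == w) * 𝟙 (E α w))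
      ≡⟨ cong (count B +_) (sum-δ w (λ _ → 𝟙 (E α w))) ⟩
    count B + 𝟙 (E α w) ∎)
    where
    open ≤-Reasoning
    pointwise : ∀ v → 𝟙 (E α v) + 𝟙 (v == q₀) * 𝟙 (E α w) ≤ 𝟙 (B v) + 𝟙 (v == w) * 𝟙 (E α w)
    pointwise v with v ≟ q₀ | v ≟ w
    ... | yes refl | yes refl = true≢false bq₀ (proj₂ at-w)
    ... | yes refl | no _ rewrite bq₀ | +-identityʳ (𝟙 (E α w)) =
      𝟙-contra {E α v} λ αq αw → tf α w v αw wq₀ αq
    ... | no _ | yes refl rewrite proj₂ at-w = ≤-reflexive (trans (+-identityʳ _) (sym (+-identityʳ _)))
    ... | no _ | no v≢w = +-monoˡ-≤ 0 (𝟙-mono in-B)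
      where
      in-B : E α v ≡ true → B v ≡ true
      in-B e with A v in av | B v | v == w | ≢⇒== v≢w | exact v
      ... | true | _ | _ | _ | _ = contradiction e (λ e → indepA α v aα av e)
      ... | false | true | _ | _ | _ = refl
      ... | false | false | false | _ | ()

  -- Being joined to `w`, the vertex `p₀` has no neighbour among the neighbours of `w` in `B`; the
  -- additional 1 is for `w` itself.
  deg+≤ : ∀ p₀ → A p₀ ≡ true → E w p₀ ≡ true → deg E p₀ + count (λ v → B v ∧ E w v) ≤ count B + 1
  deg+≤ p₀ ap₀ wp₀ = begin
    deg E p₀ + count (λ v → B v ∧ E w v)
      ≡⟨ sym (∑-distrib-+ (𝟙 ∘ E p₀) _) ⟩
    ∑[ v < n ] (𝟙 (E p₀ v) + 𝟙 (B v ∧ E w v))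
      ≤⟨ sum-mono pointwise ⟩
    ∑[ v < n ] (𝟙 (B v) + 𝟙 (v == w))
      ≡⟨ ∑-distrib-+ (𝟙 ∘ B) _ ⟩
    count B + count (_== w)
      ≡⟨ cong (count B +_) (count-δ w) ⟩
    count B + 1 ∎
    where
    open ≤-Reasoning
    pointwise : ∀ v → 𝟙 (E p₀ v) + 𝟙 (B v ∧ E w v) ≤ 𝟙 (B v) + 𝟙 (v == w)
    pointwise v with A v in av | B v | v == w | exact v
    ... | true | false | false | _ rewrite ¬true⇒false (indepA p₀ v ap₀ av) = z≤n
    ... | false | true | false | _ = 𝟙-contra {E p₀ v} λ pv wv → tf w p₀ v wp₀ pv wv
    ... | false | false | true | _ = ≤-trans (≤-reflexive (+-identityʳ _)) (𝟙≤1 _)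
    ... | true | true | true | ()
    ... | true | true | false | ()
    ... | true | false | true | ()
    ... | false | true | true | ()
    ... | false | false | false | ()

  deg-w≤ : deg E w ≤ count (λ v → A v ∧ E w v) + count (λ v → B v ∧ E w v)
  deg-w≤ = ≤-trans (sum-mono pointwise) (≤-reflexive (∑-distrib-+ (λ v → 𝟙 (A v ∧ E w v)) _))
    where
    pointwise : ∀ v → 𝟙 (E w v) ≤ 𝟙 (A v ∧ E w v) + 𝟙 (B v ∧ E w v)
    pointwise v with A v | B v | v ≟ w | exact v
    ... | true | _ | _ | _ = m≤m+n _ _
    ... | false | true | _ | _ = ≤-refl
    ... | false | false | yes refl | _ rewrite irr = z≤n
    ... | false | false | no _ | ()

  -- `swapped` and `swapped+` are `deg≤` and `deg+≤` for the instance of this module in which `A`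
  -- and `B` are exchanged.
  module _ (indepB : ∀ u v → B u ≡ true → B v ≡ true → E u v ≡ true → ⊥)
    (swapped : ∀ β p₀ → B β ≡ true → A p₀ ≡ true → E w p₀ ≡ true → deg E β ≤ count A)
    (swapped+ : ∀ q₀ → B q₀ ≡ true → E w q₀ ≡ true → deg E q₀ + count (λ v → A v ∧ E w v) ≤ count A + 1)
    (p₀ q₀ : Fin n) (ap₀ : A p₀ ≡ true) (wp₀ : E w p₀ ≡ true) (bq₀ : B q₀ ≡ true) (wq₀ : E w q₀ ≡ true) where

    private
      a = count A
      b = count B
      p = count (λ v → A v ∧ E w v)
      q = count (λ v → B v ∧ E w v)

      -- Vertices of `A` are charged `b`, vertices of `B` are charged `a`, and `w` is charged
      -- `p + q`. The savings `q` at `p₀` and `p` at `q₀` pay for the degree of `w`, so that only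
      -- two units remain above `2 a b`.
      row : ∀ u → deg E u + (𝟙 (u == p₀) * q + 𝟙 (u == q₀) * p)
        ≤ (𝟙 (A u) * b + 𝟙 (B u) * a) + (𝟙 (u == w) * (p + q) + (𝟙 (u == p₀) * 1 + 𝟙 (u == q₀) * 1))
      row u with A u in au | B u in bu | u ≟ w | exact u | u ≟ p₀ | u ≟ q₀
      ... | true | false | no _ | _ | no _ | no _ =
        subst₂ _≤_ (sym (+-identityʳ _)) (lem b) (deg≤ u q₀ au bq₀ wq₀)
        where
        lem : ∀ b → b ≡ (b + 0 + 0) + 0
        lem = solve-∀
      ... | true | false | no _ | _ | yes refl | no _ =
        subst₂ _≤_ (lem₁ (deg E u) q) (lem₂ b) (deg+≤ u au wp₀)
        where
        lem₁ : ∀ d q → d + q ≡ d + (q + 0 + 0)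
        lem₁ = solve-∀
        lem₂ : ∀ b → b + 1 ≡ (b + 0 + 0) + 1
        lem₂ = solve-∀
      ... | true | false | no _ | _ | _ | yes refl = true≢false bq₀ bu
      ... | false | true | no _ | _ | yes refl | _ = true≢false ap₀ au
      ... | false | true | no _ | _ | no _ | no _ =
        subst₂ _≤_ (sym (+-identityʳ _)) (lem a) (swapped u p₀ bu ap₀ wp₀)
        where
        lem : ∀ b → b ≡ (b + 0) + 0
        lem = solve-∀
      ... | false | true | no _ | _ | no _ | yes refl =
        subst₂ _≤_ (lem₁ (deg E u) p) (lem₂ a) (swapped+ u bu wq₀)
        where
        lem₁ : ∀ d q → d + q ≡ d + (q + 0)
        lem₁ = solve-∀
        lem₂ : ∀ b → b + 1 ≡ (b + 0) + 1
        lem₂ = solve-∀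
      ... | false | false | yes refl | _ | yes refl | _ = true≢false ap₀ au
      ... | false | false | yes refl | _ | no _ | yes refl = true≢false bq₀ bu
      ... | false | false | yes refl | _ | no _ | no _ =
        subst₂ _≤_ (sym (+-identityʳ _)) (lem (p + q)) deg-w≤
        where
        lem : ∀ b → b ≡ (b + 0) + 0
        lem = solve-∀
      ... | true | true | yes _ | () | _ | _
      ... | true | true | no _ | () | _ | _
      ... | true | false | yes _ | () | _ | _
      ... | false | true | yes _ | () | _ | _
      ... | false | false | no _ | () | _ | _

    vol≤ : vol E ≤ 2 * (a * b) + 2
    vol≤ = +-cancelʳ-≤ (q + p) _ _ (begin
      vol E + (q + p)
        ≡⟨ cong (vol E +_) (sym (cong₂ _+_ (sum-δ p₀ (λ _ → q)) (sum-δ q₀ (λ _ → p)))) ⟩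
      vol E + (∑[ u < n ] (𝟙 (u == p₀) * q) + ∑[ u < n ] (𝟙 (u == q₀) * p))
        ≡⟨ cong (vol E +_) (sym (∑-distrib-+ (λ u → 𝟙 (u == p₀) * q) _)) ⟩
      vol E + ∑[ u < n ] (𝟙 (u == p₀) * q + 𝟙 (u == q₀) * p)
        ≡⟨ sym (∑-distrib-+ (deg E) _) ⟩
      ∑[ u < n ] (deg E u + (𝟙 (u == p₀) * q + 𝟙 (u == q₀) * p))
        ≤⟨ sum-mono row ⟩
      ∑[ u < n ] ((𝟙 (A u) * b + 𝟙 (B u) * a) + (𝟙 (u == w) * (p + q) + (𝟙 (u == p₀) * 1 + 𝟙 (u == q₀) * 1)))
        ≡⟨ trans (∑-distrib-+ (λ u → 𝟙 (A u) * b + 𝟙 (B u) * a) _) (cong₂ _+_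
             (trans (∑-distrib-+ (λ u → 𝟙 (A u) * b) _) (sym (cong₂ _+_ (*-distribʳ-sum b (𝟙 ∘ A)) (*-distribʳ-sum a (𝟙 ∘ B)))))
             (trans (∑-distrib-+ (λ u → 𝟙 (u == w) * (p + q)) _) (cong₂ _+_ (sum-δ w _)
               (trans (∑-distrib-+ (λ u → 𝟙 (u == p₀) * 1) _) (cong₂ _+_ (sum-δ p₀ _) (sum-δ q₀ _)))))) ⟩
      (a * b + b * a) + ((p + q) + 2)
        ≡⟨ arith a b p q ⟩
      2 * (a * b) + 2 + (q + p) ∎)
      where
      open ≤-Reasoning
      arith : ∀ a b p q → (a * b + b * a) + ((p + q) + 2) ≡ 2 * (a * b) + 2 + (q + p)
      arith = solve-∀

Crossing : Relation n → (Fin n → Bool) → Set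
Crossing E χ = ∀ u v → E u v ≡ true → χ v ≡ not (χ u)

-- Write R for `suc r`. The neighbourhoods of the ends of an edge of degree sum at least 2R are
-- disjoint, so they miss at most one vertex `w`. If `w` has no neighbour on one of the two sides,
-- it can be added to that side. Otherwise there are at most `a b + 1` edges with `a + b = 2R`,
-- hence at most R² + 1, one fewer than required.
triangle-free⇒bipartite : (E : Relation n) → Symmetric E → TriangleFree E →
  ∀ r → n ≡ 2 * suc r + 1 → vol E ≡ 2 * (suc r * suc r + 2) → ∃ (Crossing E)
triangle-free⇒bipartite {n} E symm tf r n≡ vol≡
  with heavy-edge E (λ _ → true) symm (λ _ _ _ → refl) (r + r) strict
  where
  arith : ∀ r → suc ((2 * suc r + 1) * suc (r + r) + 8) ≡ 2 * (2 * (suc r * suc r + 2))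
  arith = solve-∀
  strict : count {n} (λ _ → true) * suc (r + r) < 2 * vol E
  strict = ≤-trans (s≤s (≤-trans (≤-reflexive (cong (_* suc (r + r)) (trans (trans (sum-const n 1) (*-identityʳ n)) n≡))) (m≤m+n _ 8)))
    (≤-reflexive (trans (arith r) (cong (2 *_) (sym vol≡))))
... | p , q , pq , heavy with any? (λ w → (E p w Bool.≟ false) ×-dec (E q w Bool.≟ false))
...   | no covered = A , crossing
  where
  A = E p
  B = E q
  crossing : Crossing E A
  crossing u v e with A u in au | A v in av | B u in bu | B v in bv
  ... | true | true | _ | _ = contradiction e (λ e → tf p u v au e av)
  ... | true | false | _ | _ = refl
  ... | false | true | _ | _ = refl
  ... | false | false | true | true = contradiction e (λ e → tf q u v bu e bv)
  ... | false | false | false | _ = contradiction (u , au , bu) covered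
  ... | false | false | _ | false = contradiction (v , av , bv) covered
...   | yes (w , aw , bw) = go
  where
  A = E p
  B = E q
  indepA : ∀ u v → A u ≡ true → A v ≡ true → E u v ≡ true → ⊥
  indepA u v au av e = tf p u v au e av
  indepB : ∀ u v → B u ≡ true → B v ≡ true → E u v ≡ true → ⊥
  indepB u v bu bv e = tf q u v bu e bv
  at-most : ∀ v → 𝟙 (A v) + 𝟙 (B v) + 𝟙 (v == w) ≤ 1
  at-most v with A v in av | B v in bv | v ≟ w
  ... | true | true | _ = contradiction pq (λ pq → tf p q v pq bv av)
  ... | true | false | yes refl = true≢false av aw
  ... | true | false | no _ = ≤-refl
  ... | false | true | yes refl = true≢false bv bw
  ... | false | true | no _ = ≤-refl
  ... | false | false | yes _ = ≤-refl
  ... | false | false | no _ = z≤n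
  total : ∑[ v < n ] (𝟙 (A v) + 𝟙 (B v) + 𝟙 (v == w)) ≡ count A + count B + 1
  total = trans (∑-distrib-+ (λ v → 𝟙 (A v) + 𝟙 (B v)) _) (cong₂ _+_ (∑-distrib-+ (𝟙 ∘ A) (𝟙 ∘ B)) (count-δ w))
  all-ones : ∑[ v < n ] 1 ≡ 2 * suc r + 1
  all-ones = trans (trans (sum-const n 1) (*-identityʳ n)) n≡
  ab≡ : count A + count B ≡ 2 * suc r
  ab≡ = ≤-antisym (+-cancelʳ-≤ 1 _ _ (≤-trans (≤-reflexive (sym total)) (≤-trans (sum-mono at-most) (≤-reflexive all-ones))))
    (≤-trans (≤-reflexive (arith r)) heavy)
    where
    arith : ∀ r → 2 * suc r ≡ suc (suc (r + r))
    arith = solve-∀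
  exact : ∀ v → 𝟙 (A v) + 𝟙 (B v) + 𝟙 (v == w) ≡ 1
  exact = sum-tight at-most (≤-reflexive (trans all-ones (sym (trans total (cong (_+ 1) ab≡)))))
  exact' : ∀ v → 𝟙 (B v) + 𝟙 (A v) + 𝟙 (v == w) ≡ 1
  exact' v = trans (cong (_+ 𝟙 (v == w)) (+-comm (𝟙 (B v)) (𝟙 (A v)))) (exact v)
  module L = NearBipartite E symm tf A B w exact indepA
  module R = NearBipartite E symm tf B A w exact' indepB
  irr : ∀ {u} → E u u ≡ true → ⊥
  irr {u} e = tf u u u e e e
  go : ∃ (Crossing E)
  go with any? (λ v → (A v Bool.≟ true) ×-dec (E w v Bool.≟ true))
        | any? (λ v → (B v Bool.≟ true) ×-dec (E w v Bool.≟ true))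
  ... | no noA | _ = (λ v → not (B v)) , crossing
    where
    crossing : Crossing E (λ v → not (B v))
    crossing u v e with A u in au | B u in bu | u ≟ w | exact u | A v in av | B v in bv | v ≟ w | exact v
    ... | _ | true | _ | _ | _ | true | _ | _ = contradiction e (indepB u v bu bv)
    ... | _ | true | _ | _ | _ | false | _ | _ = refl
    ... | _ | false | _ | _ | _ | true | _ | _ = refl
    ... | true | false | _ | _ | true | false | _ | _ = contradiction e (indepA u v au av)
    ... | false | false | yes refl | _ | true | false | _ | _ = contradiction (v , av , e) noA
    ... | true | false | _ | _ | false | false | yes refl | _ = contradiction (u , au , trans (symm v u) e) noA
    ... | false | false | yes refl | _ | false | false | yes refl | _ = contradiction e irr
    ... | false | false | no _ | () | _ | _ | _ | _
    ... | _ | false | _ | _ | false | false | no _ | ()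
  ... | yes _ | no noB = A , crossing
    where
    crossing : Crossing E A
    crossing u v e with A u in au | B u in bu | u ≟ w | exact u | A v in av | B v in bv | v ≟ w | exact v
    ... | true | _ | _ | _ | true | _ | _ | _ = contradiction e (indepA u v au av)
    ... | true | _ | _ | _ | false | _ | _ | _ = refl
    ... | false | _ | _ | _ | true | _ | _ | _ = refl
    ... | false | true | _ | _ | false | true | _ | _ = contradiction e (indepB u v bu bv)
    ... | false | false | yes refl | _ | false | true | _ | _ = contradiction (v , bv , e) noB
    ... | false | true | _ | _ | false | false | yes refl | _ = contradiction (u , bu , trans (symm v u) e) noB
    ... | false | false | yes refl | _ | false | false | yes refl | _ = contradiction e irr
    ... | false | false | no _ | () | _ | _ | _ | _
    ... | false | _ | _ | _ | false | false | no _ | ()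
  ... | yes (p₀ , ap₀ , wp₀) | yes (q₀ , bq₀ , wq₀) = contradiction too-large (<⇒≱ (≤-trans (s≤s (m≤m+n _ 3)) (≤-reflexive (arith r))))
    where
    a = count A
    b = count B
    small-volume : vol E ≤ 2 * (a * b) + 2
    small-volume = L.vol≤ indepB R.deg≤ R.deg+≤ p₀ q₀ ap₀ wp₀ bq₀ wq₀
    too-large : 2 * (2 * (suc r * suc r + 2)) ≤ (2 * suc r) * (2 * suc r) + 4
    too-large = begin
      2 * (2 * (suc r * suc r + 2))                ≡⟨ cong (2 *_) (sym vol≡) ⟩
      2 * vol E                                    ≤⟨ *-monoʳ-≤ 2 small-volume ⟩
      2 * (2 * (a * b) + 2)                        ≡⟨ arith₁ a b ⟩
      2 * (a * b) + 2 * (a * b) + 4                ≤⟨ +-monoˡ-≤ 4 (+-monoˡ-≤ (2 * (a * b)) (2xy≤x²+y² a b)) ⟩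
      (a * a + b * b) + 2 * (a * b) + 4            ≡⟨ arith₂ a b ⟩
      (a + b) * (a + b) + 4                        ≡⟨ cong (λ x → x * x + 4) ab≡ ⟩
      (2 * suc r) * (2 * suc r) + 4 ∎
      where
      open ≤-Reasoning
      arith₁ : ∀ a b → 2 * (2 * (a * b) + 2) ≡ 2 * (a * b) + 2 * (a * b) + 4
      arith₁ = solve-∀
      arith₂ : ∀ a b → (a * a + b * b) + 2 * (a * b) + 4 ≡ (a + b) * (a + b) + 4
      arith₂ = solve-∀
    arith : ∀ r → suc ((2 * suc r) * (2 * suc r) + 4 + 3) ≡ 2 * (2 * (suc r * suc r + 2))
    arith = solve-∀

-- Digraphs with a bipartite underlying graph

-- The fields list the ways in which two different walks of length at most 2 can share both ends:
-- the empty walk against length 1 or 2, length 1 against 2, and 2 against 2. The vertex type is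
-- arbitrary because the condition is moved between `Fin n` and the encoded vertices.
record Geodetic₂ {V : Set} (G : V → V → Bool) : Set where
  field
    no-loop : ∀ u → G u u ≡ true → ⊥
    no-digon : ∀ u v → G u v ≡ true → G v u ≡ true → ⊥
    no-shortcut : ∀ u w v → G u w ≡ true → G w v ≡ true → G u v ≡ true → ⊥
    unique-middle : ∀ u v w w' → G u w ≡ true → G w v ≡ true → G u w' ≡ true → G w' v ≡ true → w ≡ w'

HasPredecessors HasSuccessors : {V : Set} → (V → V → Bool) → Set
HasPredecessors G = ∀ v → ∃ λ u → G u v ≡ true
HasSuccessors G = ∀ v → ∃ λ w → G v w ≡ true

-- Walks u → w → v with u, v on one side of the bipartition have their middle on the other side, and
-- a vertex with d⁻ d⁺ such walks through it satisfies d⁻ + d⁺ ≤ d⁻ d⁺ + 1.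
bipartite-arcs≤ : (G : Relation n) → Geodetic₂ G → HasPredecessors G → HasSuccessors G →
  (χ : Fin n → Bool) → Crossing G χ →
  ∑[ u < n ] ∑[ v < n ] 𝟙 (G u v) + count χ ≤ count χ * count χ + count (not ∘ χ)
bipartite-arcs≤ {n} G geo pred succ χ cross = begin
  arcs + count χ
    ≤⟨ +-monoˡ-≤ (count χ) arcs≤ ⟩
  through + count (not ∘ χ) + count χ
    ≡⟨ arith through (count (not ∘ χ)) (count χ) ⟩
  (through + count χ) + count (not ∘ χ)
    ≤⟨ +-monoˡ-≤ _ pairs ⟩
  count χ * count χ + count (not ∘ χ) ∎
  where
  open ≤-Reasoning
  open Geodetic₂ geo
  arcs = ∑[ u < n ] ∑[ v < n ] 𝟙 (G u v)
  arith : ∀ a b c → a + b + c ≡ (a + c) + b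
  arith = solve-∀
  in° out° : Fin n → ℕ
  in° w = count (λ u → G u w)
  out° w = count (G w)
  through = ∑[ w < n ] (𝟙 (not (χ w)) * (in° w * out° w))

  -- This is `(m − 1) (n − 1) ≥ 0`. The two lower bounds are where the absence of sources and sinks
  -- enters the count.
  m+n≤mn+1 : ∀ m n → 1 ≤ m → 1 ≤ n → m + n ≤ m * n + 1
  m+n≤mn+1 (suc m) (suc n) _ _ = ≤-trans (m≤m+n _ (m * n)) (≤-reflexive (eq m n))
    where
    eq : ∀ m n → suc m + suc n + m * n ≡ suc m * suc n + 1
    eq = solve-∀

  member : {p : Fin n → Bool} (i : Fin n) → p i ≡ true → 1 ≤ count p
  member {p} i e = ≤-trans (≤-reflexive (cong 𝟙 (sym e))) (member≤sum (𝟙 ∘ p) i)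

  at-middle : ∀ w → 𝟙 (not (χ w)) * in° w + 𝟙 (not (χ w)) * out° w ≤ 𝟙 (not (χ w)) * (in° w * out° w) + 𝟙 (not (χ w))
  at-middle w with χ w
  ... | true = z≤n
  ... | false = subst₂ _≤_ (sym (cong₂ _+_ (+-identityʳ (in° w)) (+-identityʳ (out° w))))
    (cong (_+ 1) (sym (+-identityʳ (in° w * out° w))))
    (m+n≤mn+1 _ _ (member (proj₁ (pred w)) (proj₂ (pred w))) (member (proj₁ (succ w)) (proj₂ (succ w))))

  arcs≡ : arcs ≡ ∑[ w < n ] (𝟙 (not (χ w)) * in° w + 𝟙 (not (χ w)) * out° w)
  arcs≡ = sym (begin-equality
    ∑[ w < n ] (𝟙 (not (χ w)) * in° w + 𝟙 (not (χ w)) * out° w)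
      ≡⟨ ∑-distrib-+ (λ w → 𝟙 (not (χ w)) * in° w) _ ⟩
    ∑[ w < n ] (𝟙 (not (χ w)) * in° w) + ∑[ w < n ] (𝟙 (not (χ w)) * out° w)
      ≡⟨ cong₂ _+_
           (trans (sum-cong-≗ {n} λ w → *-distribˡ-sum (𝟙 (not (χ w))) (λ u → 𝟙 (G u w)))
             (sym (∑-comm (λ u w → 𝟙 (not (χ w)) * 𝟙 (G u w)))))
           (sum-cong-≗ {n} λ w → *-distribˡ-sum (𝟙 (not (χ w))) (𝟙 ∘ G w)) ⟩
    ∑[ u < n ] ∑[ w < n ] (𝟙 (not (χ w)) * 𝟙 (G u w)) + ∑[ u < n ] ∑[ w < n ] (𝟙 (not (χ u)) * 𝟙 (G u w))
      ≡⟨ sym (∑∑-distrib-+ (λ u w → 𝟙 (not (χ w)) * 𝟙 (G u w)) (λ u w → 𝟙 (not (χ u)) * 𝟙 (G u w))) ⟩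
    ∑[ u < n ] ∑[ w < n ] (𝟙 (not (χ w)) * 𝟙 (G u w) + 𝟙 (not (χ u)) * 𝟙 (G u w))
      ≡⟨ sum-cong-≗ {n} (λ u → sum-cong-≗ {n} λ w → one-end u w) ⟩
    arcs ∎)
    where
    one-end : ∀ u w → 𝟙 (not (χ w)) * 𝟙 (G u w) + 𝟙 (not (χ u)) * 𝟙 (G u w) ≡ 𝟙 (G u w)
    one-end u w with G u w in e
    ... | false = cong₂ _+_ (*-zeroʳ (𝟙 (not (χ w)))) (*-zeroʳ (𝟙 (not (χ u))))
    ... | true rewrite cross u w e with χ u
    ...   | true = refl
    ...   | false = refl

  arcs≤ : arcs ≤ through + count (not ∘ χ)
  arcs≤ = begin
    arcs ≡⟨ arcs≡ ⟩
    ∑[ w < n ] (𝟙 (not (χ w)) * in° w + 𝟙 (not (χ w)) * out° w)    ≤⟨ sum-mono at-middle ⟩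
    ∑[ w < n ] (𝟙 (not (χ w)) * (in° w * out° w) + 𝟙 (not (χ w))) ≡⟨ ∑-distrib-+ (λ w → 𝟙 (not (χ w)) * (in° w * out° w)) _ ⟩
    through + count (not ∘ χ) ∎

  via : Fin n → Fin n → Fin n → Bool
  via u v w = not (χ w) ∧ (G u w ∧ G w v)

  via-true : ∀ u v w → via u v w ≡ true → χ u ≡ true × χ v ≡ true × G u w ≡ true × G w v ≡ true
  via-true u v w h with χ w in cw | G u w in uw | G w v in wv | h
  ... | false | true | true | _ =
    not-false (trans (sym (cross u w uw)) cw) , trans (cross w v wv) (cong not cw) , refl , refl
  ... | false | false | _ | ()
  ... | false | true | false | ()
  ... | true | _ | _ | ()

  -- Distinct ends admit one middle by `unique-middle`. Equal ends admit none, since a walk of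
  -- length 2 back to `u` is a digon; the second summand records this saving, which amounts to
  -- `count χ` in total.
  pairs-pointwise : ∀ u v → count (via u v) + 𝟙 (u == v) * 𝟙 (χ u) ≤ 𝟙 (χ u) * 𝟙 (χ v)
  pairs-pointwise u v with u ≟ v
  ... | yes refl rewrite count≡0 {p = via u u} (λ w → ¬true⇒false λ e →
          let _ , _ , a , b = via-true u u w e in no-digon u w a b) with χ u
  ...   | true = ≤-refl
  ...   | false = z≤n
  pairs-pointwise u v | no _ with χ u in cu | χ v in cv
  ... | true | true = ≤-trans (≤-reflexive (+-identityʳ _)) (count≤1 λ w w' a b →
    let _ , _ , p , q = via-true u v w a
        _ , _ , p' , q' = via-true u v w' b in unique-middle u v w w' p q p' q')
  ... | true | false = ≤-reflexive (trans (+-identityʳ _) (count≡0 λ w → ¬true⇒false λ e →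
    let _ , t , _ = via-true u v w e in true≢false t cv))
  ... | false | _ = ≤-reflexive (trans (+-identityʳ _) (count≡0 λ w → ¬true⇒false λ e →
    let t , _ = via-true u v w e in true≢false t cu))

  through≡ : through ≡ ∑[ u < n ] ∑[ v < n ] count (via u v)
  through≡ = begin-equality
    through
      ≡⟨ sum-cong-≗ {n} (λ w → cong (𝟙 (not (χ w)) *_) (sym (∑∑-product (λ u → 𝟙 (G u w)) (𝟙 ∘ G w)))) ⟩
    ∑[ w < n ] (𝟙 (not (χ w)) * ∑[ u < n ] ∑[ v < n ] (𝟙 (G u w) * 𝟙 (G w v)))
      ≡⟨ sum-cong-≗ {n} (λ w → trans (*-distribˡ-sum (𝟙 (not (χ w))) (λ u → ∑[ v < n ] (𝟙 (G u w) * 𝟙 (G w v))))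
           (sum-cong-≗ {n} λ u → trans (*-distribˡ-sum (𝟙 (not (χ w))) (λ v → 𝟙 (G u w) * 𝟙 (G w v)))
             (sum-cong-≗ {n} λ v → sym (trans (𝟙-∧ (not (χ w)) _) (cong (𝟙 (not (χ w)) *_) (𝟙-∧ (G u w) _)))))) ⟩
    ∑[ w < n ] ∑[ u < n ] ∑[ v < n ] 𝟙 (via u v w)
      ≡⟨ ∑-comm (λ w u → ∑[ v < n ] 𝟙 (via u v w)) ⟩
    ∑[ u < n ] ∑[ w < n ] ∑[ v < n ] 𝟙 (via u v w)
      ≡⟨ sum-cong-≗ {n} (λ u → ∑-comm (λ w v → 𝟙 (via u v w))) ⟩
    ∑[ u < n ] ∑[ v < n ] count (via u v) ∎

  diagonal : ∑[ u < n ] ∑[ v < n ] (𝟙 (u == v) * 𝟙 (χ u)) ≡ count χ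
  diagonal = trans (∑-comm (λ u v → 𝟙 (u == v) * 𝟙 (χ u))) (sum-cong-≗ {n} λ v → sum-δ v (𝟙 ∘ χ))

  pairs : through + count χ ≤ count χ * count χ
  pairs = begin
    through + count χ
      ≡⟨ cong₂ _+_ through≡ (sym diagonal) ⟩
    ∑[ u < n ] ∑[ v < n ] count (via u v) + ∑[ u < n ] ∑[ v < n ] (𝟙 (u == v) * 𝟙 (χ u))
      ≡⟨ sym (∑∑-distrib-+ (λ u v → count (via u v)) (λ u v → 𝟙 (u == v) * 𝟙 (χ u))) ⟩
    ∑[ u < n ] ∑[ v < n ] (count (via u v) + 𝟙 (u == v) * 𝟙 (χ u))
      ≤⟨ sum-mono (λ u → sum-mono (pairs-pointwise u)) ⟩
    ∑[ u < n ] ∑[ v < n ] (𝟙 (χ u) * 𝟙 (χ v))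
      ≡⟨ ∑∑-product (𝟙 ∘ χ) (𝟙 ∘ χ) ⟩
    count χ * count χ ∎

private
  -- With `r = a + k`, and so `b = a + 2 k + 1`, the last hypothesis reads
  -- `(a + k)² + 1 ≤ a² + 2 k`. This is absurd for `a ≥ 1`; for `a = 0` it says `(r − 1)² ≤ 0`,
  -- which `2 ≤ r` excludes.
  small-side : ∀ a b r → 2 ≤ r → a + b ≡ 2 * r + 1 → a ≤ r → r * r + 2 + a ≤ a * a + b → ⊥
  small-side a b r 2≤r a+b≡ a≤r h with m≤n⇒∃[o]m+o≡n a≤r
  ... | k , refl with +-cancelˡ-≡ a b (a + 2 * k + 1) (trans a+b≡ (eq a k))
    where
    eq : ∀ a k → 2 * (a + k) + 1 ≡ a + (a + 2 * k + 1)
    eq = solve-∀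
  small-side zero _ _ (s≤s (s≤s {n = j} z≤n)) _ _ h | _ , refl | refl =
    <⇒≱ (≤-trans (s≤s (m≤m+n _ (j * j + 2 * j))) (≤-reflexive (eq j))) h
    where
    eq : ∀ j → suc (2 * (2 + j) + 1 + (j * j + 2 * j)) ≡ (2 + j) * (2 + j) + 2 + 0
    eq = solve-∀
  small-side (suc a) _ _ _ _ _ h | k , refl | refl =
    <⇒≱ (≤-trans (s≤s (m≤m+n _ (2 * (a * k) + k * k))) (≤-reflexive (eq a k))) h
    where
    eq : ∀ a k → suc (suc a * suc a + (suc a + 2 * k + 1) + (2 * (a * k) + k * k))
      ≡ (suc a + k) * (suc a + k) + 2 + suc a
    eq = solve-∀

-- The order is odd, so one colour class has at most `r` vertices; `bipartite-arcs≤` is applied with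
-- the ends of the 2-walks in that class.
no-bipartite : (G : Relation n) → Geodetic₂ G → HasPredecessors G → HasSuccessors G →
  ∀ r → 2 ≤ r → n ≡ 2 * r + 1 → ∑[ u < n ] ∑[ v < n ] 𝟙 (G u v) ≡ r * r + 2 →
  ∀ χ → Crossing G χ → ⊥
no-bipartite {n} G geo pred succ r 2≤r n≡ arcs≡ χ cross with ≤-<-connex (count χ) r
... | inj₁ a≤r = small-side (count χ) (count (not ∘ χ)) r 2≤r (trans (count-not χ) n≡) a≤r
  (≤-trans (≤-reflexive (cong (_+ count χ) (sym arcs≡))) (bipartite-arcs≤ G geo pred succ χ cross))
... | inj₂ r<a = small-side b a r 2≤r (trans (+-comm b a) ab≡) b≤r
  (≤-trans (≤-reflexive (cong (_+ b) (sym arcs≡)))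
    (≤-trans (bipartite-arcs≤ G geo pred succ (not ∘ χ) (λ u v e → cong not (cross u v e)))
      (≤-reflexive (cong (b * b +_) (sum-cong-≗ {n} λ v → cong 𝟙 (Bool.not-involutive (χ v)))))))
  where
  a = count χ
  b = count (not ∘ χ)
  ab≡ : a + b ≡ 2 * r + 1
  ab≡ = trans (count-not χ) n≡
  b≤r : b ≤ r
  b≤r = +-cancelˡ-≤ (suc r) _ _ (≤-trans (+-monoˡ-≤ b r<a) (≤-reflexive (trans ab≡ (arith r))))
    where
    arith : ∀ r → 2 * r + 1 ≡ suc r + r
    arith = solve-∀

-- 0/1 matrices

Sparse : Relation n → Set
Sparse {n} M = (∀ i j j' → M i j ≡ true → M i j' ≡ true → j ≡ j') × (∀ j i i' → M i j ≡ true → M i' j ≡ true → i ≡ i')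

-- F₁ and F₂ forbid the 2 × 2 submatrices with two distinct constant rows, resp. columns.
module SparseOrDense {n} (4≤n : 4 ≤ n) (M : Relation n)
  (F₁ : ∀ i i' j j' → j ≢ j' → M i j ≡ true → M i j' ≡ true → M i' j ≡ false → M i' j' ≡ false → ⊥)
  (F₂ : ∀ j j' i i' → i ≢ i' → M i j ≡ true → M i' j ≡ true → M i j' ≡ false → M i' j' ≡ false → ⊥) where

  third : (j j' : Fin n) → ∃ λ k → k ≢ j × k ≢ j'
  third j j' = let k , ne = fresh (≤-trans (n≤1+n 3) 4≤n) (λ { 0F → j ; 1F → j' }) in k , ne 0F , ne 1F

  -- Suppose row `i` had ones at `j`, `j'` and zeros at `k`, `k'`. By `F₁` another row `i'` is not
  -- zero at both `j`, `j'` and not one at both `k`, `k'`. It thus agrees with row `i` in one column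
  -- of ones and in one column of zeros, which `F₂` forbids.
  two-ones⇒one-zero : ∀ i j j' → j ≢ j' → M i j ≡ true → M i j' ≡ true →
    ∀ k k' → M i k ≡ false → M i k' ≡ false → k ≡ k'
  two-ones⇒one-zero i j j' j≢j' m m' k k' z z' with k ≟ k'
  ... | yes e = e
  ... | no k≢k' with third i i
  ...   | i' , i'≢i , _ with M i' j in a | M i' j' in b | M i' k in c | M i' k' in d
  ...     | false | false | _ | _ = contradiction b (F₁ i i' j j' j≢j' m m' a)
  ...     | _ | _ | true | true = contradiction z' (F₁ i' i k k' k≢k' c d z)
  ...     | true | _ | false | _ = contradiction c (F₂ j k i i' (i'≢i ∘ sym) m a z)
  ...     | true | _ | _ | false = contradiction d (F₂ j k' i i' (i'≢i ∘ sym) m a z')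
  ...     | _ | true | false | _ = contradiction c (F₂ j' k i i' (i'≢i ∘ sym) m' b z)
  ...     | _ | true | _ | false = contradiction d (F₂ j' k' i i' (i'≢i ∘ sym) m' b z')

  -- Column classes: (1,1), (1,0) and (0,∗) in rows i, i' would each occur at most once.
  two-ones⇒dense : ∀ i j j' → j ≢ j' → M i j ≡ true → M i j' ≡ true →
    ∀ i' k k' → M i' k ≡ false → M i' k' ≡ false → k ≡ k'
  two-ones⇒dense i j j' j≢j' m m' i' k k' z z' with k ≟ k'
  ... | yes e = e
  ... | no k≢k' with Fin.pigeonhole 4≤n (λ c → class (M i c) (M i' c))
    where
    class : Bool → Bool → Fin 3
    class true true = 0F
    class true false = 1F
    class false _ = 2F
  ... | c , c' , c<c' , same with M i c in a | M i c' in a' | M i' c in b | M i' c' in b' | same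
  ...   | true | true | true | true | _ = contradiction (two-ones⇒one-zero i' c c' (Fin.<⇒≢ c<c') b b' k k' z z') k≢k'
  ...   | true | true | false | false | _ = contradiction b' (F₁ i i' c c' (Fin.<⇒≢ c<c') a a' b)
  ...   | false | false | _ | _ | _ = contradiction (two-ones⇒one-zero i j j' j≢j' m m' c c' a a') (Fin.<⇒≢ c<c')
  ...   | false | true | _ | true | ()
  ...   | false | true | _ | false | ()
  ...   | true | false | true | _ | ()
  ...   | true | false | false | _ | ()
  ...   | true | true | true | false | ()
  ...   | true | true | false | true | ()

  -- A single row with two ones forces at most one zero in every row; without such a row, every row
  -- has at most one one. The bound passes to columns by comparing a column having two exceptional
  -- entries with any other column, which is constant in those rows with the opposite value, against
  -- `F₂`.
  sparse-or-dense : Sparse M ⊎ Sparse (λ j i → not (M i j))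
  sparse-or-dense with any? (λ i → any? (λ j → any? (λ j' →
      Relation.Nullary.¬? (j ≟ j') ×-dec ((M i j Bool.≟ true) ×-dec (M i j' Bool.≟ true)))))
  ... | yes (i , j , j' , j≢j' , m , m') = inj₂ (columns , rows)
    where
    rows : ∀ i' k k' → not (M i' k) ≡ true → not (M i' k') ≡ true → k ≡ k'
    rows i' k k' z z' = two-ones⇒dense i j j' j≢j' m m' i' k k' (not-true z) (not-true z')
    columns : ∀ k i₁ i₂ → not (M i₁ k) ≡ true → not (M i₂ k) ≡ true → i₁ ≡ i₂
    columns k i₁ i₂ z₁ z₂ with i₁ ≟ i₂
    ... | yes e = e
    ... | no i₁≢i₂ with third k k
    ...   | c , c≢k , _ = contradiction (not-true z₂)
      (F₂ c k i₁ i₂ i₁≢i₂ (other i₁ z₁) (other i₂ z₂) (not-true z₁))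
      where
      other : ∀ i → not (M i k) ≡ true → M i c ≡ true
      other i z = not-false (¬true⇒false λ e → c≢k (rows i c k e z))
  ... | no none = inj₁ (rows , columns)
    where
    rows : ∀ i j j' → M i j ≡ true → M i j' ≡ true → j ≡ j'
    rows i j j' m m' with j ≟ j'
    ... | yes e = e
    ... | no j≢j' = contradiction (i , j , j' , j≢j' , m , m') none
    columns : ∀ j i i' → M i j ≡ true → M i' j ≡ true → i ≡ i'
    columns j i i' m m' with i ≟ i'
    ... | yes e = e
    ... | no i≢i' with third j j
    ...   | c , c≢j , _ = contradiction (zero-at i' m') (F₂ j c i i' i≢i' m m' (zero-at i m))
      where
      zero-at : ∀ i → M i j ≡ true → M i c ≡ false
      zero-at i m = ¬true⇒false λ e → c≢j (rows i c j e m)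

transpose-matchˡ : (i j : Fin n) → transpose i j ⟨$⟩ʳ i ≡ j
transpose-matchˡ i j with i ≟ i
... | yes _ = refl
... | no i≢i = contradiction refl i≢i

transpose-mismatch : (i j k : Fin n) → k ≢ i → k ≢ j → transpose i j ⟨$⟩ʳ k ≡ k
transpose-mismatch i j k k≢i k≢j with k ≟ i
... | yes e = contradiction e k≢i
... | no _ with k ≟ j
...   | yes e = contradiction e k≢j
...   | no _ = refl

perm-injective : (π : Permutation′ n) → ∀ {i j} → π ⟨$⟩ʳ i ≡ π ⟨$⟩ʳ j → i ≡ j
perm-injective π {i} {j} e = trans (sym (Perm.inverseˡ π)) (trans (cong (π Perm.⟨$⟩ˡ_) e) (Perm.inverseˡ π))

-- Rows are treated one at a time. To make row `i₀` go to `j₀`, its current image is transposed with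
-- `j₀`. This leaves earlier nonzero rows alone: their images differ from that of `i₀` by
-- injectivity, and from `j₀` because column `j₀` has only one entry.
extend-to-permutation : (M : Relation n) → Sparse M →
  ∃ λ (π : Permutation′ n) → ∀ i j → M i j ≡ true → π ⟨$⟩ʳ i ≡ j
extend-to-permutation {n} M (rows , columns) =
  let π , h = first n ≤-refl in π , λ i j → h i j (Fin.toℕ<n i)
  where
  first : ∀ k → k ≤ n → ∃ λ (π : Permutation′ n) → ∀ i j → toℕ i < k → M i j ≡ true → π ⟨$⟩ʳ i ≡ j
  first zero _ = Perm.id , λ _ _ ()
  first (suc k) k<n with first k (≤-trans (n≤1+n k) k<n)
  ... | π , h with any? (λ j → M (fromℕ< k<n) j Bool.≟ true)
  ...   | no none = π , λ i j i<1+k m → case-last i j (m<1+n⇒m<n∨m≡n i<1+k) m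
    where
    case-last : ∀ i j → toℕ i < k ⊎ toℕ i ≡ k → M i j ≡ true → π ⟨$⟩ʳ i ≡ j
    case-last i j (inj₁ i<k) m = h i j i<k m
    case-last i j (inj₂ refl) m = contradiction (j , subst (λ i → M i j ≡ true) (sym (Fin.fromℕ<-toℕ i k<n)) m) none
  ...   | yes (j₀ , m₀) = π ∘ₚ transpose (π ⟨$⟩ʳ i₀) j₀ , λ i j i<1+k m → case-last i j (m<1+n⇒m<n∨m≡n i<1+k) m
    where
    i₀ = fromℕ< k<n
    case-last : ∀ i j → toℕ i < k ⊎ toℕ i ≡ k → M i j ≡ true → transpose (π ⟨$⟩ʳ i₀) j₀ ⟨$⟩ʳ (π ⟨$⟩ʳ i) ≡ j
    case-last i j (inj₁ i<k) m = trans (transpose-mismatch (π ⟨$⟩ʳ i₀) j₀ _ (i≢i₀ ∘ perm-injective π)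
      (λ e → i≢i₀ (columns j₀ i i₀ (subst (λ j → M i j ≡ true) (trans (sym (h i j i<k m)) e) m) m₀))) (h i j i<k m)
      where
      i≢i₀ : i ≢ i₀
      i≢i₀ refl = <⇒≢ i<k (Fin.toℕ-fromℕ< k<n)
    case-last i j (inj₂ refl) m with fromℕ< k<n | Fin.fromℕ<-toℕ i k<n
    ... | _ | refl = trans (transpose-matchˡ (π ⟨$⟩ʳ i) j₀) (rows i j₀ j m₀ m)

-- Encoding by states

-- (true , t) stands for an arc from corner t of the triangle, (false , t) for an arc to it.
Attachment : Set
Attachment = Bool × Fin 3

fromCorner toCorner : Attachment → Fin 3 → Bool
fromCorner (d , t) t' = d ∧ (t == t')
toCorner (d , t) t' = not d ∧ (t == t')

-- The state of an index i: whether x_i → y_i, and how x_i and y_i are attached to the triangle.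
record State : Set where
  constructor state
  field
    matched : Bool
    attX attY : Attachment
open State public

data Vtx (s : ℕ) : Set where
  ▵ : Fin 3 → Vtx s
  X Y : Fin s → Vtx s

next : Fin 3 → Fin 3
next 0F = 1F
next 1F = 2F
next 2F = 0F

next³ : ∀ t → next (next (next t)) ≡ t
next³ 0F = refl
next³ 1F = refl
next³ 2F = refl

next-injective : ∀ t t' → next t ≡ next t' → t ≡ t'
next-injective t t' e = trans (sym (next³ t)) (trans (cong (next ∘ next) e) (next³ t'))

arc : ∀ {s} → (Fin s → State) → Vtx s → Vtx s → Bool
arc f (▵ t) (▵ t') = next t == t'
arc f (▵ t) (X i) = fromCorner (attX (f i)) t
arc f (▵ t) (Y i) = fromCorner (attY (f i)) t
arc f (X i) (▵ t) = toCorner (attX (f i)) t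
arc f (X i) (X j) = false
arc f (X i) (Y j) = (i == j) ∧ matched (f i)
arc f (Y i) (▵ t) = toCorner (attY (f i)) t
arc f (Y j) (X i) = not ((i == j) ∧ matched (f i))
arc f (Y i) (Y j) = false

infix 4 _≃_

-- Unlike `Iso`, this compares digraphs on different vertex types, so that `Vtx s` can be used in
-- place of `Fin n`.
record _≃_ {V W : Set} (G : V → V → Bool) (H : W → W → Bool) : Set where
  constructor iso
  field
    bij : V ↔ W
    arcs : ∀ u v → G u v ≡ H (Inverse.to bij u) (Inverse.to bij v)

-- From two sides to a family of states

module Assemble {n} (G : Relation n) (geo : Geodetic₂ G) (T : Fin 3 → Fin n)
  (T-arcs : ∀ t t' → G (T t) (T t') ≡ (next t == t')) where
  open Geodetic₂ geo

  AttachedBy : Fin n → Attachment → Set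
  AttachedBy v a = ∀ t → G (T t) v ≡ fromCorner a t × G v (T t) ≡ toCorner a t

  record Sides (s : ℕ) (A B : Fin n → Bool) : Set where
    field
      count-A : count A ≡ s
      count-B : count B ≡ s
      cover : ∀ v → (∃ λ t → T t ≡ v) ⊎ A v ≡ true ⊎ B v ≡ true
      disjoint : ∀ v → A v ≡ true → B v ≡ true → ⊥
      corner∉A : ∀ t → A (T t) ≡ false
      corner∉B : ∀ t → B (T t) ≡ false
      indepA : ∀ u v → A u ≡ true → A v ≡ true → G u v ≡ false
      indepB : ∀ u v → B u ≡ true → B v ≡ true → G u v ≡ false
      between : ∀ a b → A a ≡ true → B b ≡ true → G b a ≡ not (G a b)
      attachedA : ∀ v → A v ≡ true → ∃ (AttachedBy v)
      attachedB : ∀ v → B v ≡ true → ∃ (AttachedBy v)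

  swap : ∀ {s A B} → Sides s A B → Sides s B A
  swap S = record
    { count-A = count-B ; count-B = count-A
    ; cover = λ v → Sum.map₂ Sum.swap (cover v)
    ; disjoint = λ v b a → disjoint v a b
    ; corner∉A = corner∉B ; corner∉B = corner∉A
    ; indepA = indepB ; indepB = indepA
    ; between = λ b a hb ha → trans (sym (Bool.not-involutive (G a b))) (cong not (sym (between a b ha hb)))
    ; attachedA = attachedB ; attachedB = attachedA }
    where open Sides S

  module _ {s A B} (S : Sides s A B) where
    open Sides S
    private
      module EA = Enumeration (subst (Enumeration A) count-A (enumerate A))
      module EB = Enumeration (subst (Enumeration B) count-B (enumerate B))

    M : Relation s
    M i j = G (EA.elem i) (EB.elem j)

    -- Renumbering `B` by the permutation that extends `M` makes every arc from `A` to `B` join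
    -- equal indices; by `between`, all other pairs carry an arc from `B` to `A`, as in `arc`.
    assemble : Sparse M → ∃ λ f → arc {s} f ≃ G
    assemble sparse = f , iso (bijection φ φ-injective φ-surjective) φ-arcs
      where
      π = proj₁ (extend-to-permutation M sparse)
      x y : Fin s → Fin n
      x = EA.elem
      y i = EB.elem (π ⟨$⟩ʳ i)
      ax : ∀ i → ∃ (AttachedBy (x i))
      ax i = attachedA (x i) (EA.sound i)
      ay : ∀ i → ∃ (AttachedBy (y i))
      ay i = attachedB (y i) (EB.sound _)
      f : Fin s → State
      f i = state (G (x i) (y i)) (proj₁ (ax i)) (proj₁ (ay i))
      φ : Vtx s → Fin n
      φ (▵ t) = T t
      φ (X i) = x i
      φ (Y i) = y i
      x→y : ∀ i j → (i == j) ∧ G (x i) (y i) ≡ G (x i) (y j)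
      x→y i j with i ≟ j
      ... | yes refl = refl
      ... | no i≢j = sym (¬true⇒false λ e → i≢j (perm-injective π (proj₂ (extend-to-permutation M sparse) i _ e)))
      φ-arcs : ∀ u v → arc f u v ≡ G (φ u) (φ v)
      φ-arcs (▵ t) (▵ t') = sym (T-arcs t t')
      φ-arcs (▵ t) (X i) = sym (proj₁ (proj₂ (ax i) t))
      φ-arcs (▵ t) (Y i) = sym (proj₁ (proj₂ (ay i) t))
      φ-arcs (X i) (▵ t) = sym (proj₂ (proj₂ (ax i) t))
      φ-arcs (X i) (X j) = sym (indepA _ _ (EA.sound i) (EA.sound j))
      φ-arcs (X i) (Y j) = x→y i j
      φ-arcs (Y i) (▵ t) = sym (proj₂ (proj₂ (ay i) t))
      φ-arcs (Y j) (X i) = trans (cong not (x→y i j)) (sym (between _ _ (EA.sound i) (EB.sound _)))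
      φ-arcs (Y i) (Y j) = sym (indepB _ _ (EB.sound _) (EB.sound _))
      corner-injective : ∀ t t' → T t ≡ T t' → t ≡ t'
      corner-injective t t' e = next-injective t t' (==⇒≡ (trans (sym (T-arcs t (next t')))
        (trans (cong (λ v → G v (T (next t'))) e) (trans (T-arcs t' (next t')) (==-refl (next t'))))))
      φ-injective : ∀ {u v} → φ u ≡ φ v → u ≡ v
      φ-injective {▵ t} {▵ t'} e = cong ▵ (corner-injective t t' e)
      φ-injective {▵ t} {X i} e = true≢false (EA.sound i) (trans (cong A (sym e)) (corner∉A t))
      φ-injective {▵ t} {Y i} e = true≢false (EB.sound _) (trans (cong B (sym e)) (corner∉B t))
      φ-injective {X i} {▵ t} e = true≢false (EA.sound i) (trans (cong A e) (corner∉A t))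
      φ-injective {X i} {X j} e = cong X (EA.injective e)
      φ-injective {X i} {Y j} e = contradiction (EB.sound _) (disjoint _ (trans (cong A (sym e)) (EA.sound i)))
      φ-injective {Y i} {▵ t} e = true≢false (EB.sound _) (trans (cong B e) (corner∉B t))
      φ-injective {Y i} {X j} e = contradiction (EB.sound _) (disjoint _ (trans (cong A e) (EA.sound j)))
      φ-injective {Y i} {Y j} e = cong Y (perm-injective π (EB.injective e))
      φ-surjective : ∀ v → ∃ λ u → φ u ≡ v
      φ-surjective v with cover v
      ... | inj₁ (t , e) = ▵ t , e
      ... | inj₂ (inj₁ a) = let i , e = EA.complete v a in X i , e
      ... | inj₂ (inj₂ b) = let j , e = EB.complete v b in
        Y (π Perm.⟨$⟩ˡ j) , trans (cong EB.elem (Perm.inverseʳ π)) e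

    -- A row of ones at two columns above a row of zeros there is a pair of 2-walks from one vertex
    -- of `A` to another through two vertices of `B`. For columns, the ends lie in `B` and the
    -- middles in `A`. Both contradict `unique-middle`.
    M-dichotomy : 4 ≤ s → Sparse M ⊎ Sparse (λ j i → not (M i j))
    M-dichotomy 4≤s = SparseOrDense.sparse-or-dense 4≤s M
      (λ i i' j j' j≢j' a b c d → j≢j' (EB.injective (unique-middle (EA.elem i) (EA.elem i') _ _ a (rev i' j c) b (rev i' j' d))))
      (λ j j' i i' i≢i' a b c d → i≢i' (EA.injective (unique-middle (EB.elem j') (EB.elem j) _ _ (rev i j' c) a (rev i' j' d) b)))
      where
      rev : ∀ i j → M i j ≡ false → G (EB.elem j) (EA.elem i) ≡ true
      rev i j e = trans (between _ _ (EA.sound i) (EB.sound j)) (cong not e)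

  -- If the arcs from `A` to `B` are dense, those from `B` to `A` are sparse, and the two sides
  -- exchange their roles.
  assembled : ∀ {s A B} → 4 ≤ s → Sides s A B → ∃ λ f → arc {s} f ≃ G
  assembled {s} {A} {B} 4≤s S with M-dichotomy S 4≤s
  ... | inj₁ sparse = assemble S sparse
  ... | inj₂ (rows , columns) = assemble (swap S)
    ( (λ j i i' a b → rows j i i' (trans (sym (flip i j)) a) (trans (sym (flip i' j)) b))
    , (λ i j j' a b → columns i j j' (trans (sym (flip i j)) a) (trans (sym (flip i j')) b)) )
    where
    open Sides S
    flip : ∀ i j → M (swap S) j i ≡ not (M S i j)
    flip i j = between _ _ (Enumeration.sound (subst (Enumeration A) count-A (enumerate A)) i)
      (Enumeration.sound (subst (Enumeration B) count-B (enumerate B)) j)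

-- The underlying graph of a 2-geodetic digraph

module Underlying {n} (G : Relation n) (geo : Geodetic₂ G) where
  open Geodetic₂ geo

  U : Relation n
  U u v = G u v ∨ G v u

  U-symmetric : Symmetric U
  U-symmetric u v = Bool.∨-comm (G u v) (G v u)

  U-cases : ∀ u v → U u v ≡ true → G u v ≡ true ⊎ G v u ≡ true
  U-cases u v e with G u v | G v u
  ... | true | _ = inj₁ refl
  ... | false | true = inj₂ refl

  arc⇒U : ∀ u v → G u v ≡ true → U u v ≡ true
  arc⇒U u v e rewrite e = refl

  ¬U⇒¬arc : ∀ u v → U u v ≡ false → G u v ≡ false
  ¬U⇒¬arc u v e = ¬true⇒false λ g → true≢false (arc⇒U u v g) e

  reverse-arc : ∀ u v → U u v ≡ true → G v u ≡ not (G u v)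
  reverse-arc u v e with G u v in uv | G v u in vu
  ... | true | true = contradiction vu (no-digon u v uv)
  ... | true | false = refl
  ... | false | true = refl
  ... | false | false = e

  U-irreflexive : Irreflexive U
  U-irreflexive u = trans (Bool.∨-idem (G u u)) (¬true⇒false (no-loop u))

  -- Every other orientation of the remaining two sides makes the triangle transitive, and so
  -- contains a shortcut.
  directed-triangle : ∀ u v w → G u v ≡ true → U u w ≡ true → U v w ≡ true → G v w ≡ true × G w u ≡ true
  directed-triangle u v w uv uw vw with U-cases u w uw | U-cases v w vw
  ... | inj₁ a | inj₁ b = contradiction a (no-shortcut u v w uv b)
  ... | inj₁ a | inj₂ b = contradiction uv (no-shortcut u w v a b)
  ... | inj₂ a | inj₁ b = b , a
  ... | inj₂ a | inj₂ b = contradiction b (no-shortcut w u v a uv)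

  -- Two triangles on one edge are both directed, so they yield two 2-walks from the head of the arc
  -- back to its tail.
  U-bookFree : BookFree U
  U-bookFree u v w w' uv uw vw uw' vw' with U-cases u v uv
  ... | inj₁ g = let a , b = directed-triangle u v w g uw vw
                     c , d = directed-triangle u v w' g uw' vw' in unique-middle v u w w' a b c d
  ... | inj₂ g = let a , b = directed-triangle v u w g vw uw
                     c , d = directed-triangle v u w' g vw' uw' in unique-middle u v w w' a b c d

  vol-U : vol U ≡ 2 * ∑[ u < n ] ∑[ v < n ] 𝟙 (G u v)
  vol-U = begin
    vol U
      ≡⟨ sum-cong-≗ {n} (λ u → sum-cong-≗ {n} λ v → one-direction u v) ⟩
    ∑[ u < n ] ∑[ v < n ] (𝟙 (G u v) + 𝟙 (G v u))
      ≡⟨ ∑∑-distrib-+ (λ u v → 𝟙 (G u v)) (λ u v → 𝟙 (G v u)) ⟩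
    ∑[ u < n ] ∑[ v < n ] 𝟙 (G u v) + ∑[ u < n ] ∑[ v < n ] 𝟙 (G v u)
      ≡⟨ cong (∑[ u < n ] ∑[ v < n ] 𝟙 (G u v) +_) (trans (∑-comm (λ u v → 𝟙 (G v u))) (sym (+-identityʳ _))) ⟩
    2 * ∑[ u < n ] ∑[ v < n ] 𝟙 (G u v) ∎
    where
    open ≡-Reasoning
    one-direction : ∀ u v → 𝟙 (U u v) ≡ 𝟙 (G u v) + 𝟙 (G v u)
    one-direction u v with G u v in uv | G v u in vu
    ... | true | true = contradiction vu (no-digon u v uv)
    ... | true | false = refl
    ... | false | _ = refl

  find-triangle : (TriangleFree U → ⊥) → ∃ λ x → ∃₂ λ y z → G x y ≡ true × G y z ≡ true × G z x ≡ true
  find-triangle some with any? (λ u → any? (λ v → any? (λ w →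
    (U u v Bool.≟ true) ×-dec ((U v w Bool.≟ true) ×-dec (U u w Bool.≟ true)))))
  ... | no none = contradiction (λ u v w a b c → none (u , v , w , a , b , c)) some
  ... | yes (u , v , w , uv , vw , uw) with U-cases u v uv
  ...   | inj₁ g = let a , b = directed-triangle u v w g uw vw in u , v , w , g , a , b
  ...   | inj₂ g = let a , b = directed-triangle v u w g vw uw in v , u , w , g , a , b

module FromPartition {n} (G : Relation n) (geo : Geodetic₂ G) (x y z : Fin n)
  (xy : G x y ≡ true) (yz : G y z ≡ true) (zx : G z x ≡ true) (s : ℕ) (A B : Fin n → Bool)
  (cover : ∀ w → outside x y z w ≡ A w ∨ B w) (disjoint : ∀ w → A w ≡ true → B w ≡ true → ⊥)
  (count-A : count A ≡ s) (count-B : count B ≡ s)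
  (between : ∀ u v → restrict (outside x y z) (Underlying.U G geo) u v ≡ complete-bipartite A B u v)
  (attached-once : ∀ v → outside x y z v ≡ true →
    𝟙 (Underlying.U G geo v x) + 𝟙 (Underlying.U G geo v y) + 𝟙 (Underlying.U G geo v z) ≡ 1) where
  open Geodetic₂ geo
  open Underlying G geo
  other : Fin n → Bool
  other = outside x y z
  T : Fin 3 → Fin n
  T 0F = x
  T 1F = y
  T 2F = z
  loop : ∀ u → G u u ≡ false
  loop u = ¬true⇒false (no-loop u)
  backward : ∀ u v → G u v ≡ true → G v u ≡ false
  backward u v e = ¬true⇒false (no-digon u v e)
  T-arcs : ∀ t t' → G (T t) (T t') ≡ (next t == t')
  T-arcs 0F 0F = loop x
  T-arcs 0F 1F = xy
  T-arcs 0F 2F = backward z x zx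
  T-arcs 1F 0F = backward x y xy
  T-arcs 1F 1F = loop y
  T-arcs 1F 2F = yz
  T-arcs 2F 0F = zx
  T-arcs 2F 1F = backward y z yz
  T-arcs 2F 2F = loop z
  open Assemble G geo T T-arcs
  corner-other : ∀ t → other (T t) ≡ false
  corner-other t = ¬true⇒false λ e → not-corner t (outside⇒≢ {x = x} {y} {z} {T t} e)
    where
    not-corner : ∀ t → T t ≢ x × T t ≢ y × T t ≢ z → ⊥
    not-corner 0F (a , _ , _) = a refl
    not-corner 1F (_ , b , _) = b refl
    not-corner 2F (_ , _ , c) = c refl
  corner∉A : ∀ t → A (T t) ≡ false
  corner∉A t with A (T t) | B (T t) | trans (sym (cover (T t))) (corner-other t)
  ... | false | _ | _ = refl
  corner∉B : ∀ t → B (T t) ≡ false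
  corner∉B t with A (T t) | B (T t) | trans (sym (cover (T t))) (corner-other t)
  ... | false | false | _ = refl
  A⇒other : ∀ v → A v ≡ true → other v ≡ true
  A⇒other v a = trans (cover v) (cong (_∨ B v) a)
  B⇒other : ∀ v → B v ≡ true → other v ≡ true
  B⇒other v b = trans (cover v) (trans (cong (A v ∨_) b) (Bool.∨-zeroʳ (A v)))
  U≡ : ∀ u v → other u ≡ true → other v ≡ true → U u v ≡ complete-bipartite A B u v
  U≡ u v ou ov = trans (sym (cong₂ (λ a b → a ∧ (b ∧ U u v)) ou ov)) (between u v)
  indepA : ∀ u v → A u ≡ true → A v ≡ true → G u v ≡ false
  indepA u v au av = ¬U⇒¬arc u v (trans (U≡ u v (A⇒other u au) (A⇒other v av))
    (cong₂ _∨_ (cong₂ _∧_ au (¬true⇒false (disjoint v av))) (cong (_∧ A v) (¬true⇒false (disjoint u au)))))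
  indepB : ∀ u v → B u ≡ true → B v ≡ true → G u v ≡ false
  indepB u v bu bv = ¬U⇒¬arc u v (trans (U≡ u v (B⇒other u bu) (B⇒other v bv))
    (cong₂ _∨_ (cong (_∧ B v) (¬true⇒false λ au → disjoint u au bu)) (cong₂ _∧_ bu (¬true⇒false λ av → disjoint v av bv))))
  attached : ∀ v → other v ≡ true → ∃ (AttachedBy v)
  attached v o = by-corner (attached-once v o)
    where
    at : ∀ t → U v (T t) ≡ true → (∀ t' → t ≢ t' → U v (T t') ≡ false) → ∃ (AttachedBy v)
    at t yes-t no-t' = (G (T t) v , t) , arcs
      where
      arcs : AttachedBy v (G (T t) v , t)
      arcs t' with t ≟ t'
      ... | yes refl = sym (Bool.∧-identityʳ _) , trans (reverse-arc (T t) v (trans (U-symmetric (T t) v) yes-t)) (sym (Bool.∧-identityʳ _))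
      ... | no t≢t' = trans (¬U⇒¬arc (T t') v (trans (U-symmetric (T t') v) (no-t' t' t≢t'))) (sym (Bool.∧-zeroʳ _))
                    , trans (¬U⇒¬arc v (T t') (no-t' t' t≢t')) (sym (Bool.∧-zeroʳ _))
    by-corner : 𝟙 (U v x) + 𝟙 (U v y) + 𝟙 (U v z) ≡ 1 → ∃ (AttachedBy v)
    by-corner e with U v x in ux | U v y in uy | U v z in uz | e
    ... | true | false | false | _ = at 0F ux λ { 0F ne → contradiction refl ne ; 1F _ → uy ; 2F _ → uz }
    ... | false | true | false | _ = at 1F uy λ { 0F _ → ux ; 1F ne → contradiction refl ne ; 2F _ → uz }
    ... | false | false | true | _ = at 2F uz λ { 0F _ → ux ; 1F _ → uy ; 2F ne → contradiction refl ne }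
    ... | true | true | true | ()
    ... | true | true | false | ()
    ... | true | false | true | ()
    ... | false | true | true | ()
    ... | false | false | false | ()
  corner-or-side : ∀ v → (∃ λ t → T t ≡ v) ⊎ A v ≡ true ⊎ B v ≡ true
  corner-or-side v with v ≟ x | v ≟ y | v ≟ z | A v | B v | cover v
  ... | yes refl | _ | _ | _ | _ | _ = inj₁ (0F , refl)
  ... | no _ | yes refl | _ | _ | _ | _ = inj₁ (1F , refl)
  ... | no _ | no _ | yes refl | _ | _ | _ = inj₁ (2F , refl)
  ... | no _ | no _ | no _ | true | _ | _ = inj₂ (inj₁ refl)
  ... | no _ | no _ | no _ | false | true | _ = inj₂ (inj₂ refl)
  ... | no _ | no _ | no _ | false | false | ()
  sides : Sides s A B
  sides = record
    { count-A = count-A ; count-B = count-B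
    ; cover = corner-or-side
    ; disjoint = disjoint
    ; corner∉A = corner∉A ; corner∉B = corner∉B
    ; indepA = indepA ; indepB = indepB
    ; between = λ a b ha hb → reverse-arc a b (trans (U≡ a b (A⇒other a ha) (B⇒other b hb))
        (cong (_∨ (B a ∧ A b)) (cong₂ _∧_ ha hb)))
    ; attachedA = λ v a → attached v (A⇒other v a)
    ; attachedB = λ v b → attached v (B⇒other v b) }

structure : (G : Relation n) → Geodetic₂ G → HasPredecessors G → HasSuccessors G →
  ∀ s → 4 ≤ s → n ≡ 2 * suc s + 1 → ∑[ u < n ] ∑[ v < n ] 𝟙 (G u v) ≡ suc s * suc s + 2 →
  ∃ λ f → arc {s} f ≃ G
structure {n} G geo pred succ (suc s⁻) 4≤s@(s≤s 3≤s⁻) n≡ arcs≡ = from-triangle (find-triangle has-triangle)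
  where
  open Underlying G geo
  s = suc s⁻
  3+ = m≤n⇒∃[o]m+o≡n 3≤s⁻
  vol≡ : vol U ≡ 2 * (suc s * suc s + 2)
  vol≡ = trans vol-U (cong (2 *_) arcs≡)
  has-triangle : TriangleFree U → ⊥
  has-triangle tf = no-bipartite G geo pred succ (suc s) (s≤s (s≤s z≤n)) n≡ arcs≡ (proj₁ bipartition)
    λ u v e → proj₂ bipartition u v (arc⇒U u v e)
    where
    bipartition : ∃ (Crossing U)
    bipartition = triangle-free⇒bipartite U U-symmetric tf s n≡ vol≡
  from-triangle : (∃ λ x → ∃₂ λ y z → G x y ≡ true × G y z ≡ true × G z x ≡ true) → ∃ λ f → arc {s} f ≃ G
  from-triangle (x , y , z , xy , yz , zx) = Assemble.assembled G geo P.T P.T-arcs 4≤s P.sides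
    where
    arith₁ : ∀ s → 2 * suc s + 1 ≡ 2 * s + 3
    arith₁ = solve-∀
    arith₂ : ∀ s → 2 * (suc s * suc s + 2) ≡ 2 * (s * s + 2 * s + 3)
    arith₂ = solve-∀
    module R = AroundTriangle U U-symmetric U-irreflexive U-bookFree x y z (arc⇒U x y xy) (arc⇒U y z yz)
      (trans (U-symmetric x z) (arc⇒U z x zx)) s⁻ (proj₁ 3+) (sym (proj₂ 3+)) (trans n≡ (arith₁ s)) (trans vol≡ (arith₂ s))
    module P = FromPartition G geo x y z xy yz zx s R.A R.B R.cover R.disjoint R.count-A R.count-B R.between R.attached-once

private variable
  s s⁻ : ℕ

-- Compatible states

mapVtx : {r s : ℕ} → (Fin r → Fin s) → Vtx r → Vtx s
mapVtx ι (▵ t) = ▵ t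
mapVtx ι (X i) = X (ι i)
mapVtx ι (Y i) = Y (ι i)

module _ {r s} (f : Fin s → State) (ι : Fin r → Fin s) (ι-inj : ∀ {i j} → ι i ≡ ι j → i ≡ j) where

  private
    same-index : ∀ i j → (i == j) ≡ (ι i == ι j)
    same-index i j with i ≟ j
    ... | yes refl = sym (==-refl (ι i))
    ... | no ne = sym (≢⇒== (ne ∘ ι-inj))

  -- An injective choice of indices gives an induced subdigraph. With three indices this makes the
  -- obstructions local; with a bijection it renumbers the pairs.
  arc-reindex : ∀ u v → arc (f ∘ ι) u v ≡ arc f (mapVtx ι u) (mapVtx ι v)
  arc-reindex (▵ t) (▵ t') = refl
  arc-reindex (▵ t) (X i) = refl
  arc-reindex (▵ t) (Y i) = refl
  arc-reindex (X i) (▵ t) = refl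
  arc-reindex (X i) (X j) = refl
  arc-reindex (X i) (Y j) = cong (_∧ matched (f (ι i))) (same-index i j)
  arc-reindex (Y i) (▵ t) = refl
  arc-reindex (Y j) (X i) = cong (λ b → not (b ∧ matched (f (ι i)))) (same-index i j)
  arc-reindex (Y i) (Y j) = refl

  mapVtx-injective : ∀ {u v} → mapVtx ι u ≡ mapVtx ι v → u ≡ v
  mapVtx-injective {▵ t} {▵ t} refl = refl
  mapVtx-injective {X i} {X j} e = cong X (ι-inj (X-injective e))
    where
    X-injective : ∀ {i j} → X i ≡ X j → i ≡ j
    X-injective refl = refl
  mapVtx-injective {Y i} {Y j} e = cong Y (ι-inj (Y-injective e))
    where
    Y-injective : ∀ {i j} → Y i ≡ Y j → i ≡ j
    Y-injective refl = refl

Geodetic₂-pullback : {V W : Set} {G : V → V → Bool} {H : W → W → Bool} (φ : V → W) →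
  (∀ {u v} → φ u ≡ φ v → u ≡ v) → (∀ u v → G u v ≡ H (φ u) (φ v)) → Geodetic₂ H → Geodetic₂ G
Geodetic₂-pullback {G = G} {H} φ inj h geo = record
  { no-loop = λ u a → no-loop (φ u) (to a)
  ; no-digon = λ u v a b → no-digon (φ u) (φ v) (to a) (to b)
  ; no-shortcut = λ u w v a b c → no-shortcut (φ u) (φ w) (φ v) (to a) (to b) (to c)
  ; unique-middle = λ u v w w' a b c d → inj (unique-middle (φ u) (φ v) (φ w) (φ w') (to a) (to b) (to c) (to d)) }
  where
  open Geodetic₂ geo
  to : ∀ {u v} → G u v ≡ true → H (φ u) (φ v) ≡ true
  to a = trans (sym (h _ _)) a

-- Up to rotation these 14 patterns suffice to rule out all quadruples of states but the listed ones; they were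
-- found by computer.
shortcuts : Fin 3 → List (Vtx 3 × Vtx 3 × Vtx 3)
shortcuts t =
  (Y 0F , X 1F , ▵ t) ∷ (X 1F , Y 1F , ▵ t) ∷ (X 0F , ▵ t , Y 0F) ∷
  (Y 0F , ▵ t , X 1F) ∷ (▵ t , X 0F , Y 0F) ∷ (▵ t , Y 0F , X 1F) ∷ []

forks : Fin 3 → List (Vtx 3 × Vtx 3 × Vtx 3 × Vtx 3)
forks t =
  (Y 1F , X 0F , X 1F , ▵ t) ∷ (Y 1F , ▵ t , X 0F , Y 0F) ∷ (▵ t , ▵ (next t) , Y 1F , X 0F) ∷
  (▵ t , Y 0F , Y 1F , X 2F) ∷ (Y 0F , ▵ t , X 1F , ▵ (next t)) ∷ (▵ t , ▵ (next t) , X 1F , Y 1F) ∷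
  (X 0F , ▵ t , Y 0F , X 1F) ∷ (X 0F , ▵ t , Y 0F , ▵ (next t)) ∷ []

forks-fork : ∀ t → All (λ (_ , w , w' , _) → w ≢ w') (forks t)
forks-fork t = (λ ()) ∷ (λ ()) ∷ (λ ()) ∷ (λ ()) ∷ (λ ()) ∷ (λ ()) ∷ (λ ()) ∷ (λ ()) ∷ []

hasShortcut : (Fin 3 → State) → Vtx 3 × Vtx 3 × Vtx 3 → Bool
hasShortcut g (u , w , v) = arc g u w ∧ (arc g w v ∧ arc g u v)

hasFork : (Fin 3 → State) → Vtx 3 × Vtx 3 × Vtx 3 × Vtx 3 → Bool
hasFork g (u , w , w' , v) = arc g u w ∧ (arc g w v ∧ (arc g u w' ∧ arc g w' v))

obstructedAt : (Fin 3 → State) → Fin 3 → Bool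
obstructedAt g t = any (hasShortcut g) (shortcuts t) ∨ any (hasFork g) (forks t)

obstructed : (Fin 3 → State) → Bool
obstructed g = any (obstructedAt g) (allFin 3)

-- The third entry is a dummy: no pattern consults its state.
compatible : State → State → Bool
compatible c d = not (obstructed (λ { 0F → c ; 1F → d ; 2F → c }))

any-false : {A : Set} (p : A → Bool) {xs : List A} → All (λ x → p x ≡ false) xs → any p xs ≡ false
any-false p [] = refl
any-false p (h ∷ hs) rewrite h = any-false p hs

unobstructed : (g : Fin 3 → State) → Geodetic₂ (arc g) → obstructed g ≡ false
unobstructed g geo = any-false (obstructedAt g) {allFin 3} (at 0F ∷ at 1F ∷ at 2F ∷ [])
  where
  open Geodetic₂ geo
  open import Data.List.Relation.Unary.All using (universal) renaming (map to mapAll)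
  no-short : ∀ p → hasShortcut g p ≡ false
  no-short (u , w , v) = ¬true⇒false λ e →
    let a , bc = ∧-true {arc g u w} e
        b , c = ∧-true {arc g w v} bc in no-shortcut u w v a b c
  no-fork : ∀ p → proj₁ (proj₂ p) ≢ proj₁ (proj₂ (proj₂ p)) → hasFork g p ≡ false
  no-fork (u , w , w' , v) ne = ¬true⇒false λ e →
    let a , bcd = ∧-true {arc g u w} e
        b , cd = ∧-true {arc g w v} bcd
        c , d = ∧-true {arc g u w'} cd in ne (unique-middle u v w w' a b c d)
  at : ∀ t → obstructedAt g t ≡ false
  at t = cong₂ _∨_ (any-false (hasShortcut g) (universal no-short (shortcuts t))) (any-false (hasFork g) (mapAll (λ {p} → no-fork p) (forks-fork t)))

-- A third index is taken because one pattern ends in an `X` vertex with an index other than the two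
-- compared. Both `Y` vertices send an arc to it whatever its state, so `obstructed (f ∘ ι)` agrees
-- by computation with the value inside `compatible`.
geodetic⇒compatible : 3 ≤ s → (f : Fin s → State) → Geodetic₂ (arc f) → ∀ i j → i ≢ j → compatible (f i) (f j) ≡ true
geodetic⇒compatible {s} 3≤s f geo i j i≢j with fresh 3≤s (λ { 0F → i ; 1F → j })
... | k , k≢ = cong not (unobstructed (f ∘ ι)
  (Geodetic₂-pullback (mapVtx ι) (mapVtx-injective f ι ι-inj) (arc-reindex f ι ι-inj) geo))
  where
  ι : Fin 3 → Fin s
  ι 0F = i
  ι 1F = j
  ι 2F = k
  ι-inj : ∀ {a b} → ι a ≡ ι b → a ≡ b
  ι-inj {0F} {0F} _ = refl
  ι-inj {0F} {1F} e = contradiction e i≢j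
  ι-inj {0F} {2F} e = contradiction (sym e) (k≢ 0F)
  ι-inj {1F} {0F} e = contradiction (sym e) i≢j
  ι-inj {1F} {1F} _ = refl
  ι-inj {1F} {2F} e = contradiction (sym e) (k≢ 1F)
  ι-inj {2F} {0F} e = contradiction e (k≢ 0F)
  ι-inj {2F} {1F} e = contradiction e (k≢ 1F)
  ι-inj {2F} {2F} _ = refl

-- At an unmatched index all arcs between the sides enter the `X` vertex and leave the `Y` vertex,
-- so only the triangle can provide an exit for the former and an entrance for the latter.
viable : State → Bool
viable (state m (dx , _) (dy , _)) = m ∨ (not dx ∧ dy)

no-source-or-sink⇒viable : (f : Fin s → State) → HasPredecessors (arc f) → HasSuccessors (arc f) →
  ∀ i → viable (f i) ≡ true
no-source-or-sink⇒viable f pred succ i with f i in eq | succ (X i) | pred (Y i)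
... | state true _ _ | _ | _ = refl
... | state false (dx , _) (dy , _) | u , a | v , b = cong₂ _∧_ (exits u a) (entered v b)
  where
  exits : ∀ u → arc f (X i) u ≡ true → not dx ≡ true
  exits (▵ t) a rewrite eq = proj₁ (∧-true {not dx} a)
  exits (Y j) a rewrite eq = true≢false a (Bool.∧-zeroʳ (i == j))
  entered : ∀ v → arc f v (Y i) ≡ true → dy ≡ true
  entered (▵ t) a rewrite eq = proj₁ (∧-true {dy} a)
  entered (X j) a with ∧-true {j == i} a
  ... | e , m with ==⇒≡ {i = j} {i} e
  ...   | refl rewrite eq = contradiction m λ ()

-- Exhaustive search over the states

_≟ᵃ_ : DecidableEquality Attachment
_≟ᵃ_ = Product.≡-dec Bool._≟_ _≟_

_≟ˢ_ : DecidableEquality State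
state m a b ≟ˢ state m' a' b' = map′ (λ { (refl , refl , refl) → refl }) (λ { refl → refl , refl , refl })
  ((m Bool.≟ m') ×-dec ((a ≟ᵃ a') ×-dec (b ≟ᵃ b')))

fromParts : Bool → Attachment × Attachment → State
fromParts m (a , b) = state m a b

states : List State
states = cartesianProductWith fromParts bools (cartesianProduct attachments attachments)
  where
  bools = true ∷ false ∷ []
  attachments = cartesianProduct bools (allFin 3)

∈-states : ∀ c → c ∈ states
∈-states (state m a b) = ∈-cartesianProductWith⁺ fromParts (bool m) (∈-cartesianProduct⁺ (att a) (att b))
  where
  bool : ∀ m → m ∈ true ∷ false ∷ []
  bool true = here refl
  bool false = there (here refl)
  att : ∀ (a : Attachment) → a ∈ cartesianProduct (true ∷ false ∷ []) (allFin 3)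
  att (d , t) = ∈-cartesianProduct⁺ (bool d) (∈-allFin t)

all-sound : {A : Set} (p : A → Bool) {xs : List A} → all p xs ≡ true → ∀ {x} → x ∈ xs → p x ≡ true
all-sound p {y ∷ _} h (here refl) = proj₁ (∧-true {p y} h)
all-sound p {y ∷ _} h (there x∈) = all-sound p (proj₂ (∧-true {p y} h)) x∈

any-sound : {A : Set} (p : A → Bool) (xs : List A) → any p xs ≡ true → ∃ λ x → p x ≡ true
any-sound p (x ∷ xs) h with p x in e
... | true = x , e
... | false = any-sound p xs h

∈-filterᵇ : {A : Set} (p : A → Bool) {xs : List A} → ∀ {x} → x ∈ xs → p x ≡ true → x ∈ filterᵇ p xs
∈-filterᵇ p (here {x} refl) e rewrite e = here refl
∈-filterᵇ p {y ∷ _} (there x∈) e with p y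
... | true = there (∈-filterᵇ p x∈ e)
... | false = ∈-filterᵇ p x∈ e

-- The two states of a digraph of each kind, corner t playing the role of x (B′ is traversed backwards, so
-- there next t is z).  In A, C, D only one index has the minor state; D′ is D with x and y exchanged.
data Kind : Set where
  kA kB kB' kC kD kD' : Kind

major minor : Kind → Fin 3 → State
major kA t = state true (true , t) (false , next t)
major kB t = state true (true , t) (false , next t)
major kB' t = state true (true , next (next t)) (false , t)
major kC t = state true (true , next t) (false , t)
major kD t = state true (true , next t) (false , t)
major kD' t = state true (true , t) (false , next t)
minor kA t = state false (false , t) (true , next t)
minor kB t = state true (true , t) (false , next (next t))
minor kB' t = state true (true , next t) (false , t)
minor kC t = state false (false , next (next t)) (true , next (next t))
minor kD t = state true (true , next (next t)) (false , next (next t))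
minor kD' t = state true (true , next (next t)) (false , next (next t))

ofKind : Kind → Fin 3 → State → Bool
ofKind k t c = does (c ≟ˢ major k t) ∨ does (c ≟ˢ minor k t)

anyKind : (Kind → Fin 3 → Bool) → Bool
anyKind p = any (λ k → any (p k) (allFin 3)) (kA ∷ kB ∷ kB' ∷ kC ∷ kD ∷ kD' ∷ [])

fits : State → State → Bool
fits c d = compatible c d ∧ compatible d c

-- A backtracking search in which `candidates` holds the states that fit everything chosen. A chosen
-- state is kept among the candidates if it fits itself, as different indices may share a state.
cliquesOfOneKind : ℕ → List State → List State → Bool
cliquesOfOneKind zero chosen _ = anyKind λ k t → all (ofKind k t) chosen
cliquesOfOneKind (suc m) chosen candidates =
  all (λ c → cliquesOfOneKind m (c ∷ chosen) (filterᵇ (fits c) candidates)) candidates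

viableStates : List State
viableStates = filterᵇ viable states

-- Evaluated by the type checker: four pairwise compatible states always belong to a common kind.
quadruples : cliquesOfOneKind 4 [] viableStates ≡ true
quadruples = refl

anyKind-sound : ∀ p → anyKind p ≡ true → ∃₂ λ k t → p k t ≡ true
anyKind-sound p h =
  let k , e = any-sound (λ k → any (p k) (allFin 3)) (kA ∷ kB ∷ kB' ∷ kC ∷ kD ∷ kD' ∷ []) h
      t , e' = any-sound (p k) (allFin 3) e in k , t , e'

ofKind-cases : ∀ k t c → ofKind k t c ≡ true → c ≡ major k t ⊎ c ≡ minor k t
ofKind-cases k t c = ∨-does (c ≟ˢ major k t) (c ≟ˢ minor k t)
  where
  ∨-does : {P Q : Set} (d : Dec P) (e : Dec Q) → does d ∨ does e ≡ true → P ⊎ Q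
  ∨-does (yes p) _ _ = inj₁ p
  ∨-does (no _) (yes q) _ = inj₂ q

extend-clique : ∀ m chosen candidates → cliquesOfOneKind (suc m) chosen candidates ≡ true → ∀ {c} → c ∈ candidates →
  cliquesOfOneKind m (c ∷ chosen) (filterᵇ (fits c) candidates) ≡ true
extend-clique m chosen candidates =
  all-sound (λ c → cliquesOfOneKind m (c ∷ chosen) (filterᵇ (fits c) candidates))

module Classify (4≤s : 4 ≤ s) (f : Fin s → State)
  (via : ∀ i → viable (f i) ≡ true) (compat : ∀ i j → i ≢ j → compatible (f i) (f j) ≡ true) where

  private
    fit : ∀ i j → i ≢ j → fits (f i) (f j) ≡ true
    fit i j ne = cong₂ _∧_ (compat i j ne) (compat j i (ne ∘ sym))

  -- Descends from the closed computation `quadruples` along the branch given by the four states,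
  -- which therefore never have to be split into cases. Distinct indices guarantee that each state
  -- survives the earlier filters.
  one-kind : (ι : Fin 4 → Fin s) → (∀ a b → a ≢ b → ι a ≢ ι b) →
    ∃₂ λ k t → ∀ a → f (ι a) ≡ major k t ⊎ f (ι a) ≡ minor k t
  one-kind ι inj =
    let k , t , e = anyKind-sound (λ k t → all (ofKind k t) (c 3F ∷ c 2F ∷ c 1F ∷ c 0F ∷ [])) step₄
    in k , t , λ { 0F → member k t e (there (there (there (here refl)))) ; 1F → member k t e (there (there (here refl)))
                 ; 2F → member k t e (there (here refl)) ; 3F → member k t e (here refl) }
    where
    open import Data.Fin.Patterns using (3F)
    c : Fin 4 → State
    c a = f (ι a)
    member : ∀ k t → all (ofKind k t) (c 3F ∷ c 2F ∷ c 1F ∷ c 0F ∷ []) ≡ true →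
      ∀ {x} → x ∈ c 3F ∷ c 2F ∷ c 1F ∷ c 0F ∷ [] → x ≡ major k t ⊎ x ≡ minor k t
    member k t e x∈ = ofKind-cases k t _ (all-sound (ofKind k t) e x∈)
    L₀ = viableStates
    L₁ = filterᵇ (fits (c 0F)) L₀
    L₂ = filterᵇ (fits (c 1F)) L₁
    L₃ = filterᵇ (fits (c 2F)) L₂
    ∈₀ : ∀ a → c a ∈ L₀
    ∈₀ a = ∈-filterᵇ viable (∈-states (c a)) (via (ι a))
    ∈₁ : ∀ a → 0F ≢ a → c a ∈ L₁
    ∈₁ a ne = ∈-filterᵇ (fits (c 0F)) (∈₀ a) (fit _ _ (inj 0F a ne))
    ∈₂ : ∀ a → 0F ≢ a → 1F ≢ a → c a ∈ L₂
    ∈₂ a ne ne' = ∈-filterᵇ (fits (c 1F)) (∈₁ a ne) (fit _ _ (inj 1F a ne'))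
    step₁ : cliquesOfOneKind 3 (c 0F ∷ []) L₁ ≡ true
    step₁ = extend-clique 3 [] L₀ quadruples (∈₀ 0F)
    step₂ : cliquesOfOneKind 2 (c 1F ∷ c 0F ∷ []) L₂ ≡ true
    step₂ = extend-clique 2 (c 0F ∷ []) L₁ step₁ (∈₁ 1F λ ())
    step₃ : cliquesOfOneKind 1 (c 2F ∷ c 1F ∷ c 0F ∷ []) L₃ ≡ true
    step₃ = extend-clique 1 (c 1F ∷ c 0F ∷ []) L₂ step₂ (∈₂ 2F (λ ()) λ ())
    step₄ : cliquesOfOneKind 0 (c 3F ∷ c 2F ∷ c 1F ∷ c 0F ∷ []) (filterᵇ (fits (c 3F)) L₃) ≡ true
    step₄ = extend-clique 0 (c 2F ∷ c 1F ∷ c 0F ∷ []) L₃ step₃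
      (∈-filterᵇ (fits (c 2F)) (∈₂ 3F (λ ()) λ ()) (fit _ _ (inj 2F 3F λ ())))

module _ (4≤s : 4 ≤ s) (f : Fin s → State)
  (via : ∀ i → viable (f i) ≡ true) (compat : ∀ i j → i ≢ j → compatible (f i) (f j) ≡ true) where

  private
    HasKind : Kind → Fin 3 → Fin s → Set
    HasKind k t i = f i ≡ major k t ⊎ f i ≡ minor k t

    with-distinct : ∀ i j l → i ≢ j → i ≢ l → j ≢ l →
      ∃₂ λ k t → HasKind k t i × HasKind k t j × HasKind k t l
    with-distinct i j l i≢j i≢l j≢l =
      let k , t , h = Classify.one-kind 4≤s f via compat ι distinct in k , t , h 0F , h 1F , h 2F
      where
      extra = fresh 4≤s (λ { 0F → i ; 1F → j ; 2F → l })
      m = proj₁ extra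
      m≢ = proj₂ extra
      ι : Fin 4 → Fin s
      ι 0F = i
      ι 1F = j
      ι 2F = l
      ι 3F = m
      distinct : ∀ a b → a ≢ b → ι a ≢ ι b
      distinct 0F 0F ne = contradiction refl ne
      distinct 0F 1F _ = i≢j
      distinct 0F 2F _ = i≢l
      distinct 0F 3F _ = m≢ 0F ∘ sym
      distinct 1F 0F _ = i≢j ∘ sym
      distinct 1F 1F ne = contradiction refl ne
      distinct 1F 2F _ = j≢l
      distinct 1F 3F _ = m≢ 1F ∘ sym
      distinct 2F 0F _ = i≢l ∘ sym
      distinct 2F 1F _ = j≢l ∘ sym
      distinct 2F 2F ne = contradiction refl ne
      distinct 2F 3F _ = m≢ 2F ∘ sym
      distinct 3F 0F _ = m≢ 0F
      distinct 3F 1F _ = m≢ 1F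
      distinct 3F 2F _ = m≢ 2F
      distinct 3F 3F ne = contradiction refl ne

    i₀ : Fin s
    i₀ = inject≤ 0F 4≤s

    one-of-two : {A : Set} {a b x y z : A} → x ≢ y → x ≡ a ⊎ x ≡ b → y ≡ a ⊎ y ≡ b → z ≡ a ⊎ z ≡ b → z ≡ x ⊎ z ≡ y
    one-of-two x≢y (inj₁ refl) (inj₁ refl) _ = contradiction refl x≢y
    one-of-two x≢y (inj₁ refl) (inj₂ refl) h = h
    one-of-two x≢y (inj₂ refl) (inj₁ refl) h = Sum.swap h
    one-of-two x≢y (inj₂ refl) (inj₂ refl) _ = contradiction refl x≢y

  -- Different quadruples might a priori belong to different kinds. If `f` is not constant, take
  -- `i₀` and `j` with different states: within any quadruple containing both, these are the two
  -- states of its kind, so every other index repeats one of them. Hence the kind found for one such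
  -- quadruple fits all indices. The index `l` only fills up that quadruple.
  common-kind : ∃₂ λ k t → ∀ i → f i ≡ major k t ⊎ f i ≡ minor k t
  common-kind with any? (λ j → ¬? (f j ≟ˢ f i₀))
  ... | no constant =
    let k , t , h = Classify.one-kind 4≤s f via compat (λ a → inject≤ a 4≤s)
                      (λ a b ne e → ne (Fin.inject≤-injective 4≤s 4≤s a b e))
    in k , t , λ i → Sum.map (trans (same i)) (trans (same i)) (h 0F)
    where
    same : ∀ i → f i ≡ f i₀
    same i with f i ≟ˢ f i₀
    ... | yes e = e
    ... | no ne = contradiction (i , ne) constant
  ... | yes (j , fj≢) = let k , t , h₀ , hj , _ = with-distinct i₀ j l i₀≢j (l≢ 0F ∘ sym) (l≢ 1F ∘ sym) in
    k , t , all-of-kind h₀ hj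
    where
    extra = fresh (≤-trans (n≤1+n 3) 4≤s) (λ { 0F → i₀ ; 1F → j })
    l = proj₁ extra
    l≢ = proj₂ extra
    i₀≢j : i₀ ≢ j
    i₀≢j e = fj≢ (cong f (sym e))
    same-as : ∀ i → i ≢ i₀ → i ≢ j → f i ≡ f i₀ ⊎ f i ≡ f j
    same-as i i≢i₀ i≢j = let _ , _ , h₀ , hj , hi = with-distinct i₀ j i i₀≢j (i≢i₀ ∘ sym) (i≢j ∘ sym) in
      one-of-two (fj≢ ∘ sym) h₀ hj hi
    all-of-kind : ∀ {k t} → HasKind k t i₀ → HasKind k t j → ∀ i → HasKind k t i
    all-of-kind {k} {t} h₀ hj i = by-cases (i ≟ i₀) (i ≟ j)
      where
      by-cases : Dec (i ≡ i₀) → Dec (i ≡ j) → HasKind k t i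
      by-cases (yes e) _ = subst (HasKind k t) (sym e) h₀
      by-cases (no _) (yes e) = subst (HasKind k t) (sym e) hj
      by-cases (no ne) (no ne') = [ (λ e → Sum.map (trans e) (trans e) h₀) , (λ e → Sum.map (trans e) (trans e) hj) ]′ (same-as i ne ne')

-- Normal forms

≃-trans : {U V W : Set} {G : U → U → Bool} {H : V → V → Bool} {K : W → W → Bool} → G ≃ H → H ≃ K → G ≃ K
≃-trans (iso φ p) (iso ψ q) = iso (ψ ↔-∘ φ) λ u v → trans (p u v) (q _ _)

≃-sym : {V W : Set} {G : V → V → Bool} {H : W → W → Bool} → G ≃ H → H ≃ G
≃-sym {G = G} {H} (iso φ p) = iso (↔-sym φ) λ u v →
  trans (cong₂ H (sym (Inverse.strictlyInverseˡ φ u)) (sym (Inverse.strictlyInverseˡ φ v))) (sym (p _ _))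

arc-cong : {f g : Fin s → State} → (∀ i → f i ≡ g i) → ∀ u v → arc f u v ≡ arc g u v
arc-cong h (▵ t) (▵ t') = refl
arc-cong h (▵ t) (X i) = cong (λ c → fromCorner (attX c) t) (h i)
arc-cong h (▵ t) (Y i) = cong (λ c → fromCorner (attY c) t) (h i)
arc-cong h (X i) (▵ t) = cong (λ c → toCorner (attX c) t) (h i)
arc-cong h (X i) (X j) = refl
arc-cong h (X i) (Y j) = cong (λ c → (i == j) ∧ matched c) (h i)
arc-cong h (Y i) (▵ t) = cong (λ c → toCorner (attY c) t) (h i)
arc-cong h (Y j) (X i) = cong (λ c → not ((i == j) ∧ matched c)) (h i)
arc-cong h (Y i) (Y j) = refl

≗⇒≃ : {f g : Fin s → State} → (∀ i → f i ≡ g i) → arc f ≃ arc g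
≗⇒≃ h = iso (bijection id id (λ v → v , refl)) (arc-cong h)

permute-≃ : (f : Fin s → State) (σ : Fin s ↔ Fin s) → arc (f ∘ Inverse.to σ) ≃ arc f
permute-≃ {s} f σ = iso (bijection (mapVtx to) (mapVtx-injective f to to-injective) surj) (arc-reindex f to to-injective)
  where
  open Inverse σ
  to-injective : ∀ {i j} → to i ≡ to j → i ≡ j
  to-injective = perm-injective σ
  surj : ∀ v → ∃ λ u → mapVtx to u ≡ v
  surj (▵ t) = ▵ t , refl
  surj (X i) = X (from i) , cong X (strictlyInverseˡ i)
  surj (Y i) = Y (from i) , cong Y (strictlyInverseˡ i)

rotate : State → State
rotate (state m (d , t) (d' , t')) = state m (d , next t) (d' , next t')

next-== : ∀ t t' → (next t == next t') ≡ (t == t')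
next-== t t' with t ≟ t'
... | yes refl = ==-refl (next t)
... | no ne = ≢⇒== (ne ∘ next-injective t t')

rotate-≃ : (f : Fin s → State) → arc f ≃ arc (rotate ∘ f)
rotate-≃ {s} f = iso (bijection φ φ-injective φ-surjective) φ-arcs
  where
  φ : Vtx s → Vtx s
  φ (▵ t) = ▵ (next t)
  φ (X i) = X i
  φ (Y i) = Y i
  φ-injective : ∀ {u v} → φ u ≡ φ v → u ≡ v
  φ-injective {▵ t} {▵ t'} e = cong ▵ (next-injective t t' (▵-injective e))
    where
    ▵-injective : ∀ {t t'} → ▵ {s} t ≡ ▵ t' → t ≡ t'
    ▵-injective refl = refl
  φ-injective {X i} {X i} refl = refl
  φ-injective {Y i} {Y i} refl = refl
  φ-surjective : ∀ v → ∃ λ u → φ u ≡ v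
  φ-surjective (▵ t) = ▵ (next (next t)) , cong ▵ (next³ t)
  φ-surjective (X i) = X i , refl
  φ-surjective (Y i) = Y i , refl
  φ-arcs : ∀ u v → arc f u v ≡ arc (rotate ∘ f) (φ u) (φ v)
  φ-arcs (▵ t) (▵ t') = sym (next-== (next t) t')
  φ-arcs (▵ t) (X i) = cong (proj₁ (attX (f i)) ∧_) (sym (next-== (proj₂ (attX (f i))) t))
  φ-arcs (▵ t) (Y i) = cong (proj₁ (attY (f i)) ∧_) (sym (next-== (proj₂ (attY (f i))) t))
  φ-arcs (X i) (▵ t) = cong (not (proj₁ (attX (f i))) ∧_) (sym (next-== (proj₂ (attX (f i))) t))
  φ-arcs (X i) (X j) = refl
  φ-arcs (X i) (Y j) = refl
  φ-arcs (Y i) (▵ t) = cong (not (proj₁ (attY (f i))) ∧_) (sym (next-== (proj₂ (attY (f i))) t))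
  φ-arcs (Y j) (X i) = refl
  φ-arcs (Y i) (Y j) = refl

form : Kind → (Fin s → Bool) → Fin s → State
form k p i = if p i then major k 0F else minor k 0F

-- Renumbering the pairs makes the number of major states the only invariant of `form k`; for B this
-- number is the parameter `t`.
form-permute : ∀ k (p q : Fin s → Bool) → count p ≡ count q → arc (form k p) ≃ arc (form k q)
form-permute k p q eq with matching-permutation p q eq
... | σ , h = ≃-sym (≃-trans (≗⇒≃ (λ i → cong (λ b → if b then major k 0F else minor k 0F) (sym (h i)))) (permute-≃ (form k p) σ))

major-rotate : ∀ k t → rotate (major k t) ≡ major k (next t)
major-rotate kA t = refl
major-rotate kB t = refl
major-rotate kB' t = refl
major-rotate kC t = refl
major-rotate kD t = refl
major-rotate kD' t = refl

minor-rotate : ∀ k t → rotate (minor k t) ≡ minor k (next t)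
minor-rotate kA t = refl
minor-rotate kB t = refl
minor-rotate kB' t = refl
minor-rotate kC t = refl
minor-rotate kD t = refl
minor-rotate kD' t = refl

OfKind : Kind → Fin 3 → (Fin s → State) → Set
OfKind k t f = ∀ i → f i ≡ major k t ⊎ f i ≡ minor k t

rotate-kind : ∀ k t (f : Fin s → State) → OfKind k t f → OfKind k (next t) (rotate ∘ f)
rotate-kind k t f h i = Sum.map (λ e → trans (cong rotate e) (major-rotate k t)) (λ e → trans (cong rotate e) (minor-rotate k t)) (h i)

normal-form : ∀ k t (f : Fin s → State) → OfKind k t f → ∃ λ (p : Fin s → Bool) → arc f ≃ arc (form k p)
normal-form k 0F f h = (λ i → does (f i ≟ˢ major k 0F)) , ≗⇒≃ pointwise
  where
  select : {A : Set} {c a b : A} (d : Dec (c ≡ a)) → c ≡ a ⊎ c ≡ b → c ≡ (if does d then a else b)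
  select (yes e) _ = e
  select (no ne) (inj₁ e) = contradiction e ne
  select (no _) (inj₂ e) = e
  pointwise : ∀ i → f i ≡ form k (λ i → does (f i ≟ˢ major k 0F)) i
  pointwise i = select (f i ≟ˢ major k 0F) (h i)
normal-form k 2F f h =
  let p , e = normal-form k 0F (rotate ∘ f) (rotate-kind k 2F f h) in p , ≃-trans (rotate-≃ f) e
normal-form k 1F f h =
  let p , e = normal-form k 0F (rotate ∘ rotate ∘ f) (rotate-kind k 2F (rotate ∘ f) (rotate-kind k 1F f h))
  in p , ≃-trans (rotate-≃ f) (≃-trans (rotate-≃ (rotate ∘ f)) e)

-- From normal forms to names

kindOf : ∀ {r} → Name r → Kind
kindOf nA = kA
kindOf nB0 = kB
kindOf nBlast = kB
kindOf nC = kC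
kindOf nD = kD
kindOf (nB _) = kB
kindOf (nB' _) = kB'

-- Index `i` stands for the pair with subscript `i + 1`, and `s` is `r − 1`. In D the exceptional
-- pair is the one of index 0, in A and C it is the last.
isMajor : Name (suc s) → Fin s → Bool
isMajor {s} nA i = suc (toℕ i) <ᵇ s
isMajor nB0 i = toℕ i <ᵇ 0
isMajor {s} nBlast i = toℕ i <ᵇ s
isMajor {s} nC i = suc (toℕ i) <ᵇ s
isMajor nD i = 0 <ᵇ toℕ i
isMajor (nB j) i = toℕ i <ᵇ suc (toℕ j)
isMajor (nB' j) i = toℕ i <ᵇ suc (toℕ j)

nameState : Name (suc s) → Fin s → State
nameState nm = form (kindOf nm) (isMajor nm)

count-<ᵇ : ∀ {s t} → t ≤ s → count {s} (λ i → toℕ i <ᵇ t) ≡ t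
count-<ᵇ {s} z≤n = count≡0 {s} (λ _ → refl)
count-<ᵇ {suc s} (s≤s t≤s) = cong suc (count-<ᵇ {s} t≤s)

count-0<ᵇ : count {suc s} (λ i → 0 <ᵇ toℕ i) ≡ s
count-0<ᵇ {s} = trans (sum-const s 1) (*-identityʳ s)

-- The triangle z → x₀ → y₀ → z of D′ plays the role of the base triangle of C.
D′≃C : arc (form {suc s} kD' (λ i → 0 <ᵇ toℕ i)) ≃ arc (form {suc s} kC (λ i → 0 <ᵇ toℕ i))
D′≃C {s} = iso (mk↔ₛ′ φ ψ φψ ψφ) φ-arcs
  where
  φ : Vtx (suc s) → Vtx (suc s)
  φ (▵ 0F) = Y zero
  φ (▵ 1F) = X zero
  φ (▵ 2F) = ▵ 2F
  φ (X zero) = ▵ 0F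
  φ (X (suc i)) = X (suc i)
  φ (Y zero) = ▵ 1F
  φ (Y (suc i)) = Y (suc i)
  ψ : Vtx (suc s) → Vtx (suc s)
  ψ (▵ 0F) = X zero
  ψ (▵ 1F) = Y zero
  ψ (▵ 2F) = ▵ 2F
  ψ (X zero) = ▵ 1F
  ψ (X (suc i)) = X (suc i)
  ψ (Y zero) = ▵ 0F
  ψ (Y (suc i)) = Y (suc i)
  φψ : ∀ v → φ (ψ v) ≡ v
  φψ (▵ 0F) = refl
  φψ (▵ 1F) = refl
  φψ (▵ 2F) = refl
  φψ (X zero) = refl
  φψ (X (suc i)) = refl
  φψ (Y zero) = refl
  φψ (Y (suc i)) = refl
  ψφ : ∀ v → ψ (φ v) ≡ v
  ψφ (▵ 0F) = refl
  ψφ (▵ 1F) = refl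
  ψφ (▵ 2F) = refl
  ψφ (X zero) = refl
  ψφ (X (suc i)) = refl
  ψφ (Y zero) = refl
  ψφ (Y (suc i)) = refl
  φ-arcs : ∀ u v → arc (form {suc s} kD' (λ i → 0 <ᵇ toℕ i)) u v ≡ arc (form {suc s} kC (λ i → 0 <ᵇ toℕ i)) (φ u) (φ v)
  φ-arcs (▵ 0F) = λ { (▵ 0F) → refl ; (▵ 1F) → refl ; (▵ 2F) → refl ; (X zero) → refl ; (X (suc j)) → refl ; (Y zero) → refl ; (Y (suc j)) → refl }
  φ-arcs (▵ 1F) = λ { (▵ 0F) → refl ; (▵ 1F) → refl ; (▵ 2F) → refl ; (X zero) → refl ; (X (suc j)) → refl ; (Y zero) → refl ; (Y (suc j)) → refl }
  φ-arcs (▵ 2F) = λ { (▵ 0F) → refl ; (▵ 1F) → refl ; (▵ 2F) → refl ; (X zero) → refl ; (X (suc j)) → refl ; (Y zero) → refl ; (Y (suc j)) → refl }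
  φ-arcs (X zero) = λ { (▵ 0F) → refl ; (▵ 1F) → refl ; (▵ 2F) → refl ; (X zero) → refl ; (X (suc j)) → refl ; (Y zero) → refl ; (Y (suc j)) → refl }
  φ-arcs (X (suc i)) = λ { (▵ 0F) → refl ; (▵ 1F) → refl ; (▵ 2F) → refl ; (X zero) → refl ; (X (suc j)) → refl ; (Y zero) → refl ; (Y (suc j)) → refl }
  φ-arcs (Y zero) = λ { (▵ 0F) → refl ; (▵ 1F) → refl ; (▵ 2F) → refl ; (X zero) → refl ; (X (suc j)) → refl ; (Y zero) → refl ; (Y (suc j)) → refl }
  φ-arcs (Y (suc i)) = λ { (▵ 0F) → refl ; (▵ 1F) → refl ; (▵ 2F) → refl ; (X zero) → refl ; (X (suc j)) → refl ; (Y zero) → refl ; (Y (suc j)) → refl }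

count-split : (p : Fin s → Bool) → count (not ∘ p) ≤ 1 → (∀ i → p i ≡ true) ⊎ suc (count p) ≡ s
count-split {s} p le with count (not ∘ p) in eq | le | count-not p
... | 0 | _ | _ = inj₁ λ i → ¬false⇒true λ e → <⇒≱ (≤-reflexive (trans (cong (𝟙 ∘ not) (sym e)) refl)) (≤-trans (member≤sum (𝟙 ∘ not ∘ p) i) (≤-reflexive eq))
  where
  ¬false⇒true : ∀ {b} → (b ≡ false → ⊥) → b ≡ true
  ¬false⇒true {true} _ = refl
  ¬false⇒true {false} h = contradiction refl h
... | 1 | _ | total = inj₂ (trans (+-comm 1 (count p)) total)
... | suc (suc _) | s≤s () | _

-- These are the ranges `t = 0`, `t = r − 1` and `1 ≤ t ≤ r − 2` of the parameter of B and B′, with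
-- `t = toℕ j + 1` in the last.
all-or-some : (p : Fin (suc s) → Bool) →
  (∀ i → p i ≡ false) ⊎ (∀ i → p i ≡ true) ⊎ ∃ λ (j : Fin s) → count p ≡ suc (toℕ j)
all-or-some {s} p with any? (λ i → p i Bool.≟ true) | any? (λ i → p i Bool.≟ false)
... | no none | _ = inj₁ λ i → ¬true⇒false λ e → none (i , e)
... | yes _ | no none = inj₂ (inj₁ λ i → not-false (¬true⇒false λ e → none (i , not-true e)))
... | yes (i , pi) | yes (j , pj) = inj₂ (inj₂ (fromℕ< c<s , trans (sym 1+c≡) (cong suc (sym (Fin.toℕ-fromℕ< c<s)))))
  where
  one : ∀ (p : Fin (suc s) → Bool) i → p i ≡ true → 1 ≤ count p
  one p i e = ≤-trans (≤-reflexive (cong 𝟙 (sym e))) (member≤sum (𝟙 ∘ p) i)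
  c = proj₁ (m≤n⇒∃[o]m+o≡n (one p i pi))
  1+c≡ : suc c ≡ count p
  1+c≡ = proj₂ (m≤n⇒∃[o]m+o≡n (one p i pi))
  c<s : c < s
  c<s = +-cancelʳ-≤ 1 _ _ (≤-trans (+-monoʳ-≤ (suc c) (one (not ∘ p) j (cong not pj)))
    (≤-reflexive (trans (cong (_+ count (not ∘ p)) 1+c≡) (trans (count-not p) (+-comm 1 s)))))

Named : (Fin (suc s) → State) → Set
Named {s} f = ∃ λ (nm : Name (suc (suc s))) → arc f ≃ arc (nameState nm)

named-B : ∀ t (f : Fin (suc s) → State) → OfKind kB t f → Named f
named-B {s} t f h with normal-form kB t f h
... | p , e with all-or-some p
...   | inj₁ none = nB0 , ≃-trans e (form-permute kB p (λ i → toℕ i <ᵇ 0) (trans (count≡0 none) (sym (count-<ᵇ {suc s} z≤n))))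
...   | inj₂ (inj₁ every) = nBlast , ≃-trans e (form-permute kB p _ (trans (trans (sum-cong-≗ {suc s} (λ i → cong 𝟙 (every i)))
          (trans (sum-const (suc s) 1) (*-identityʳ (suc s)))) (sym (count-<ᵇ {suc s} ≤-refl))))
...   | inj₂ (inj₂ (j , c)) = nB j , ≃-trans e (form-permute kB p _ (trans c (sym (count-<ᵇ {suc s} (s≤s (Fin.toℕ≤n j))))))

all-major : ∀ k {p : Fin s → Bool} → (∀ i → p i ≡ true) → ∀ i → form k p i ≡ major k 0F
all-major k h i = cong (λ b → if b then major k 0F else minor k 0F) (h i)

all-minor : ∀ k {p : Fin s → Bool} → (∀ i → p i ≡ false) → ∀ i → form k p i ≡ minor k 0F
all-minor k h i = cong (λ b → if b then major k 0F else minor k 0F) (h i)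

-- At the two ends of the range B′ is not new: when all states agree, that state is also a state of
-- kind B at a rotated corner, the minor one at `1F` or the major one at `2F`.
named-B' : (p : Fin (suc s) → Bool) → Named (form kB' p)
named-B' {s} p with all-or-some p
... | inj₁ none = named-B 1F _ (λ i → inj₂ (all-minor kB' none i))
... | inj₂ (inj₁ every) = named-B 2F _ (λ i → inj₁ (all-major kB' every i))
... | inj₂ (inj₂ (j , c)) = nB' j , form-permute kB' p _ (trans c (sym (count-<ᵇ {suc s} (s≤s (Fin.toℕ≤n j)))))

-- Without its single minor state, a digraph of one of these kinds has constant state and
-- degenerates to B: the major states of A and D′ are the major state of B at `0F`, those of C and D
-- the minor state of B at `1F`.
module _ (p : Fin (suc s) → Bool) (le : count (not ∘ p) ≤ 1) where

  private
    by-last : ∀ k nm → nameState nm ≡ form k (λ i → suc (toℕ i) <ᵇ suc s) → suc (count p) ≡ suc s → Named (form k p)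
    by-last k nm e c = nm , subst (λ f → arc (form k p) ≃ arc f) (sym e)
      (form-permute k p _ (trans (cong pred c) (sym (count-<ᵇ {suc s} (n≤1+n s)))))
    to-first : ∀ k → suc (count p) ≡ suc s → arc (form k p) ≃ arc (form k (λ i → 0 <ᵇ toℕ i))
    to-first k c = form-permute k p _ (trans (cong pred c) (sym (count-0<ᵇ {s})))

  named-A : Named (form kA p)
  named-A with count-split p le
  ... | inj₁ every = named-B 0F _ (λ i → inj₁ (all-major kA every i))
  ... | inj₂ c = by-last kA nA refl c

  named-C : Named (form kC p)
  named-C with count-split p le
  ... | inj₁ every = named-B 1F _ (λ i → inj₂ (all-major kC every i))
  ... | inj₂ c = by-last kC nC refl c

  named-D : Named (form kD p)
  named-D with count-split p le
  ... | inj₁ every = named-B 1F _ (λ i → inj₂ (all-major kD every i))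
  ... | inj₂ c = nD , to-first kD c

  named-D' : Named (form kD' p)
  named-D' with count-split p le
  ... | inj₁ every = named-B 0F _ (λ i → inj₁ (all-major kD' every i))
  ... | inj₂ c = nC , ≃-trans (to-first kD' c) (≃-trans D′≃C
    (form-permute kC (λ i → 0 <ᵇ toℕ i) _ (trans (count-0<ᵇ {s}) (sym (count-<ᵇ {suc s} (n≤1+n s))))))

Geodetic₂-≃ : {V W : Set} {G : V → V → Bool} {H : W → W → Bool} → G ≃ H → Geodetic₂ H → Geodetic₂ G
Geodetic₂-≃ (iso φ h) = Geodetic₂-pullback (Inverse.to φ) (λ {u} {v} e →
  trans (sym (Inverse.strictlyInverseʳ φ u)) (trans (cong (Inverse.from φ) e) (Inverse.strictlyInverseʳ φ v))) h

-- For A, C, D and D′ the minor state is not compatible with itself, which plain evaluation confirms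
-- as `bad`; two indices therefore cannot both carry it.
lonely-minor : 3 ≤ s → ∀ k (p : Fin s → Bool) → Geodetic₂ (arc (form k p)) →
  compatible (minor k 0F) (minor k 0F) ≡ false → count (not ∘ p) ≤ 1
lonely-minor 3≤s k p geo bad = count≤1 λ i j a b → unique i j (not-true a) (not-true b)
  where
  is-minor : ∀ {i} → p i ≡ false → form k p i ≡ minor k 0F
  is-minor e = cong (λ b → if b then major k 0F else minor k 0F) e
  unique : ∀ i j → p i ≡ false → p j ≡ false → i ≡ j
  unique i j a b with i ≟ j
  ... | yes e = e
  ... | no ne = true≢false (geodetic⇒compatible 3≤s (form k p) geo i j ne)
    (trans (cong₂ compatible (is-minor a) (is-minor b)) bad)

classify : 4 ≤ suc s → (f : Fin (suc s) → State) → Geodetic₂ (arc f) → HasPredecessors (arc f) → HasSuccessors (arc f) → Named f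
classify {s} 4≤ f geo preds succs = finish (proj₁ kind) (proj₂ (proj₂ kind))
  where
  3≤ = ≤-trans (n≤1+n 3) 4≤
  kind = common-kind 4≤ f (no-source-or-sink⇒viable f preds succs) (geodetic⇒compatible 3≤ f geo)
  lonely : ∀ k (p : Fin (suc s) → Bool) → arc f ≃ arc (form k p) → compatible (minor k 0F) (minor k 0F) ≡ false → count (not ∘ p) ≤ 1
  lonely k p e = lonely-minor 3≤ k p (Geodetic₂-≃ (≃-sym e) geo)
  via : ∀ {g} → arc f ≃ arc g → Named g → Named f
  via e (nm , e') = nm , ≃-trans e e'
  finish : ∀ k {t} → OfKind k t f → Named f
  finish kA h = let p , e = normal-form kA _ f h in via e (named-A p (lonely kA p e refl))
  finish kB h = named-B _ f h
  finish kB' h = let p , e = normal-form kB' _ f h in via e (named-B' p)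
  finish kC h = let p , e = normal-form kC _ f h in via e (named-C p (lonely kC p e refl))
  finish kD h = let p , e = normal-form kD _ f h in via e (named-D p (lonely kD p e refl))
  finish kD' h = let p , e = normal-form kD' _ f h in via e (named-D' p (lonely kD' p e refl))

-- The labelled catalogue

cornerLabel : Fin 3 → Lab
cornerLabel 0F = lx
cornerLabel 1F = ly
cornerLabel 2F = lz

label : Vtx s → Lab
label (▵ t) = cornerLabel t
label (X i) = lX (suc (toℕ i))
label (Y i) = lY (suc (toℕ i))

Vtx↔Fin : Vtx s ↔ Fin (3 + (s + s))
Vtx↔Fin {s} = mk↔ₛ′ to from to-from from-to
  where
  to : Vtx s → Fin (3 + (s + s))
  to (▵ t) = t ↑ˡ (s + s)
  to (X i) = 3 ↑ʳ (i ↑ˡ s)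
  to (Y i) = 3 ↑ʳ (s ↑ʳ i)
  from : Fin (3 + (s + s)) → Vtx s
  from v = [ ▵ , (λ w → [ X , Y ]′ (splitAt s w)) ]′ (splitAt 3 v)
  from-to : ∀ v → from (to v) ≡ v
  from-to (▵ t) rewrite Fin.splitAt-↑ˡ 3 t (s + s) = refl
  from-to (X i) rewrite Fin.splitAt-↑ˡ s i s = refl
  from-to (Y i) rewrite Fin.splitAt-↑ʳ s s i = refl
  to-side : ∀ w e → splitAt s w ≡ e → to ([ X , Y ]′ e) ≡ 3 ↑ʳ w
  to-side w (inj₁ i) e = cong (3 ↑ʳ_) (Fin.splitAt⁻¹-↑ˡ e)
  to-side w (inj₂ i) e = cong (3 ↑ʳ_) (Fin.splitAt⁻¹-↑ʳ e)
  to-from : ∀ v → to (from v) ≡ v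
  to-from 0F = refl
  to-from 1F = refl
  to-from 2F = refl
  to-from (suc (suc (suc w))) = to-side w _ refl

order≡ : ∀ s → 3 + (s + s) ≡ 2 * suc s + 1
order≡ = solve-∀

encode : Vtx s ↔ Fin (2 * suc s + 1)
encode {s} = mk↔ₛ′ (cast (order≡ s)) (cast (sym (order≡ s)))
  (Fin.cast-involutive (order≡ s) (sym (order≡ s))) (Fin.cast-involutive (sym (order≡ s)) (order≡ s)) ↔-∘ Vtx↔Fin

<ᵇ-true : ∀ {m n} → m < n → (m <ᵇ n) ≡ true
<ᵇ-true {zero} (s≤s _) = refl
<ᵇ-true {suc m} (s≤s m<n) = <ᵇ-true m<n

<ᵇ-false : ∀ m n → (m + n <ᵇ m) ≡ false
<ᵇ-false zero n = refl
<ᵇ-false (suc m) n = <ᵇ-false m n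

decode-encode : (v : Vtx s) → decode (suc s) (Inverse.to encode v) ≡ label v
decode-encode {s} v = trans (cong (decodeℕ (suc s)) (Fin.toℕ-cast (order≡ s) (Inverse.to Vtx↔Fin v))) (go v)
  where
  go : (v : Vtx s) → decodeℕ (suc s) (toℕ (Inverse.to Vtx↔Fin v)) ≡ label v
  go (▵ 0F) = refl
  go (▵ 1F) = refl
  go (▵ 2F) = refl
  go (X i) rewrite Fin.toℕ-↑ˡ i s | <ᵇ-true (Fin.toℕ<n i) = refl
  go (Y i) rewrite Fin.toℕ-↑ʳ s i | <ᵇ-false s (toℕ i) | m+n∸m≡n s (toℕ i) = refl

≡ᵇ-== : (i j : Fin n) → (toℕ i ≡ᵇ toℕ j) ≡ (i == j)
≡ᵇ-== zero zero = refl
≡ᵇ-== zero (suc j) = refl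
≡ᵇ-== (suc i) zero = refl
≡ᵇ-== (suc i) (suc j) = ≡ᵇ-== i j

last-or-before : (i : Fin s) → (suc (toℕ i) ≡ᵇ s) ≡ not (suc (toℕ i) <ᵇ s)
last-or-before {suc zero} zero = refl
last-or-before {suc (suc s)} zero = refl
last-or-before {suc s} (suc i) = last-or-before i

above : ∀ t i → (t <ᵇ suc i) ≡ not (i <ᵇ t)
above zero i = refl
above (suc t) zero = refl
above (suc t) (suc i) = above t i

fromX fromY toX toY : Fin 3 → State → Bool
fromX t c = fromCorner (attX c) t
fromY t c = fromCorner (attY c) t
toX t c = toCorner (attX c) t
toY t c = toCorner (attY c) t

always never : Bool → Bool
always _ = true
never _ = false

-- The entries of the arc tables below depend on the index only through `p i`. The function `c`
-- tells how (`id`, `not`, `always` or `never`), and the two values are then compared by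
-- computation.
pick : (F : State → Bool) (c : Bool → Bool) (b : Bool) {x y : State} → c true ≡ F x → c false ≡ F y → c b ≡ F (if b then x else y)
pick F c true h _ = h
pick F c false _ h = h

pick₂ : (F G : State → Bool) (b : Bool) {x y x' y' : State} → F x ≡ G x' → F y ≡ G y' →
  F (if b then x else y) ≡ G (if b then x' else y')
pick₂ F G true h _ = h
pick₂ F G false _ h = h

LabelArcs : (Lab → Lab → Bool) → (Fin s → State) → Set
LabelArcs {s} L f = ∀ (u v : Vtx s) → L (label u) (label v) ≡ arc f u v

not-∧ : ∀ a {b} → not a ∨ not b ≡ not (a ∧ b)
not-∧ true = refl
not-∧ false = refl

common-arcs : (diag : ℕ → Bool) (f : Fin s → State) → (∀ i → diag (suc (toℕ i)) ≡ matched (f i)) →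
  (∀ i j → common diag (lX (suc (toℕ i))) (lY (suc (toℕ j))) ≡ arc f (X i) (Y j)) ×
  (∀ i j → common diag (lY (suc (toℕ j))) (lX (suc (toℕ i))) ≡ arc f (Y j) (X i))
common-arcs diag f h = forth , back
  where
  forth : ∀ i j → common diag (lX (suc (toℕ i))) (lY (suc (toℕ j))) ≡ arc f (X i) (Y j)
  forth i j = cong₂ _∧_ (≡ᵇ-== i j) (h i)
  back : ∀ i j → common diag (lY (suc (toℕ j))) (lX (suc (toℕ i))) ≡ arc f (Y j) (X i)
  back i j rewrite ≡ᵇ-== i j | h i = not-∧ (i == j)

≡ᵇ-zero : ∀ i → (i ≡ᵇ 0) ≡ not (0 <ᵇ i)
≡ᵇ-zero zero = refl
≡ᵇ-zero (suc i) = refl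

triangle? : (L : Lab → Lab → Bool) → Dec (∀ t t' → L (cornerLabel t) (cornerLabel t') ≡ (next t == t'))
triangle? L = all? λ t → all? λ t' → L (cornerLabel t) (cornerLabel t') Bool.≟ (next t == t')

labels-A : LabelArcs (arcA (suc s)) (nameState {s} nA)
labels-A {s} = go
  where
  p : Fin s → Bool
  p i = suc (toℕ i) <ᵇ s
  diag : ℕ → Bool
  diag = small (suc s)
  matched≡ : ∀ i → diag (suc (toℕ i)) ≡ matched (form kA p i)
  matched≡ i = pick matched id (p i) refl refl
  go : LabelArcs (arcA (suc s)) (form kA p)
  go (▵ t) (▵ t') = toWitness {a? = triangle? (arcA (suc s))} _ t t'
  go (▵ 0F) (X i) = pick (fromX 0F) id (p i) refl refl
  go (▵ 1F) (X i) = pick (fromX 1F) never (p i) refl refl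
  go (▵ 2F) (X i) = pick (fromX 2F) never (p i) refl refl
  go (▵ 0F) (Y i) = pick (fromY 0F) never (p i) refl refl
  go (▵ 1F) (Y i) = trans (last-or-before i) (pick (fromY 1F) not (p i) refl refl)
  go (▵ 2F) (Y i) = pick (fromY 2F) never (p i) refl refl
  go (X i) (▵ 0F) = trans (last-or-before i) (pick (toX 0F) not (p i) refl refl)
  go (X i) (▵ 1F) = pick (toX 1F) never (p i) refl refl
  go (X i) (▵ 2F) = pick (toX 2F) never (p i) refl refl
  go (Y i) (▵ 0F) = pick (toY 0F) never (p i) refl refl
  go (Y i) (▵ 1F) = pick (toY 1F) id (p i) refl refl
  go (Y i) (▵ 2F) = pick (toY 2F) never (p i) refl refl
  go (X i) (X j) = refl
  go (X i) (Y j) = proj₁ (common-arcs diag (form kA p) matched≡) i j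
  go (Y j) (X i) = proj₂ (common-arcs diag (form kA p) matched≡) i j
  go (Y i) (Y j) = refl

labels-B : ∀ t → LabelArcs (arcB (suc s) t) (form {s} kB (λ i → toℕ i <ᵇ t))
labels-B {s} t = go
  where
  p : Fin s → Bool
  p i = toℕ i <ᵇ t
  diag : ℕ → Bool
  diag = λ _ → true
  matched≡ : ∀ i → diag (suc (toℕ i)) ≡ matched (form kB p i)
  matched≡ i = pick matched always (p i) refl refl
  go : LabelArcs (arcB (suc s) t) (form kB p)
  go (▵ u) (▵ v) = toWitness {a? = triangle? (arcB (suc s) t)} _ u v
  go (▵ 0F) (X i) = pick (fromX 0F) always (p i) refl refl
  go (▵ 1F) (X i) = pick (fromX 1F) never (p i) refl refl
  go (▵ 2F) (X i) = pick (fromX 2F) never (p i) refl refl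
  go (▵ 0F) (Y i) = pick (fromY 0F) never (p i) refl refl
  go (▵ 1F) (Y i) = pick (fromY 1F) never (p i) refl refl
  go (▵ 2F) (Y i) = pick (fromY 2F) never (p i) refl refl
  go (X i) (▵ 0F) = pick (toX 0F) never (p i) refl refl
  go (X i) (▵ 1F) = pick (toX 1F) never (p i) refl refl
  go (X i) (▵ 2F) = pick (toX 2F) never (p i) refl refl
  go (Y i) (▵ 0F) = pick (toY 0F) never (p i) refl refl
  go (Y i) (▵ 1F) = pick (toY 1F) id (p i) refl refl
  go (Y i) (▵ 2F) = trans (above t (toℕ i)) (pick (toY 2F) not (p i) refl refl)
  go (X i) (X j) = refl
  go (X i) (Y j) = proj₁ (common-arcs diag (form kB p) matched≡) i j
  go (Y j) (X i) = proj₂ (common-arcs diag (form kB p) matched≡) i j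
  go (Y i) (Y j) = refl

labels-C : LabelArcs (arcC (suc s)) (nameState {s} nC)
labels-C {s} = go
  where
  p : Fin s → Bool
  p i = suc (toℕ i) <ᵇ s
  diag : ℕ → Bool
  diag = small (suc s)
  matched≡ : ∀ i → diag (suc (toℕ i)) ≡ matched (form kC p i)
  matched≡ i = pick matched id (p i) refl refl
  go : LabelArcs (arcC (suc s)) (form kC p)
  go (▵ t) (▵ t') = toWitness {a? = triangle? (arcC (suc s))} _ t t'
  go (▵ 0F) (X i) = pick (fromX 0F) never (p i) refl refl
  go (▵ 1F) (X i) = pick (fromX 1F) id (p i) refl refl
  go (▵ 2F) (X i) = pick (fromX 2F) never (p i) refl refl
  go (▵ 0F) (Y i) = pick (fromY 0F) never (p i) refl refl
  go (▵ 1F) (Y i) = pick (fromY 1F) never (p i) refl refl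
  go (▵ 2F) (Y i) = trans (last-or-before i) (pick (fromY 2F) not (p i) refl refl)
  go (X i) (▵ 0F) = pick (toX 0F) never (p i) refl refl
  go (X i) (▵ 1F) = pick (toX 1F) never (p i) refl refl
  go (X i) (▵ 2F) = trans (last-or-before i) (pick (toX 2F) not (p i) refl refl)
  go (Y i) (▵ 0F) = pick (toY 0F) id (p i) refl refl
  go (Y i) (▵ 1F) = pick (toY 1F) never (p i) refl refl
  go (Y i) (▵ 2F) = pick (toY 2F) never (p i) refl refl
  go (X i) (X j) = refl
  go (X i) (Y j) = proj₁ (common-arcs diag (form kC p) matched≡) i j
  go (Y j) (X i) = proj₂ (common-arcs diag (form kC p) matched≡) i j
  go (Y i) (Y j) = refl

labels-D : LabelArcs (arcD (suc s)) (nameState {s} nD)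
labels-D {s} = go
  where
  p : Fin s → Bool
  p i = 0 <ᵇ toℕ i
  diag : ℕ → Bool
  diag = λ _ → true
  matched≡ : ∀ i → diag (suc (toℕ i)) ≡ matched (form kD p i)
  matched≡ i = pick matched always (p i) refl refl
  go : LabelArcs (arcD (suc s)) (form kD p)
  go (▵ t) (▵ t') = toWitness {a? = triangle? (arcD (suc s))} _ t t'
  go (▵ 0F) (X i) = pick (fromX 0F) never (p i) refl refl
  go (▵ 1F) (X i) = pick (fromX 1F) id (p i) refl refl
  go (▵ 2F) (X i) = trans (≡ᵇ-zero (toℕ i)) (pick (fromX 2F) not (p i) refl refl)
  go (▵ 0F) (Y i) = pick (fromY 0F) never (p i) refl refl
  go (▵ 1F) (Y i) = pick (fromY 1F) never (p i) refl refl
  go (▵ 2F) (Y i) = pick (fromY 2F) never (p i) refl refl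
  go (X i) (▵ 0F) = pick (toX 0F) never (p i) refl refl
  go (X i) (▵ 1F) = pick (toX 1F) never (p i) refl refl
  go (X i) (▵ 2F) = pick (toX 2F) never (p i) refl refl
  go (Y i) (▵ 0F) = pick (toY 0F) id (p i) refl refl
  go (Y i) (▵ 1F) = pick (toY 1F) never (p i) refl refl
  go (Y i) (▵ 2F) = trans (≡ᵇ-zero (toℕ i)) (pick (toY 2F) not (p i) refl refl)
  go (X i) (X j) = refl
  go (X i) (Y j) = proj₁ (common-arcs diag (form kD p) matched≡) i j
  go (Y j) (X i) = proj₂ (common-arcs diag (form kD p) matched≡) i j
  go (Y i) (Y j) = refl

-- Reversing all arcs reverses the triangle and turns the prevailing direction from `X` to `Y`.
-- Fixing x, exchanging y with z and `X` with `Y` restores both conventions, so the converse of B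
-- becomes a digraph of the encoded form.
reflect : Vtx s → Vtx s
reflect (▵ 0F) = ▵ 0F
reflect (▵ 1F) = ▵ 2F
reflect (▵ 2F) = ▵ 1F
reflect (X i) = Y i
reflect (Y i) = X i

reflect-involutive : ∀ (v : Vtx s) → reflect (reflect v) ≡ v
reflect-involutive (▵ 0F) = refl
reflect-involutive (▵ 1F) = refl
reflect-involutive (▵ 2F) = refl
reflect-involutive (X i) = refl
reflect-involutive (Y i) = refl

reflect-↔ : Vtx s ↔ Vtx s
reflect-↔ = mk↔ₛ′ reflect reflect reflect-involutive reflect-involutive

==-sym : (i j : Fin n) → (i == j) ≡ (j == i)
==-sym i j with i ≟ j
... | yes refl = sym (==-refl i)
... | no ne = sym (≢⇒== (ne ∘ sym))

converse-B : (p : Fin s → Bool) (u v : Vtx s) → arc (form kB p) (reflect v) (reflect u) ≡ arc (form kB' p) u v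
converse-B p (▵ t) (▵ t') = corners t t'
  where
  corners : ∀ t t' → arc (form kB p) (reflect (▵ t')) (reflect (▵ t)) ≡ (next t == t')
  corners = toWitness {a? = all? λ t → all? λ t' → arc (form kB p) (reflect (▵ t')) (reflect (▵ t)) Bool.≟ (next t == t')} _
converse-B p (▵ 0F) (X i) = pick₂ (toY 0F) (fromX 0F) (p i) refl refl
converse-B p (▵ 1F) (X i) = pick₂ (toY 2F) (fromX 1F) (p i) refl refl
converse-B p (▵ 2F) (X i) = pick₂ (toY 1F) (fromX 2F) (p i) refl refl
converse-B p (▵ 0F) (Y i) = pick₂ (toX 0F) (fromY 0F) (p i) refl refl
converse-B p (▵ 1F) (Y i) = pick₂ (toX 2F) (fromY 1F) (p i) refl refl
converse-B p (▵ 2F) (Y i) = pick₂ (toX 1F) (fromY 2F) (p i) refl refl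
converse-B p (X i) (▵ 0F) = pick₂ (fromY 0F) (toX 0F) (p i) refl refl
converse-B p (X i) (▵ 1F) = pick₂ (fromY 2F) (toX 1F) (p i) refl refl
converse-B p (X i) (▵ 2F) = pick₂ (fromY 1F) (toX 2F) (p i) refl refl
converse-B p (Y i) (▵ 0F) = pick₂ (fromX 0F) (toY 0F) (p i) refl refl
converse-B p (Y i) (▵ 1F) = pick₂ (fromX 2F) (toY 1F) (p i) refl refl
converse-B p (Y i) (▵ 2F) = pick₂ (fromX 1F) (toY 2F) (p i) refl refl
converse-B p (X i) (X j) = refl
converse-B p (X i) (Y j) = cong₂ _∧_ (==-sym j i) (trans (sym (pick matched always (p j) refl refl)) (pick matched always (p i) refl refl))
converse-B p (Y j) (X i) = cong not (cong₂ _∧_ (==-sym j i) (trans (sym (pick matched always (p j) refl refl)) (pick matched always (p i) refl refl)))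
converse-B p (Y i) (Y j) = refl

lab : Name (suc s) → Vtx s → Lab
lab (nB' _) = label ∘ reflect
lab _ = label

lab-arcs : (nm : Name (suc s)) → ∀ u v → labArcs (suc s) nm (lab nm u) (lab nm v) ≡ arc (nameState nm) u v
lab-arcs nA = labels-A
lab-arcs nB0 = labels-B 0
lab-arcs {s} nBlast = labels-B s
lab-arcs nC = labels-C
lab-arcs nD = labels-D
lab-arcs (nB j) = labels-B (suc (toℕ j))
lab-arcs (nB' j) u v = trans (labels-B (suc (toℕ j)) (reflect v) (reflect u)) (converse-B (λ i → toℕ i <ᵇ suc (toℕ j)) u v)

place : Name (suc s) → Vtx s ↔ Fin (2 * suc s + 1)
place (nB' _) = encode ↔-∘ reflect-↔
place _ = encode

decode-place : (nm : Name (suc s)) (v : Vtx s) → decode (suc s) (Inverse.to (place nm) v) ≡ lab nm v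
decode-place nA = decode-encode
decode-place nB0 = decode-encode
decode-place nBlast = decode-encode
decode-place nC = decode-encode
decode-place nD = decode-encode
decode-place (nB _) = decode-encode
decode-place (nB' _) v = decode-encode (reflect v)

family≃ : (nm : Name (suc s)) → arc (nameState nm) ≃ family (suc s) nm
family≃ {s} nm = iso (place nm) λ u v → sym (trans
  (cong₂ (labArcs (suc s) nm) (decode-place nm u) (decode-place nm v)) (lab-arcs nm u v))

-- The catalogue is 2-geodetic

cornerX cornerY : State → Fin 3
cornerX c = proj₂ (attX c)
cornerY c = proj₂ (attY c)

-- The arc between a pair and the triangle always completes the matching: an `X` vertex has exactly
-- one out-arc, to its partner or to a corner, and a `Y` vertex exactly one in-arc.
Polarised : State → Set
Polarised c = proj₁ (attX c) ≡ matched c × proj₁ (attY c) ≡ not (matched c)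

-- Two matched indices must avoid the shortcut from a `Y` vertex through a corner to an `X` vertex.
-- For a matched and an unmatched one, shortcuts and double 2-walks exclude two of the three
-- relative positions of the corners, which leaves these equations. Two unmatched indices do not
-- occur in the catalogue.
Amicable : State → State → Set
Amicable c d = go (matched c) (matched d)
  where
  go : Bool → Bool → Set
  go true true = cornerX c ≢ cornerY d
  go true false = cornerY d ≡ next (cornerX c) × cornerY c ≡ next (cornerX d)
  go false true = cornerY c ≡ next (cornerX d) × cornerY d ≡ next (cornerX c)
  go false false = ⊥

next≢ : ∀ t → t ≢ next t
next≢ 0F ()
next≢ 1F ()
next≢ 2F ()

next²≢ : ∀ t → next (next t) ≢ t
next²≢ 0F ()
next²≢ 1F ()
next²≢ 2F ()

module Realise {s} (f : Fin s → State) (polar : ∀ i → Polarised (f i))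
  (amicable : ∀ i j → i ≢ j → Amicable (f i) (f j)) where

  private
    m : Fin s → Bool
    m i = matched (f i)
    px py : Fin s → Fin 3
    px i = cornerX (f i)
    py i = cornerY (f i)

    -- Arcs are presented with their conditions on matching and corners, so that the exclusion of
    -- each double walk is a pattern match on the types of its arcs.
    data Arc : Vtx s → Vtx s → Set where
      tt : ∀ {t t'} → next t ≡ t' → Arc (▵ t) (▵ t')
      tx : ∀ {t i} → m i ≡ true → px i ≡ t → Arc (▵ t) (X i)
      xt : ∀ {t i} → m i ≡ false → px i ≡ t → Arc (X i) (▵ t)
      ty : ∀ {t i} → m i ≡ false → py i ≡ t → Arc (▵ t) (Y i)
      yt : ∀ {t i} → m i ≡ true → py i ≡ t → Arc (Y i) (▵ t)
      xy : ∀ {i} → m i ≡ true → Arc (X i) (Y i)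
      yx : ∀ {i j} → (i ≡ j → m i ≡ true → ⊥) → Arc (Y j) (X i)

    view : ∀ u v → arc f u v ≡ true → Arc u v
    view (▵ t) (▵ t') e = tt (==⇒≡ e)
    view (▵ t) (X i) e = let a , b = ∧-true {proj₁ (attX (f i))} e in tx (trans (sym (proj₁ (polar i))) a) (==⇒≡ b)
    view (▵ t) (Y i) e = let a , b = ∧-true {proj₁ (attY (f i))} e in ty (not-true (trans (sym (proj₂ (polar i))) a)) (==⇒≡ b)
    view (X i) (▵ t) e = let a , b = ∧-true {not (proj₁ (attX (f i)))} e in xt (trans (sym (proj₁ (polar i))) (not-true a)) (==⇒≡ b)
    view (Y i) (▵ t) e = let a , b = ∧-true {not (proj₁ (attY (f i)))} e in
      yt (not-false (trans (sym (proj₂ (polar i))) (not-true a))) (==⇒≡ b)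
    view (X i) (Y j) e with ∧-true {i == j} e
    ... | a , b with ==⇒≡ {i = i} {j} a
    ...   | refl = xy b
    view (Y j) (X i) e = yx λ { refl mi → true≢false (cong₂ _∧_ (==-refl i) mi) (not-true e) }

    both : ∀ i j → i ≢ j → m i ≡ true → m j ≡ true → px i ≢ py j
    both i j ne mi mj with matched (f i) | matched (f j) | amicable i j ne | mi | mj
    ... | true | true | h | _ | _ = h

    mixed : ∀ i j → m i ≡ true → m j ≡ false → py j ≡ next (px i) × py i ≡ next (px j)
    mixed i j mi mj with matched (f i) | matched (f j) | amicable i j (λ { refl → true≢false mi mj }) | mi | mj
    ... | true | false | h | _ | _ = h

    neither : ∀ i j → m i ≡ false → m j ≡ false → i ≡ j
    neither i j mi mj with i ≟ j
    ... | yes e = e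
    ... | no ne with matched (f i) | matched (f j) | amicable i j ne | mi | mj
    ...   | false | false | h | _ | _ = contradiction h (λ h → h)

    digon : ∀ {u v} → Arc u v → Arc v u → ⊥
    digon (tt {t} refl) (tt e) = next²≢ t e
    digon (tx a _) (xt b _) = true≢false a b
    digon (xt a _) (tx b _) = true≢false b a
    digon (ty a _) (yt b _) = true≢false b a
    digon (yt a _) (ty b _) = true≢false a b
    digon (xy a) (yx h) = h refl a
    digon (yx h) (xy a) = h refl a

    shortcut : ∀ {u w v} → Arc u w → Arc w v → Arc u v → ⊥
    shortcut (tt {t} refl) (tt refl) (tt e) = next≢ (next t) e
    shortcut (tt {t} refl) (tx _ e) (tx _ e') = next≢ t (trans (sym e') e)
    shortcut (tt {t} refl) (ty _ e) (ty _ e') = next≢ t (trans (sym e') e)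
    shortcut (tx a _) (xt b _) _ = true≢false a b
    shortcut (tx _ _) (xy a) (ty b _) = true≢false a b
    shortcut (ty a _) (yt b _) _ = true≢false b a
    shortcut {t} (ty {i = j} a e) (yx _) (tx {i = i} b e') =
      next≢ _ (trans (trans (sym e) (proj₁ (mixed i j b a))) (cong next e'))
    shortcut (xt {t} _ e) (tt refl) (xt _ e') = next≢ t (trans (sym e) e')
    shortcut (xt a _) (ty _ _) (xy b) = true≢false b a
    shortcut (xy a) (yt _ _) (xt b _) = true≢false a b
    shortcut (yt {t} _ e) (tt refl) (yt _ e') = next≢ t (trans (sym e) e')
    shortcut (yt {i = j} a e) (tx {i = i} b e') (yx h) = both i j (λ { refl → h refl b }) b a (trans e' (sym e))
    shortcut (yx _) (xt {i = i} a e) (yt {i = j} b e') = next≢ _ (trans (trans (sym e') (proj₂ (mixed j i b a))) (cong next e))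

    middle : ∀ {u v w w'} → Arc u w → Arc w v → Arc u w' → Arc w' v → w ≡ w'
    middle (tt refl) _ (tt refl) _ = refl
    middle (tx a _) (xt b _) _ _ = true≢false a b
    middle _ _ (tx a _) (xt b _) = true≢false a b
    middle (ty a _) (yt b _) _ _ = true≢false b a
    middle _ _ (ty a _) (yt b _) = true≢false b a
    middle (tt {t} refl) (tx {i = i} a e) (ty {i = j} b e') (yx _) = contradiction (trans (cong next (sym e)) (trans (sym (proj₁ (mixed i j a b))) e')) (next²≢ t)
    middle (ty {i = j} b e') (yx _) (tt {t} refl) (tx {i = i} a e) = contradiction (trans (cong next (sym e)) (trans (sym (proj₁ (mixed i j a b))) e')) (next²≢ t)
    middle (ty {i = i} a _) (yx _) (ty {i = j} b _) (yx _) = cong Y (neither i j a b)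
    middle (tt _) (ty a _) (tx b _) (xy c) = true≢false c a
    middle (tx b _) (xy c) (tt _) (ty a _) = true≢false c a
    middle (tx _ _) (xy _) (tx _ _) (xy _) = refl
    middle (xt _ refl) _ (xt _ refl) _ = refl
    middle (xt a _) _ (xy b) _ = true≢false b a
    middle (xy b) _ (xt a _) _ = true≢false b a
    middle (xy _) _ (xy _) _ = refl
    middle (yt _ refl) _ (yt _ refl) _ = refl
    middle (yt {i = j} a refl) (tt refl) (yx _) (xt {i = i} b e) =
      contradiction (trans (cong next (sym e)) (sym (proj₂ (mixed j i a b)))) (next²≢ (py j))
    middle (yx _) (xt {i = i} b e) (yt {i = j} a refl) (tt refl) =
      contradiction (trans (cong next (sym e)) (sym (proj₂ (mixed j i a b)))) (next²≢ (py j))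
    middle (yx _) (xt {i = i} a _) (yx _) (xt {i = j} b _) = cong X (neither i j a b)
    middle (yt _ _) (ty a _) (yx _) (xy b) = true≢false b a
    middle (yx _) (xy b) (yt _ _) (ty a _) = true≢false b a
    middle (yx _) (xy _) (yx _) (xy _) = refl

  geodetic : Geodetic₂ (arc f)
  geodetic = record
    { no-loop = λ u e → digon (view u u e) (view u u e)
    ; no-digon = λ u v a b → digon (view u v a) (view v u b)
    ; no-shortcut = λ u w v a b c → shortcut (view u w a) (view w v b) (view u v c)
    ; unique-middle = λ u v w w' a b c d → middle (view u w a) (view w v b) (view u w' c) (view w' v d) }

  private
    corner-pred : ∀ t → arc f (▵ (next (next t))) (▵ t) ≡ true
    corner-pred 0F = refl
    corner-pred 1F = refl
    corner-pred 2F = refl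

    corner-arc : ∀ (d : Bool) (t : Fin 3) → d ≡ true → d ∧ (t == t) ≡ true
    corner-arc d t e = trans (cong (_∧ (t == t)) e) (==-refl t)

    other : 2 ≤ s → ∀ i → ∃ λ j → j ≢ i
    other 2≤s i = let j , ne = fresh 2≤s (λ { 0F → i }) in j , ne 0F

    across : ∀ i j → i ≢ j → arc f (Y j) (X i) ≡ true
    across i j ne = cong (λ b → not (b ∧ matched (f i))) (≢⇒== ne)

  predecessors : 2 ≤ s → HasPredecessors (arc f)
  predecessors 2≤s (▵ t) = ▵ (next (next t)) , corner-pred t
  predecessors 2≤s (X i) = let j , ne = other 2≤s i in Y j , across i j (ne ∘ sym)
  predecessors 2≤s (Y i) with matched (f i) in eq | polar i
  ... | true | _ = X i , cong₂ _∧_ (==-refl i) eq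
  ... | false | _ , e = ▵ (py i) , corner-arc (proj₁ (attY (f i))) (py i) e

  successors : 2 ≤ s → HasSuccessors (arc f)
  successors 2≤s (▵ t) = ▵ (next t) , ==-refl (next t)
  successors 2≤s (Y j) = let i , ne = other 2≤s j in X i , across i j ne
  successors 2≤s (X i) with matched (f i) in eq | polar i
  ... | true | _ = Y i , cong₂ _∧_ (==-refl i) eq
  ... | false | e , _ = ▵ (px i) , corner-arc (not (proj₁ (attX (f i)))) (px i) (cong not e)

form-cases : (P : State → Set) → ∀ k (p : Fin s → Bool) → P (major k 0F) → P (minor k 0F) → ∀ i → P (form k p i)
form-cases P k p h h' i with p i
... | true = h
... | false = h'

form-amicable : ∀ k (p : Fin s → Bool) → Amicable (major k 0F) (major k 0F) → Amicable (major k 0F) (minor k 0F) →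
  Amicable (minor k 0F) (major k 0F) → (∀ i j → p i ≡ false → p j ≡ false → i ≢ j → Amicable (minor k 0F) (minor k 0F)) →
  ∀ i j → i ≢ j → Amicable (form k p i) (form k p j)
form-amicable k p MM Mm mM mm i j ne with p i in ei | p j in ej
... | true | true = MM
... | true | false = Mm
... | false | true = mM
... | false | false = mm i j ei ej ne

last-unique : (i j : Fin s) → (suc (toℕ i) <ᵇ s) ≡ false → (suc (toℕ j) <ᵇ s) ≡ false → i ≡ j
last-unique {suc zero} zero zero _ _ = refl
last-unique {suc (suc s)} (suc i) (suc j) a b = cong suc (last-unique i j a b)

first-unique : (i j : Fin s) → (0 <ᵇ toℕ i) ≡ false → (0 <ᵇ toℕ j) ≡ false → i ≡ j
first-unique zero zero _ _ = refl

polarised : (nm : Name (suc s)) → ∀ i → Polarised (nameState nm i)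
polarised nA = form-cases Polarised kA (isMajor nA) (refl , refl) (refl , refl)
polarised nB0 = form-cases Polarised kB (isMajor nB0) (refl , refl) (refl , refl)
polarised nBlast = form-cases Polarised kB (isMajor nBlast) (refl , refl) (refl , refl)
polarised nC = form-cases Polarised kC (isMajor nC) (refl , refl) (refl , refl)
polarised nD = form-cases Polarised kD (isMajor nD) (refl , refl) (refl , refl)
polarised nm@(nB _) = form-cases Polarised kB (isMajor nm) (refl , refl) (refl , refl)
polarised nm@(nB' _) = form-cases Polarised kB' (isMajor nm) (refl , refl) (refl , refl)

B-amicable : (p : Fin s → Bool) → ∀ i j → i ≢ j → Amicable (form kB p i) (form kB p j)
B-amicable p = form-amicable kB p (λ ()) (λ ()) (λ ()) (λ _ _ _ _ _ ())

amicable : (nm : Name (suc s)) → ∀ i j → i ≢ j → Amicable (nameState nm i) (nameState nm j)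
amicable nA = form-amicable kA (isMajor nA) (λ ()) (refl , refl) (refl , refl) (λ i j a b ne → contradiction (last-unique i j a b) ne)
amicable nB0 = B-amicable (isMajor nB0)
amicable nBlast = B-amicable (isMajor nBlast)
amicable nC = form-amicable kC (isMajor nC) (λ ()) (refl , refl) (refl , refl) (λ i j a b ne → contradiction (last-unique i j a b) ne)
amicable nD = form-amicable kD (isMajor nD) (λ ()) (λ ()) (λ ()) (λ i j a b ne → contradiction (first-unique i j a b) ne)
amicable nm@(nB _) = B-amicable (isMajor nm)
amicable nm@(nB' _) = form-amicable kB' (isMajor nm) (λ ()) (λ ()) (λ ()) (λ _ _ _ _ _ ())

module Realised {s} (nm : Name (suc s)) = Realise (nameState nm) (polarised nm) (amicable nm)

-- Sums over the vertices and the size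

sum-++ : ∀ m {n} (f : Fin (m + n) → ℕ) → sum f ≡ ∑[ i < m ] f (i ↑ˡ n) + ∑[ i < n ] f (m ↑ʳ i)
sum-++ zero f = refl
sum-++ (suc m) f = trans (cong (f zero +_) (sum-++ m (f ∘ suc))) (sym (+-assoc (f zero) _ _))

sumV : (Vtx s → ℕ) → ℕ
sumV {s} g = ∑[ t < 3 ] g (▵ t) + (∑[ i < s ] g (X i) + ∑[ i < s ] g (Y i))

sumV-cong : {g h : Vtx s → ℕ} → (∀ v → g v ≡ h v) → sumV g ≡ sumV h
sumV-cong {s} e = cong₂ _+_ (sum-cong-≗ {3} (e ∘ ▵)) (cong₂ _+_ (sum-cong-≗ {s} (e ∘ X)) (sum-cong-≗ {s} (e ∘ Y)))

sum-Vtx : (φ : Vtx s ↔ Fin n) (h : Fin n → ℕ) → sum h ≡ sumV (h ∘ Inverse.to φ)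
sum-Vtx {s} {n} φ h = begin
  sum h
    ≡⟨ ∑-permute h (φ ↔-∘ ↔-sym Vtx↔Fin) ⟩
  sum k
    ≡⟨ trans (sum-++ 3 k) (cong (∑[ t < 3 ] k (t ↑ˡ (s + s)) +_) (sum-++ s (λ i → k (3 ↑ʳ i)))) ⟩
  sumV {s} (k ∘ Inverse.to (Vtx↔Fin {s}))
    ≡⟨ sumV-cong {s} (λ v → cong (h ∘ Inverse.to φ) (Inverse.strictlyInverseʳ (Vtx↔Fin {s}) v)) ⟩
  sumV (h ∘ Inverse.to φ) ∎
  where
  open ≡-Reasoning
  k : Fin (3 + (s + s)) → ℕ
  k w = h (Inverse.to φ (Inverse.from Vtx↔Fin w))

sumV-permute : (β : Vtx s ↔ Vtx s) (g : Vtx s → ℕ) → sumV g ≡ sumV (g ∘ Inverse.to β)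
sumV-permute {s} β g = begin
  sumV g                                             ≡⟨ sumV-cong (λ v → cong g (sym (Inverse.strictlyInverseʳ Vtx↔Fin v))) ⟩
  sumV (g ∘ from ∘ to)                               ≡⟨ sym (sum-Vtx {s} Vtx↔Fin (g ∘ from)) ⟩
  sum (g ∘ from)                                     ≡⟨ sum-Vtx {s} (Vtx↔Fin ↔-∘ β) (g ∘ from) ⟩
  sumV (g ∘ from ∘ to ∘ Inverse.to β)                ≡⟨ sumV-cong {s} (λ v → cong g (Inverse.strictlyInverseʳ Vtx↔Fin (Inverse.to β v))) ⟩
  sumV (g ∘ Inverse.to β) ∎
  where
  open ≡-Reasoning
  to : Vtx s → Fin (3 + (s + s))
  to = Inverse.to Vtx↔Fin
  from : Fin (3 + (s + s)) → Vtx s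
  from = Inverse.from Vtx↔Fin

-- The states only direct the arcs: there are three sides, one attachment for each of the `2 s`
-- vertices off the triangle, and one arc for each of the `s²` pairs across.
sumV-arcs : (f : Fin s → State) → sumV (λ u → sumV (λ v → 𝟙 (arc f u v))) ≡ suc s * suc s + 2
sumV-arcs {s} f = begin
  sumV (λ u → sumV (λ v → 𝟙 (arc f u v)))
    ≡⟨ cong₂ _+_ rows▵ (cong₂ _+_ rowsX rowsY) ⟩
  (3 + (∑[ t < 3 ] ∑[ i < s ] a t i + ∑[ t < 3 ] ∑[ i < s ] b t i)) +
    ((∑[ i < s ] ∑[ t < 3 ] a' i t + ∑[ i < s ] ∑[ j < s ] c i j) +
     (∑[ i < s ] ∑[ t < 3 ] b' i t + ∑[ j < s ] ∑[ i < s ] c' j i))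
    ≡⟨ regroup (∑[ t < 3 ] ∑[ i < s ] a t i) (∑[ t < 3 ] ∑[ i < s ] b t i) (∑[ i < s ] ∑[ t < 3 ] a' i t)
         (∑[ i < s ] ∑[ j < s ] c i j) (∑[ i < s ] ∑[ t < 3 ] b' i t) (∑[ j < s ] ∑[ i < s ] c' j i) ⟩
  3 + (∑[ t < 3 ] ∑[ i < s ] a t i + ∑[ i < s ] ∑[ t < 3 ] a' i t) +
    (∑[ t < 3 ] ∑[ i < s ] b t i + ∑[ i < s ] ∑[ t < 3 ] b' i t) +
    (∑[ i < s ] ∑[ j < s ] c i j + ∑[ j < s ] ∑[ i < s ] c' j i)
    ≡⟨ cong₂ _+_ (cong₂ (λ x y → 3 + x + y)
         (attached a a' (attX ∘ f) (λ _ _ → refl) (λ _ _ → refl))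
         (attached b b' (attY ∘ f) (λ _ _ → refl) (λ _ _ → refl))) across ⟩
  3 + s + s + s * s
    ≡⟨ square s ⟩
  suc s * suc s + 2 ∎
  where
  open ≡-Reasoning
  a b : Fin 3 → Fin s → ℕ
  a t i = 𝟙 (arc f (▵ t) (X i))
  b t i = 𝟙 (arc f (▵ t) (Y i))
  a' b' : Fin s → Fin 3 → ℕ
  a' i t = 𝟙 (arc f (X i) (▵ t))
  b' i t = 𝟙 (arc f (Y i) (▵ t))
  c c' : Fin s → Fin s → ℕ
  c i j = 𝟙 (arc f (X i) (Y j))
  c' j i = 𝟙 (arc f (Y j) (X i))
  regroup : ∀ p q p' x q' y → (3 + (p + q)) + ((p' + x) + (q' + y)) ≡ 3 + (p + p') + (q + q') + (x + y)
  regroup = solve-∀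
  square : ∀ s → 3 + s + s + s * s ≡ suc s * suc s + 2
  square = solve-∀
  zeros : ∑[ i < s ] 0 ≡ 0
  zeros = sum-zero {s} (λ _ → refl)
  rows▵ : ∑[ t < 3 ] sumV (λ v → 𝟙 (arc f (▵ t) v)) ≡ 3 + (∑[ t < 3 ] ∑[ i < s ] a t i + ∑[ t < 3 ] ∑[ i < s ] b t i)
  rows▵ = trans (∑-distrib-+ {3} (λ t → ∑[ t' < 3 ] 𝟙 (arc f (▵ t) (▵ t'))) (λ t → ∑[ i < s ] a t i + ∑[ i < s ] b t i))
    (cong (3 +_) (∑-distrib-+ {3} (λ t → ∑[ i < s ] a t i) (λ t → ∑[ i < s ] b t i)))
  rowsX : ∑[ i < s ] sumV (λ v → 𝟙 (arc f (X i) v)) ≡ ∑[ i < s ] ∑[ t < 3 ] a' i t + ∑[ i < s ] ∑[ j < s ] c i j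
  rowsX = trans (sum-cong-≗ {s} (λ i → cong (∑[ t < 3 ] a' i t +_) (cong (_+ ∑[ j < s ] c i j) zeros)))
    (∑-distrib-+ (λ i → ∑[ t < 3 ] a' i t) (λ i → ∑[ j < s ] c i j))
  rowsY : ∑[ i < s ] sumV (λ v → 𝟙 (arc f (Y i) v)) ≡ ∑[ i < s ] ∑[ t < 3 ] b' i t + ∑[ j < s ] ∑[ i < s ] c' j i
  rowsY = trans (sum-cong-≗ {s} (λ i → cong (∑[ t < 3 ] b' i t +_) (trans (cong (∑[ j < s ] c' i j +_) zeros) (+-identityʳ _))))
    (∑-distrib-+ (λ i → ∑[ t < 3 ] b' i t) (λ j → ∑[ i < s ] c' j i))
  once : ∀ α → ∑[ t < 3 ] 𝟙 (fromCorner α t) + ∑[ t < 3 ] 𝟙 (toCorner α t) ≡ 1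
  once (true , 0F) = refl
  once (true , 1F) = refl
  once (true , 2F) = refl
  once (false , 0F) = refl
  once (false , 1F) = refl
  once (false , 2F) = refl
  attached : (a : Fin 3 → Fin s → ℕ) (a' : Fin s → Fin 3 → ℕ) (att : Fin s → Attachment) →
    (∀ t i → a t i ≡ 𝟙 (fromCorner (att i) t)) → (∀ i t → a' i t ≡ 𝟙 (toCorner (att i) t)) →
    ∑[ t < 3 ] ∑[ i < s ] a t i + ∑[ i < s ] ∑[ t < 3 ] a' i t ≡ s
  attached a a' att h h' = begin
    ∑[ t < 3 ] ∑[ i < s ] a t i + ∑[ i < s ] ∑[ t < 3 ] a' i t
      ≡⟨ cong (_+ ∑[ i < s ] ∑[ t < 3 ] a' i t) (∑-comm a) ⟩
    ∑[ i < s ] ∑[ t < 3 ] a t i + ∑[ i < s ] ∑[ t < 3 ] a' i t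
      ≡⟨ sym (∑-distrib-+ (λ i → ∑[ t < 3 ] a t i) (λ i → ∑[ t < 3 ] a' i t)) ⟩
    ∑[ i < s ] (∑[ t < 3 ] a t i + ∑[ t < 3 ] a' i t)
      ≡⟨ sum-cong-≗ {s} (λ i → trans (cong₂ _+_ (sum-cong-≗ {3} (λ t → h t i)) (sum-cong-≗ {3} (h' i))) (once (att i))) ⟩
    ∑[ i < s ] 1
      ≡⟨ trans (sum-const s 1) (*-identityʳ s) ⟩
    s ∎
  across : ∑[ i < s ] ∑[ j < s ] c i j + ∑[ j < s ] ∑[ i < s ] c' j i ≡ s * s
  across = begin
    ∑[ i < s ] ∑[ j < s ] c i j + ∑[ j < s ] ∑[ i < s ] c' j i
      ≡⟨ cong (∑[ i < s ] ∑[ j < s ] c i j +_) (∑-comm c') ⟩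
    ∑[ i < s ] ∑[ j < s ] c i j + ∑[ i < s ] ∑[ j < s ] c' j i
      ≡⟨ sym (∑∑-distrib-+ c (λ i j → c' j i)) ⟩
    ∑[ i < s ] ∑[ j < s ] (c i j + c' j i)
      ≡⟨ sum-cong-≗ {s} (λ i → trans (sum-cong-≗ {s} (λ j → one ((i == j) ∧ matched (f i)))) (trans (sum-const s 1) (*-identityʳ s))) ⟩
    ∑[ i < s ] s
      ≡⟨ sum-const s s ⟩
    s * s ∎
    where
    one : ∀ b → 𝟙 b + 𝟙 (not b) ≡ 1
    one true = refl
    one false = refl

-- Walks against local conditions, and transport along isomorphisms

Geodetic₂⇒Geodetic : {G : Digraph n} → Geodetic₂ G → Geodetic 2 G
Geodetic₂⇒Geodetic {G = G} geo = go
  where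
  open Geodetic₂ geo
  arc? : ∀ {u v} → IsTrue (G u v) → G u v ≡ true
  arc? = Equivalence.to Bool.T-≡
  go : Geodetic 2 G
  go u v [] [] _ _ _ _ = refl
  go u .u [] (_ ∷ []) _ _ stop (step a stop) = contradiction (arc? a) (no-loop u)
  go u .u [] (w ∷ _ ∷ []) _ _ stop (step a (step b stop)) = contradiction (arc? b) (no-digon u w (arc? a))
  go u .u (_ ∷ []) [] _ _ (step a stop) stop = contradiction (arc? a) (no-loop u)
  go u .u (w ∷ _ ∷ []) [] _ _ (step a (step b stop)) stop = contradiction (arc? b) (no-digon u w (arc? a))
  go u v (_ ∷ []) (_ ∷ []) _ _ (step _ stop) (step _ stop) = refl
  go u v (_ ∷ []) (w ∷ _ ∷ []) _ _ (step a stop) (step b (step c stop)) = contradiction (arc? a) (no-shortcut u w v (arc? b) (arc? c))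
  go u v (w ∷ _ ∷ []) (_ ∷ []) _ _ (step b (step c stop)) (step a stop) = contradiction (arc? a) (no-shortcut u w v (arc? b) (arc? c))
  go u v (w ∷ _ ∷ []) (w' ∷ _ ∷ []) _ _ (step a (step b stop)) (step c (step d stop)) =
    cong (_∷ v ∷ []) (unique-middle u v w w' (arc? a) (arc? b) (arc? c) (arc? d))
  go u v (_ ∷ _ ∷ _ ∷ _) _ (s≤s (s≤s ())) _ _ _
  go u v _ (_ ∷ _ ∷ _ ∷ _) _ (s≤s (s≤s ())) _ _

Geodetic⇒Geodetic₂ : {G : Digraph n} → Loopless G → Geodetic 2 G → Geodetic₂ G
Geodetic⇒Geodetic₂ {G = G} loopless geo = record
  { no-loop = λ u a → true≢false a (loopless u)
  ; no-digon = λ u v a b → contradiction (geo u u [] (v ∷ u ∷ []) z≤n ≤-refl stop (path a b)) λ ()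
  ; no-shortcut = λ u w v a b c → contradiction (geo u v (v ∷ []) (w ∷ v ∷ []) (s≤s z≤n) ≤-refl (step (arc! c) stop) (path a b)) λ ()
  ; unique-middle = λ u v w w' a b c d → ∷-injectiveˡ (geo u v (w ∷ v ∷ []) (w' ∷ v ∷ []) ≤-refl ≤-refl (path a b) (path c d)) }
  where
  open import Data.List.Properties using (∷-injectiveˡ)
  arc! : ∀ {u v} → G u v ≡ true → IsTrue (G u v)
  arc! = Equivalence.from Bool.T-≡
  path : ∀ {u w v} → G u w ≡ true → G w v ≡ true → WalkFrom G u (w ∷ v ∷ []) v
  path a b = step (arc! a) (step (arc! b) stop)

predecessors-≃ : {V W : Set} {G : V → V → Bool} {H : W → W → Bool} → G ≃ H → HasPredecessors G → HasPredecessors H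
predecessors-≃ {H = H} (iso φ h) pred w = let u , a = pred (from w) in
  to u , trans (cong (H (to u)) (sym (strictlyInverseˡ w))) (trans (sym (h _ _)) a)
  where open Inverse φ

successors-≃ : {V W : Set} {G : V → V → Bool} {H : W → W → Bool} → G ≃ H → HasSuccessors G → HasSuccessors H
successors-≃ {H = H} (iso φ h) succ w = let u , a = succ (from w) in
  to u , trans (cong (λ w → H w (to u)) (sym (strictlyInverseˡ w))) (trans (sym (h _ _)) a)
  where open Inverse φ

arcs-≃ : {f : Fin s → State} {G : Digraph n} → arc f ≃ G → size G ≡ suc s * suc s + 2
arcs-≃ {s} {n} {f} {G} (iso φ h) = begin
  size G
    ≡⟨ size-sum G ⟩
  ∑[ u < n ] ∑[ v < n ] 𝟙 (G u v)
    ≡⟨ sum-Vtx φ (λ u → ∑[ v < n ] 𝟙 (G u v)) ⟩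
  sumV (λ u → ∑[ v < n ] 𝟙 (G (to u) v))
    ≡⟨ sumV-cong {s} (λ u → trans (sum-Vtx φ (λ v → 𝟙 (G (to u) v))) (sumV-cong {s} (λ v → cong 𝟙 (sym (h u v))))) ⟩
  sumV (λ u → sumV (λ v → 𝟙 (arc f u v)))
    ≡⟨ sumV-arcs f ⟩
  suc s * suc s + 2 ∎
  where
  open ≡-Reasoning
  open Inverse φ

square : ∀ s → suc s * suc s + 2 ≡ suc s ^ 2 + 2
square s = cong (λ x → suc s * x + 2) (sym (*-identityʳ (suc s)))

family-qualifies : 4 ≤ s → (nm : Name (suc s)) → Qualifies (suc s) (family (suc s) nm)
family-qualifies {s} 4≤s nm =
  (λ v → ¬true⇒false (Geodetic₂.no-loop geo v)) ,
  Geodetic₂⇒Geodetic geo ,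
  trans (arcs-≃ e) (square s) ,
  predecessors-≃ e (Realised.predecessors nm 2≤s) ,
  successors-≃ e (Realised.successors nm 2≤s)
  where
  e = family≃ nm
  2≤s = ≤-trans (s≤s (s≤s z≤n)) 4≤s
  geo = Geodetic₂-≃ (≃-sym e) (Realised.geodetic nm)

classification : 4 ≤ suc s → (G : Digraph (2 * suc (suc s) + 1)) → Qualifies (suc (suc s)) G →
  ∃ λ (nm : Name (suc (suc s))) → Iso G (family (suc (suc s)) nm)
classification {s} 4≤ G (loopless , geodetic , size≡ , preds , succs) =
  let f , e = structure G geo preds succs (suc s) 4≤ refl (trans (sym (size-sum G)) (trans size≡ (sym (square (suc s)))))
      nm , e' = classify 4≤ f (Geodetic₂-≃ e geo) (predecessors-≃ (≃-sym e) preds) (successors-≃ (≃-sym e) succs)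
      iso φ h = ≃-trans (≃-sym e) (≃-trans e' (family≃ nm))
  in nm , φ , h
  where
  geo : Geodetic₂ G
  geo = Geodetic⇒Geodetic₂ loopless geodetic

-- Degrees separate the catalogue

outV inV : (Vtx s → Vtx s → Bool) → Vtx s → ℕ
outV G v = sumV (λ w → 𝟙 (G v w))
inV G v = sumV (λ u → 𝟙 (G u v))

module _ {s} {G H : Vtx s → Vtx s → Bool} (e : G ≃ H) where
  open _≃_ e
  open Inverse bij

  outV-≃ : ∀ v → outV H (to v) ≡ outV G v
  outV-≃ v = trans (sumV-permute bij (λ w → 𝟙 (H (to v) w))) (sumV-cong {s} (λ w → cong 𝟙 (sym (arcs v w))))

  inV-≃ : ∀ v → inV H (to v) ≡ inV G v
  inV-≃ v = trans (sumV-permute bij (λ u → 𝟙 (H u (to v)))) (sumV-cong {s} (λ u → cong 𝟙 (sym (arcs u v))))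

sends receives : State → Fin 3 → Bool
sends c t = fromX t c ∨ fromY t c
receives c t = toX t c ∨ toY t c

module Degrees {s} (nm : Name (suc s)) where

  private
    k = kindOf nm
    p = isMajor nm
    f = nameState nm
    G = arc f
  a b : ℕ
  a = count p
  b = count (not ∘ p)

  a+b : a + b ≡ s
  a+b = count-not p

  private
    zeros : ∑[ i < s ] 0 ≡ 0
    zeros = sum-zero {s} (λ _ → refl)

    corner-sum : ∀ (d : Bool) t → ∑[ t' < 3 ] 𝟙 (d ∧ (t == t')) ≡ 𝟙 d
    corner-sum true 0F = refl
    corner-sum true 1F = refl
    corner-sum true 2F = refl
    corner-sum false t = refl

    row : ∀ (m : Bool) i → ∑[ j < s ] 𝟙 ((i == j) ∧ m) ≡ 𝟙 m
    row m i = trans (sum-cong-≗ {s} (λ j → trans (𝟙-∧ (i == j) m) (cong (λ b → 𝟙 b * 𝟙 m) (==-sym i j)))) (sum-δ i (λ _ → 𝟙 m))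

    row-not : ∀ (m : Bool) i → 𝟙 m + ∑[ j < s ] 𝟙 (not ((i == j) ∧ m)) ≡ s
    row-not m i = trans (cong (_+ ∑[ j < s ] 𝟙 (not ((i == j) ∧ m))) (sym (row m i))) (count-not (λ j → (i == j) ∧ m))

    column : ∀ (m : Fin s → Bool) j → ∑[ i < s ] 𝟙 ((i == j) ∧ m i) ≡ 𝟙 (m j)
    column m j = trans (sum-cong-≗ {s} (λ i → 𝟙-∧ (i == j) (m i))) (sum-δ j (𝟙 ∘ m))

    column-not : ∀ (m : Fin s → Bool) j → 𝟙 (m j) + ∑[ i < s ] 𝟙 (not ((i == j) ∧ m i)) ≡ s
    column-not m j = trans (cong (_+ ∑[ i < s ] 𝟙 (not ((i == j) ∧ m i))) (sym (column m j))) (count-not (λ i → (i == j) ∧ m i))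

    complement : ∀ m → 𝟙 (not m) + 𝟙 m ≡ 1
    complement true = refl
    complement false = refl

  -- Polarisation makes the degrees off the triangle the same throughout the catalogue: out 1 and in
  -- `s` on `X`, out `s` and in 1 on `Y`. Only the degrees of the corners can distinguish its
  -- members.
  outX : ∀ i → outV G (X i) ≡ 1
  outX i = trans (cong₂ _+_ (trans (corner-sum (not (proj₁ (attX (f i)))) (proj₂ (attX (f i)))) (cong (𝟙 ∘ not) (proj₁ (polarised nm i))))
      (cong₂ _+_ zeros (row (matched (f i)) i))) (complement (matched (f i)))

  inX : ∀ i → inV G (X i) ≡ s
  inX i = trans (cong₂ _+_ (trans (corner-sum (proj₁ (attX (f i))) (proj₂ (attX (f i)))) (cong 𝟙 (proj₁ (polarised nm i))))
      (cong (_+ ∑[ j < s ] 𝟙 (arc f (Y j) (X i))) zeros)) (row-not (matched (f i)) i)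

  outY : ∀ i → outV G (Y i) ≡ s
  outY i = trans (cong₂ _+_ (trans (corner-sum (not (proj₁ (attY (f i)))) (proj₂ (attY (f i))))
        (cong 𝟙 (trans (cong not (proj₂ (polarised nm i))) (Bool.not-involutive (matched (f i))))))
      (trans (cong (∑[ j < s ] 𝟙 (arc f (Y i) (X j)) +_) zeros) (+-identityʳ _))) (column-not (matched ∘ f) i)

  inY : ∀ i → inV G (Y i) ≡ 1
  inY i = trans (cong₂ _+_ (trans (corner-sum (proj₁ (attY (f i))) (proj₂ (attY (f i)))) (cong 𝟙 (proj₂ (polarised nm i))))
      (trans (cong₂ _+_ (column (matched ∘ f) i) zeros) (+-identityʳ (𝟙 (matched (f i)))))) (complement (matched (f i)))

  private
    -- A polarised pair is entered from the triangle once, at its `X` vertex if matched and at its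
    -- `Y` vertex otherwise, so the disjunction in `sends` loses no multiplicity.
    disjoint-from : ∀ c t → Polarised c → 𝟙 (fromCorner (attX c) t) + 𝟙 (fromCorner (attY c) t) ≡ 𝟙 (sends c t)
    disjoint-from (state true (_ , x) (_ , y)) t (refl , refl) = trans (+-identityʳ _) (cong 𝟙 (sym (Bool.∨-identityʳ (x == t))))
    disjoint-from (state false (_ , x) (_ , y)) t (refl , refl) = refl

    disjoint-to : ∀ c t → Polarised c → 𝟙 (toCorner (attX c) t) + 𝟙 (toCorner (attY c) t) ≡ 𝟙 (receives c t)
    disjoint-to (state true (_ , x) (_ , y)) t (refl , refl) = refl
    disjoint-to (state false (_ , x) (_ , y)) t (refl , refl) = trans (+-identityʳ _) (cong 𝟙 (sym (Bool.∨-identityʳ (x == t))))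

    weighted : (F : State → Bool) → ∑[ i < s ] 𝟙 (F (f i)) ≡ 𝟙 (F (major k 0F)) * a + 𝟙 (F (minor k 0F)) * b
    weighted F = trans (sum-cong-≗ {s} pointwise) (trans (∑-distrib-+ (λ i → x * 𝟙 (p i)) _)
      (sym (cong₂ _+_ (*-distribˡ-sum x (𝟙 ∘ p)) (*-distribˡ-sum y (𝟙 ∘ not ∘ p)))))
      where
      x = 𝟙 (F (major k 0F))
      y = 𝟙 (F (minor k 0F))
      pointwise : ∀ i → 𝟙 (F (f i)) ≡ x * 𝟙 (p i) + y * 𝟙 (not (p i))
      pointwise i with p i
      ... | true = sym (trans (cong₂ _+_ (*-identityʳ x) (*-zeroʳ y)) (+-identityʳ x))
      ... | false = sym (cong₂ _+_ (*-zeroʳ x) (*-identityʳ y))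

    corner-out : ∀ t → ∑[ t' < 3 ] 𝟙 (next t == t') ≡ 1
    corner-out 0F = refl
    corner-out 1F = refl
    corner-out 2F = refl

    corner-in : ∀ t → ∑[ t' < 3 ] 𝟙 (next t' == t) ≡ 1
    corner-in 0F = refl
    corner-in 1F = refl
    corner-in 2F = refl

  outCorner : ∀ t → outV G (▵ t) ≡ suc (𝟙 (sends (major k 0F) t) * a + 𝟙 (sends (minor k 0F) t) * b)
  outCorner t = cong₂ _+_ (corner-out t) (trans (sym (∑-distrib-+ {s} (λ i → 𝟙 (fromCorner (attX (f i)) t)) _))
    (trans (sum-cong-≗ {s} (λ i → disjoint-from (f i) t (polarised nm i))) (weighted (λ c → sends c t))))

  inCorner : ∀ t → inV G (▵ t) ≡ suc (𝟙 (receives (major k 0F) t) * a + 𝟙 (receives (minor k 0F) t) * b)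
  inCorner t = cong₂ _+_ (corner-in t) (trans (sym (∑-distrib-+ {s} (λ i → 𝟙 (toCorner (attX (f i)) t)) _))
    (trans (sum-cong-≗ {s} (λ i → disjoint-to (f i) t (polarised nm i))) (weighted (λ c → receives c t))))

private
  weights-top : ∀ x y a b → 1 ≤ a → 1 ≤ b → 𝟙 x * a + 𝟙 y * b ≡ a + b → x ∧ y ≡ true
  weights-top true true _ _ _ _ _ = refl
  weights-top true false a (suc b) _ _ e = contradiction (+-cancelˡ-≡ a 0 (suc b) (trans (cong (_+ 0) (sym (+-identityʳ a))) e)) λ ()
  weights-top false true (suc a) b _ _ e = contradiction (+-cancelʳ-≡ b 0 (suc a) (trans (sym (+-identityʳ b)) e)) λ ()
  weights-top false false (suc a) b _ _ ()

  weights-one : ∀ x y a → 2 ≤ a → 𝟙 x * a + 𝟙 y * 1 ≡ 1 → y ≡ true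
  weights-one x true _ _ _ = refl
  weights-one true false (suc (suc a)) _ ()
  weights-one true false (suc zero) (s≤s ()) _
  weights-one false false _ _ ()

module _ {s⁻} (nm : Name (suc (suc s⁻))) where
  open Degrees nm
  private
    k = kindOf nm

  -- Out-degree `r` exceeds every degree on the sides and requires a corner from which all `s` pairs
  -- are entered. When both states occur, both would have to be entered from that corner.
  no-top-out : 1 ≤ a → 1 ≤ b → (∀ t → sends (major k 0F) t ∧ sends (minor k 0F) t ≡ false) →
    ∀ v → outV (arc (nameState nm)) v ≢ suc (suc s⁻)
  no-top-out 1≤a 1≤b h (X i) e = contradiction (trans (sym (outX i)) e) λ ()
  no-top-out 1≤a 1≤b h (Y i) e = contradiction (trans (sym (outY i)) e) (<⇒≢ ≤-refl)
  no-top-out 1≤a 1≤b h (▵ t) e = true≢false (weights-top (sends (major k 0F) t) (sends (minor k 0F) t) a b 1≤a 1≤b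
    (trans (ℕ.suc-injective (trans (sym (outCorner t)) e)) (sym a+b))) (h t)

  no-top-in : 1 ≤ a → 1 ≤ b → (∀ t → receives (major k 0F) t ∧ receives (minor k 0F) t ≡ false) →
    ∀ v → inV (arc (nameState nm)) v ≢ suc (suc s⁻)
  no-top-in 1≤a 1≤b h (X i) e = contradiction (trans (sym (inX i)) e) (<⇒≢ ≤-refl)
  no-top-in 1≤a 1≤b h (Y i) e = contradiction (trans (sym (inY i)) e) λ ()
  no-top-in 1≤a 1≤b h (▵ t) e = true≢false (weights-top (receives (major k 0F) t) (receives (minor k 0F) t) a b 1≤a 1≤b
    (trans (ℕ.suc-injective (trans (sym (inCorner t)) e)) (sym a+b))) (h t)

  -- A corner of degree 2 gets exactly one arc beyond the triangle. The majors contribute 0 or at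
  -- least 2, so that arc belongs to the single minor pair, in each of the two directions.
  two-two : 2 ≤ a → b ≡ 1 → ∀ v → outV (arc (nameState nm)) v ≡ 2 → inV (arc (nameState nm)) v ≡ 2 →
    ∃ λ t → v ≡ ▵ t × sends (minor k 0F) t ∧ receives (minor k 0F) t ≡ true
  two-two 2≤a b≡1 (X i) e _ = contradiction (trans (sym (outX i)) e) λ ()
  two-two 2≤a b≡1 (Y i) _ e = contradiction (trans (sym (inY i)) e) λ ()
  two-two 2≤a b≡1 (▵ t) e e' = t , refl , cong₂ _∧_
    (weights-one (sends (major k 0F) t) (sends (minor k 0F) t) a 2≤a (subst (λ b → 𝟙 (sends (major k 0F) t) * a + 𝟙 (sends (minor k 0F) t) * b ≡ 1) b≡1
      (ℕ.suc-injective (trans (sym (outCorner t)) e))))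
    (weights-one (receives (major k 0F) t) (receives (minor k 0F) t) a 2≤a (subst (λ b → 𝟙 (receives (major k 0F) t) * a + 𝟙 (receives (minor k 0F) t) * b ≡ 1) b≡1
      (ℕ.suc-injective (trans (sym (inCorner t)) e'))))

data NotB {r} : Name r → Set where
  isA : NotB nA
  isB' : ∀ j → NotB (nB' j)
  isC : NotB nC
  isD : NotB nD

B-or-not : ∀ {r} (nm : Name r) → kindOf nm ≡ kB ⊎ NotB nm
B-or-not nA = inj₂ isA
B-or-not nB0 = inj₁ refl
B-or-not nBlast = inj₁ refl
B-or-not nC = inj₂ isC
B-or-not nD = inj₂ isD
B-or-not (nB _) = inj₁ refl
B-or-not (nB' j) = inj₂ (isB' j)

minors : ∀ {s} → Name (suc s) → ℕ
minors nm = Degrees.b nm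

majors : ∀ {s} → Name (suc s) → ℕ
majors nm = Degrees.a nm

majors-B' : (j : Fin s⁻) → majors {suc s⁻} (nB' j) ≡ suc (toℕ j)
majors-B' {s⁻} j = count-<ᵇ {suc s⁻} (s≤s (Fin.toℕ≤n j))

one-minor : (nm : Name (suc (suc s⁻))) → majors nm ≡ s⁻ → minors nm ≡ 1
one-minor {s⁻} nm e = +-cancelˡ-≡ s⁻ _ _ (trans (cong (_+ minors nm) (sym e)) (trans (Degrees.a+b nm) (sym (+-comm s⁻ 1))))

module _ (3≤ : 3 ≤ s⁻) where

  private
    N = suc s⁻

    graph : Name (suc N) → Vtx N → Vtx N → Bool
    graph nm = arc (nameState nm)

    majors-A : majors {N} nA ≡ s⁻
    majors-A = count-<ᵇ {N} (n≤1+n s⁻)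
    majors-C : majors {N} nC ≡ s⁻
    majors-C = count-<ᵇ {N} (n≤1+n s⁻)
    majors-D : majors {N} nD ≡ s⁻
    majors-D = count-0<ᵇ {s⁻}

    2≤ : ∀ {nm : Name (suc N)} → majors nm ≡ s⁻ → 2 ≤ majors nm
    2≤ e = ≤-trans (n≤1+n 2) (≤-trans 3≤ (≤-reflexive (sym e)))

    one≤ : ∀ {nm : Name (suc N)} → majors nm ≡ s⁻ → 1 ≤ majors nm × 1 ≤ minors nm
    one≤ {nm} e = ≤-trans (n≤1+n 1) (2≤ {nm} e) , ≤-reflexive (sym (one-minor nm e))

    one≤B' : ∀ j → 1 ≤ majors {N} (nB' j) × 1 ≤ minors {N} (nB' j)
    one≤B' j = ≤-trans (s≤s z≤n) (≤-reflexive (sym (majors-B' j))) ,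
      +-cancelˡ-≤ (majors (nB' j)) _ _ (≤-trans (≤-reflexive (trans (cong (_+ 1) (majors-B' j)) (cong suc (+-comm (toℕ j) 1))))
        (≤-trans (s≤s (Fin.toℕ<n j)) (≤-reflexive (sym (Degrees.a+b (nB' j))))))

  notB-no-top : ∀ {nm : Name (suc N)} → NotB nm → ∀ v → outV (graph nm) v ≢ suc N
  notB-no-top isA = let p , q = one≤ {nA} majors-A in no-top-out nA p q (λ { 0F → refl ; 1F → refl ; 2F → refl })
  notB-no-top (isB' j) = let p , q = one≤B' j in no-top-out (nB' j) p q (λ { 0F → refl ; 1F → refl ; 2F → refl })
  notB-no-top isC = let p , q = one≤ {nC} majors-C in no-top-out nC p q (λ { 0F → refl ; 1F → refl ; 2F → refl })
  notB-no-top isD = let p , q = one≤ {nD} majors-D in no-top-out nD p q (λ { 0F → refl ; 1F → refl ; 2F → refl })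

  A-no-top-in : ∀ v → inV (graph nA) v ≢ suc N
  A-no-top-in = let p , q = one≤ {nA} majors-A in no-top-in nA p q (λ { 0F → refl ; 1F → refl ; 2F → refl })
  C-no-top-in : ∀ v → inV (graph nC) v ≢ suc N
  C-no-top-in = let p , q = one≤ {nC} majors-C in no-top-in nC p q (λ { 0F → refl ; 1F → refl ; 2F → refl })
  D-no-top-in : ∀ v → inV (graph nD) v ≢ suc N
  D-no-top-in = let p , q = one≤ {nD} majors-D in no-top-in nD p q (λ { 0F → refl ; 1F → refl ; 2F → refl })

  A-no-two-two : ∀ v → outV (graph nA) v ≡ 2 → inV (graph nA) v ≡ 2 → ⊥
  A-no-two-two v e e' with two-two nA (2≤ {nA} majors-A) (one-minor nA majors-A) v e e'
  ... | 0F , _ , ()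
  ... | 1F , _ , ()
  ... | 2F , _ , ()

  D-two-two : ∀ v → outV (graph nD) v ≡ 2 → inV (graph nD) v ≡ 2 → v ≡ ▵ 2F
  D-two-two v e e' with two-two nD (2≤ {nD} majors-D) (one-minor nD majors-D) v e e'
  ... | 2F , v≡ , _ = v≡
  ... | 0F , _ , ()
  ... | 1F , _ , ()

  private
    out-one : (nm : Name (suc N)) → minors nm ≡ 1 → ∀ t → sends (major (kindOf nm) 0F) t ≡ false → sends (minor (kindOf nm) 0F) t ≡ true →
      outV (graph nm) (▵ t) ≡ 2
    out-one nm e t x y rewrite Degrees.outCorner nm t | x | y = cong suc (trans (+-identityʳ (minors nm)) e)
    in-one : (nm : Name (suc N)) → minors nm ≡ 1 → ∀ t → receives (major (kindOf nm) 0F) t ≡ false → receives (minor (kindOf nm) 0F) t ≡ true →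
      inV (graph nm) (▵ t) ≡ 2
    in-one nm e t x y rewrite Degrees.inCorner nm t | x | y = cong suc (trans (+-identityʳ (minors nm)) e)

  C-z-degrees : outV (graph nC) (▵ 2F) ≡ 2 × inV (graph nC) (▵ 2F) ≡ 2
  C-z-degrees = out-one nC (one-minor nC majors-C) 2F refl refl , in-one nC (one-minor nC majors-C) 2F refl refl
  D-z-degrees : outV (graph nD) (▵ 2F) ≡ 2 × inV (graph nD) (▵ 2F) ≡ 2
  D-z-degrees = out-one nD (one-minor nD majors-D) 2F refl refl , in-one nD (one-minor nD majors-D) 2F refl refl

  -- In C the vertex of in- and out-degree 2 has a successor of out-degree N, in D it does not.
  C≄D : graph nC ≃ graph nD → ⊥
  C≄D e@(iso φ h) = no-such (to (Y i)) refl sent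
    where
    open Inverse φ
    minor-index : ∃ λ i → not (isMajor {N} nC i) ≡ true
    minor-index = count-witness (≤-reflexive (sym (one-minor nC majors-C)))
    i = proj₁ minor-index
    fixed : to (▵ 2F) ≡ ▵ 2F
    fixed = D-two-two (to (▵ 2F)) (trans (outV-≃ e (▵ 2F)) (proj₁ C-z-degrees)) (trans (inV-≃ e (▵ 2F)) (proj₂ C-z-degrees))
    sent : graph nD (▵ 2F) (to (Y i)) ≡ true
    sent = trans (cong (λ v → graph nD v (to (Y i))) (sym fixed)) (trans (sym (h (▵ 2F) (Y i)))
      (cong (fromY 2F) (cong (λ b → if b then major kC 0F else minor kC 0F) (not-true (proj₂ minor-index)))))
    -- The image of a `Y` vertex keeps its out-degree `N ≥ 4`, whereas the out-neighbours of `▵ 2F`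
    -- in D, which are x and one `X` vertex, have out-degree 1.
    big : ∀ {m} → outV (graph nD) (to (Y i)) ≡ m → 4 ≤ m
    big {m} d = ≤-trans (s≤s 3≤) (≤-reflexive (trans (sym (Degrees.outY {N} nC i)) (trans (sym (outV-≃ e (Y i))) d)))
    no-such : ∀ v → outV (graph nD) (to (Y i)) ≡ outV (graph nD) v → graph nD (▵ 2F) v ≡ true → ⊥
    no-such (▵ 0F) d _ = contradiction (big (trans d (Degrees.outCorner {N} nD 0F))) λ { (s≤s ()) }
    no-such (X j) d _ = contradiction (big (trans d (Degrees.outX {N} nD j))) λ { (s≤s ()) }
    no-such (Y j) _ a = true≢false a (form-cases (λ c → fromY 2F c ≡ false) kD (isMajor nD) refl refl j)

  module _ {nm : Name (suc N)} (B : kindOf nm ≡ kB) where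
    private
      G = graph nm
      out-weight : Kind → Fin 3 → ℕ
      out-weight k t = 𝟙 (sends (major k 0F) t) * majors nm + 𝟙 (sends (minor k 0F) t) * minors nm
      by-kind : (P : Kind → Set) → P kB → P (kindOf nm)
      by-kind P h = subst P (sym B) h

    B-top : outV G (▵ 0F) ≡ suc N
    B-top = trans (Degrees.outCorner nm 0F) (cong suc (trans
      (by-kind (λ k → out-weight k 0F ≡ majors nm + minors nm)
        (cong₂ _+_ (+-identityʳ (majors nm)) (+-identityʳ (minors nm)))) (Degrees.a+b nm)))

    B-z : inV G (▵ 2F) ≡ suc (minors nm)
    B-z = trans (Degrees.inCorner nm 2F) (cong suc
      (by-kind (λ k → 𝟙 (receives (major k 0F) 2F) * majors nm + 𝟙 (receives (minor k 0F) 2F) * minors nm ≡ minors nm) (+-identityʳ _)))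

    B-unique-top : ∀ v → outV G v ≡ suc N → v ≡ ▵ 0F
    B-unique-top (▵ 0F) _ = refl
    B-unique-top (▵ 1F) e = contradiction (trans (sym (trans (Degrees.outCorner nm 1F)
      (by-kind (λ k → suc (out-weight k 1F) ≡ 1) refl))) e) λ ()
    B-unique-top (▵ 2F) e = contradiction (trans (sym (trans (Degrees.outCorner nm 2F)
      (by-kind (λ k → suc (out-weight k 2F) ≡ 1) refl))) e) λ ()
    B-unique-top (X i) e = contradiction (trans (sym (Degrees.outX nm i)) e) λ ()
    B-unique-top (Y i) e = contradiction (trans (sym (Degrees.outY nm i)) e) (<⇒≢ ≤-refl)

    B-into-top : ∀ v → G v (▵ 0F) ≡ true → v ≡ ▵ 2F
    B-into-top (▵ 2F) _ = refl
    B-into-top (X i) e = true≢false e (form-cases (λ c → toX 0F c ≡ false) (kindOf nm) (isMajor nm)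
      (by-kind (λ k → toX 0F (major k 0F) ≡ false) refl) (by-kind (λ k → toX 0F (minor k 0F) ≡ false) refl) i)
    B-into-top (Y i) e = true≢false e (form-cases (λ c → toY 0F c ≡ false) (kindOf nm) (isMajor nm)
      (by-kind (λ k → toY 0F (major k 0F) ≡ false) refl) (by-kind (λ k → toY 0F (minor k 0F) ≡ false) refl) i)

  -- The in-degree of the unique in-neighbour z of the vertex x of out-degree N + 1 recovers t.
  B-majors : ∀ {nm nm' : Name (suc N)} → kindOf nm ≡ kB → kindOf nm' ≡ kB → graph nm ≃ graph nm' → majors nm ≡ majors nm'
  B-majors {nm} {nm'} B B' e@(iso φ h) = +-cancelʳ-≡ (minors nm) _ _ (trans (Degrees.a+b nm)
      (sym (trans (cong (majors nm' +_) minors≡) (Degrees.a+b nm'))))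
    where
    open Inverse φ
    x-fixed : to (▵ 0F) ≡ ▵ 0F
    x-fixed = B-unique-top {nm'} B' (to (▵ 0F)) (trans (outV-≃ e (▵ 0F)) (B-top {nm} B))
    z-fixed : to (▵ 2F) ≡ ▵ 2F
    z-fixed = B-into-top {nm'} B' (to (▵ 2F)) (trans (cong (graph nm' (to (▵ 2F))) (sym x-fixed)) (sym (h (▵ 2F) (▵ 0F))))
    minors≡ : minors nm ≡ minors nm'
    minors≡ = ℕ.suc-injective (trans (sym (B-z {nm} B)) (trans (sym (inV-≃ e (▵ 2F))) (trans (cong (inV (graph nm')) z-fixed) (B-z {nm'} B'))))

  module _ (j : Fin s⁻) where
    private
      G = graph (nB' j)
      open Degrees {N} (nB' j)

    B'-top : inV G (▵ 0F) ≡ suc N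
    B'-top = trans (inCorner 0F) (cong suc (trans (cong₂ _+_ (+-identityʳ a) (+-identityʳ b)) a+b))

    B'-z : outV G (▵ 1F) ≡ suc (minors {N} (nB' j))
    B'-z = trans (outCorner 1F) (cong suc (+-identityʳ b))

    B'-unique-top : ∀ v → inV G v ≡ suc N → v ≡ ▵ 0F
    B'-unique-top (▵ 0F) _ = refl
    B'-unique-top (▵ 1F) e = contradiction (trans (sym (inCorner 1F)) e) λ ()
    B'-unique-top (▵ 2F) e = contradiction (trans (sym (inCorner 2F)) e) λ ()
    B'-unique-top (X i) e = contradiction (trans (sym (inX i)) e) (<⇒≢ ≤-refl)
    B'-unique-top (Y i) e = contradiction (trans (sym (inY i)) e) λ ()

    B'-from-top : ∀ v → G (▵ 0F) v ≡ true → v ≡ ▵ 1F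
    B'-from-top (▵ 1F) _ = refl
    B'-from-top (X i) e = true≢false e (form-cases (λ c → fromX 0F c ≡ false) kB' (isMajor {N} (nB' j)) refl refl i)
    B'-from-top (Y i) e = true≢false e (form-cases (λ c → fromY 0F c ≡ false) kB' (isMajor {N} (nB' j)) refl refl i)

  -- The argument for B read backwards: x is the only vertex of in-degree `N + 1`, and its only
  -- out-neighbour `▵ 1F`, which carries the label z, has an out-degree that reveals the number of
  -- minors.
  B'-majors : ∀ j j' → graph (nB' j) ≃ graph (nB' j') → j ≡ j'
  B'-majors j j' e@(iso φ h) = Fin.toℕ-injective (ℕ.suc-injective (trans (sym (majors-B' j)) (trans majors≡ (majors-B' j'))))
    where
    open Inverse φ
    x-fixed : to (▵ 0F) ≡ ▵ 0F
    x-fixed = B'-unique-top j' (to (▵ 0F)) (trans (inV-≃ e (▵ 0F)) (B'-top j))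
    z-fixed : to (▵ 1F) ≡ ▵ 1F
    z-fixed = B'-from-top j' (to (▵ 1F)) (trans (cong (λ v → graph (nB' j') v (to (▵ 1F))) (sym x-fixed)) (sym (h (▵ 0F) (▵ 1F))))
    minors≡ : minors {N} (nB' j) ≡ minors {N} (nB' j')
    minors≡ = ℕ.suc-injective (trans (sym (B'-z j)) (trans (sym (outV-≃ e (▵ 1F))) (trans (cong (outV (graph (nB' j'))) z-fixed) (B'-z j'))))
    majors≡ : majors {N} (nB' j) ≡ majors {N} (nB' j')
    majors≡ = +-cancelʳ-≡ (minors {N} (nB' j)) _ _ (trans (Degrees.a+b {N} (nB' j))
      (sym (trans (cong (majors {N} (nB' j') +_) minors≡) (Degrees.a+b {N} (nB' j')))))

  same-B : ∀ (nm nm' : Name (suc N)) → kindOf nm ≡ kB → kindOf nm' ≡ kB → majors nm ≡ majors nm' → nm ≡ nm'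
  same-B nm nm' B B' e = same nm nm' B B' (trans (sym (parameter≡ nm B)) (trans e (parameter≡ nm' B')))
    where
    parameter : Name (suc N) → ℕ
    parameter (nB j) = suc (toℕ j)
    parameter nBlast = N
    parameter _ = 0
    parameter≡ : ∀ nm → kindOf nm ≡ kB → majors nm ≡ parameter nm
    parameter≡ nB0 _ = count-<ᵇ {N} z≤n
    parameter≡ nBlast _ = count-<ᵇ {N} ≤-refl
    parameter≡ (nB j) _ = count-<ᵇ {N} (s≤s (Fin.toℕ≤n j))
    same : ∀ nm nm' → kindOf nm ≡ kB → kindOf nm' ≡ kB → parameter nm ≡ parameter nm' → nm ≡ nm'
    same nB0 nB0 _ _ _ = refl
    same nBlast nBlast _ _ _ = refl
    same nBlast (nB j) _ _ e = contradiction (sym (ℕ.suc-injective e)) (<⇒≢ (Fin.toℕ<n j))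
    same (nB j) nBlast _ _ e = contradiction (ℕ.suc-injective e) (<⇒≢ (Fin.toℕ<n j))
    same (nB j) (nB j') _ _ e = cong nB (Fin.toℕ-injective (ℕ.suc-injective e))

  private
    apart-out : ∀ (nm nm' : Name (suc N)) m → graph nm ≃ graph nm' → ∀ v → outV (graph nm) v ≡ m →
      (∀ w → outV (graph nm') w ≢ m) → ⊥
    apart-out nm nm' m e v d none = none (Inverse.to (_≃_.bij e) v) (trans (outV-≃ e v) d)

    apart-in : ∀ (nm nm' : Name (suc N)) m → graph nm ≃ graph nm' → ∀ v → inV (graph nm) v ≡ m →
      (∀ w → inV (graph nm') w ≢ m) → ⊥
    apart-in nm nm' m e v d none = none (Inverse.to (_≃_.bij e) v) (trans (inV-≃ e v) d)

    two-two≄A : ∀ (nm : Name (suc N)) → outV (graph nm) (▵ 2F) ≡ 2 × inV (graph nm) (▵ 2F) ≡ 2 →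
      graph nm ≃ graph nA → ⊥
    two-two≄A nm (d , d') e = A-no-two-two (Inverse.to (_≃_.bij e) (▵ 2F)) (trans (outV-≃ e (▵ 2F)) d) (trans (inV-≃ e (▵ 2F)) d')

  -- A vertex of out-degree `r` singles out B, and among the rest a vertex of in-degree `r` singles
  -- out B′. A vertex with both degrees 2 exists in C and D but not in A. The parameters of B and
  -- B′, and the pair C, D, need the finer invariants above.
  nameState-injective : (nm nm' : Name (suc N)) → graph nm ≃ graph nm' → nm ≡ nm'
  nameState-injective nm nm' e with B-or-not nm | B-or-not nm'
  ... | inj₁ B | inj₁ B' = same-B nm nm' B B' (B-majors {nm} {nm'} B B' e)
  ... | inj₁ B | inj₂ ¬B' = ⊥-elim (apart-out nm nm' (suc N) e (▵ 0F) (B-top {nm} B) (notB-no-top ¬B'))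
  ... | inj₂ ¬B | inj₁ B' = ⊥-elim (apart-out nm' nm (suc N) (≃-sym e) (▵ 0F) (B-top {nm'} B') (notB-no-top ¬B))
  ... | inj₂ isA | inj₂ isA = refl
  ... | inj₂ isC | inj₂ isC = refl
  ... | inj₂ isD | inj₂ isD = refl
  ... | inj₂ (isB' j) | inj₂ (isB' j') = cong nB' (B'-majors j j' e)
  ... | inj₂ (isB' j) | inj₂ isA = ⊥-elim (apart-in nm nm' (suc N) e (▵ 0F) (B'-top j) A-no-top-in)
  ... | inj₂ (isB' j) | inj₂ isC = ⊥-elim (apart-in nm nm' (suc N) e (▵ 0F) (B'-top j) C-no-top-in)
  ... | inj₂ (isB' j) | inj₂ isD = ⊥-elim (apart-in nm nm' (suc N) e (▵ 0F) (B'-top j) D-no-top-in)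
  ... | inj₂ isA | inj₂ (isB' j) = ⊥-elim (apart-in nm' nm (suc N) (≃-sym e) (▵ 0F) (B'-top j) A-no-top-in)
  ... | inj₂ isC | inj₂ (isB' j) = ⊥-elim (apart-in nm' nm (suc N) (≃-sym e) (▵ 0F) (B'-top j) C-no-top-in)
  ... | inj₂ isD | inj₂ (isB' j) = ⊥-elim (apart-in nm' nm (suc N) (≃-sym e) (▵ 0F) (B'-top j) D-no-top-in)
  ... | inj₂ isC | inj₂ isA = ⊥-elim (two-two≄A nC C-z-degrees e)
  ... | inj₂ isD | inj₂ isA = ⊥-elim (two-two≄A nD D-z-degrees e)
  ... | inj₂ isA | inj₂ isC = ⊥-elim (two-two≄A nC C-z-degrees (≃-sym e))
  ... | inj₂ isA | inj₂ isD = ⊥-elim (two-two≄A nD D-z-degrees (≃-sym e))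
  ... | inj₂ isC | inj₂ isD = ⊥-elim (C≄D e)
  ... | inj₂ isD | inj₂ isC = ⊥-elim (C≄D (≃-sym e))

-- The number of names

Name↔Fin : ∀ k → Name (2 + k) ↔ Fin (2 * (2 + k) + 1)
Name↔Fin k = mk↔ₛ′ (cast (count≡ k)) (cast (sym (count≡ k)))
  (Fin.cast-involutive (count≡ k) (sym (count≡ k))) (Fin.cast-involutive (sym (count≡ k)) (count≡ k)) ↔-∘ mk↔ₛ′ to from to-from from-to
  where
  count≡ : ∀ k → 5 + (k + k) ≡ 2 * (2 + k) + 1
  count≡ = solve-∀
  to : Name (2 + k) → Fin (5 + (k + k))
  to nA = 0F
  to nB0 = 1F
  to nBlast = 2F
  to nC = 3F
  to nD = 4F
  to (nB i) = 5 ↑ʳ (i ↑ˡ k)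
  to (nB' i) = 5 ↑ʳ (k ↑ʳ i)
  from : Fin (5 + (k + k)) → Name (2 + k)
  from 0F = nA
  from 1F = nB0
  from 2F = nBlast
  from 3F = nC
  from 4F = nD
  from (suc (suc (suc (suc (suc w))))) = [ nB , nB' ]′ (splitAt k w)
  from-to : ∀ nm → from (to nm) ≡ nm
  from-to nA = refl
  from-to nB0 = refl
  from-to nBlast = refl
  from-to nC = refl
  from-to nD = refl
  from-to (nB i) rewrite Fin.splitAt-↑ˡ k i k = refl
  from-to (nB' i) rewrite Fin.splitAt-↑ʳ k k i = refl
  to-side : ∀ w e → splitAt k w ≡ e → to ([ nB , nB' ]′ e) ≡ 5 ↑ʳ w
  to-side w (inj₁ i) e = cong (5 ↑ʳ_) (Fin.splitAt⁻¹-↑ˡ e)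
  to-side w (inj₂ i) e = cong (5 ↑ʳ_) (Fin.splitAt⁻¹-↑ʳ e)
  to-from : ∀ v → to (from v) ≡ v
  to-from 0F = refl
  to-from 1F = refl
  to-from 2F = refl
  to-from 3F = refl
  to-from 4F = refl
  to-from (suc (suc (suc (suc (suc w))))) = to-side w _ refl

theorem20 : ∀ (r : ℕ) → 5 ≤ r →
    (∀ (nm : Name r) → Qualifies r (family r nm))
    × (∀ (G : Digraph (2 * r + 1)) → Qualifies r G → ∃ λ (nm : Name r) → Iso G (family r nm))
    × (∀ (nm nm' : Name r) → Iso (family r nm) (family r nm') → nm ≡ nm')
    × (Name r ↔ Fin (2 * r + 1))
theorem20 (suc (suc s⁻)) (s≤s 4≤s@(s≤s 3≤s⁻)) =
  family-qualifies 4≤s ,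
  classification 4≤s ,
  (λ { nm nm' (φ , h) → nameState-injective 3≤s⁻ nm nm'
    (≃-trans (family≃ nm) (≃-trans (iso φ h) (≃-sym (family≃ nm')))) }) ,
  Name↔Fin s⁻
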